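{- Let $m$ be a positive integer and let $n\geq 4$ be even. Then \[\mathsf{g}(mK_n^3)=\frac{(n-2)(mn(n-1)-12)}{24}\quad\text{and}\quad \widetilde{\mathsf{g}}(mK_n^3)=\frac{(n-2)(mn(n-1)-12)}{12}.\]
   Context: $mK_n^3$ denotes the $3$-uniform multi-hypergraph on vertex set $[n]$ in which every $3$-element subset of $[n]$ occurs as an edge exactly $m$ times. Its Levi graph is the bipartite graph with one vertex for each element of $[n]$ and one vertex for each of the $m\binom{n}{3}$ edges (copies counted separately), an element $i$ being adjacent to an edge iff $i$ belongs to it. The genus $\mathsf{g}$ (resp. non-orientable genus $\widetilde{\mathsf{g}}$) of a hypergraph is that of its Levi graph. For a graph $G$, $\mathsf{g}(G)$ is the minimum $h$ such that $G$ embeds in the orientable surface of genus $h$, and $\widetilde{\mathsf{g}}(G)$ is the minimum $c$ such that $G$ embeds in the non-orientable surface with $c$ crosscaps, with $\widetilde{\mathsf{g}}(G)=0$ if $G$ is planar. -}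

module Defs where

open import Data.Bool.Base using (Bool; not)
open import Data.Empty using (⊥)
open import Data.Fin.Base using (Fin)
open import Data.Fin.Subset using (Subset; ∣_∣; _∈_)
open import Data.Integer.Base as ℤ using (ℤ; +_)
open import Data.Nat.Base using (ℕ; _≤_; _*_)
open import Data.Product.Base using (Σ; ∃; ∃-syntax; _×_; proj₁)
open import Data.Sum.Base using (_⊎_; inj₁; inj₂)
open import Function.Bundles using (_⇔_; _↔_)
open import Function.Definitions using (Injective; StrictlySurjective)
open import Relation.Binary.Core using (Rel)
open import Relation.Binary.Construct.Closure.ReflexiveTransitive using (Star)
open import Relation.Binary.Definitions using (Irreflexive; Symmetric)
open import Relation.Binary.PropositionalEquality.Core using (_≡_; _≢_)
open import Relation.Nullary.Negation.Core using (¬_)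
open import Level using (0ℓ)

record SimpleGraph : Set₁ where
  field
    Vertex      : Set
    Adjacent    : Rel Vertex 0ℓ
    symmetric   : Symmetric Adjacent
    irreflexive : Irreflexive _≡_ Adjacent

-- Several elements of Edge may be incident with the same set of vertices.
record Hypergraph : Set₁ where
  field
    Vertex   : Set
    Edge     : Set
    Incident : Vertex → Edge → Set

module _ (H : Hypergraph) where
  open Hypergraph H

  LeviAdjacent : Rel (Vertex ⊎ Edge) 0ℓ
  LeviAdjacent (inj₁ v) (inj₁ w) = ⊥
  LeviAdjacent (inj₁ v) (inj₂ e) = Incident v e
  LeviAdjacent (inj₂ e) (inj₁ v) = Incident v e
  LeviAdjacent (inj₂ e) (inj₂ f) = ⊥

  leviGraph : SimpleGraph
  leviGraph = record
    { Vertex      = Vertex ⊎ Edge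
    ; Adjacent    = LeviAdjacent
    ; symmetric   = λ {x} {y} → sym x y
    ; irreflexive = λ {x} {y} → irr x y
    }
    where
    sym : ∀ x y → LeviAdjacent x y → LeviAdjacent y x
    sym (inj₁ v) (inj₂ e) a = a
    sym (inj₂ e) (inj₁ v) a = a

    irr : ∀ x y → x ≡ y → ¬ LeviAdjacent x y
    irr (inj₁ v) (inj₂ e) ()
    irr (inj₂ e) (inj₁ v) ()

-- The 3-element subsets of [ n ], each taken with m labels.
completeHypergraph : (m n : ℕ) → Hypergraph
completeHypergraph m n = record
  { Vertex   = Fin n
  ; Edge     = (∃[ s ] (∣_∣ {n} s ≡ 3)) × Fin m
  ; Incident = λ i e → i ∈ proj₁ (proj₁ e)
  }

-- y lies in the orbit of x under the group generated by f and g, provided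
-- that f and g are involutions.
Orbit₂ : {A : Set} (f g : A → A) → Rel A 0ℓ
Orbit₂ f g = Star (λ x y → y ≡ f x ⊎ y ≡ g x)

Orbit₃ : {A : Set} (f g h : A → A) → Rel A 0ℓ
Orbit₃ f g h = Star (λ x y → y ≡ f x ⊎ y ≡ g x ⊎ y ≡ h x)

-- R is an equivalence relation with finitely many classes, numbered by Fin size.
record Classes {A : Set} (R : Rel A 0ℓ) : Set where
  field
    size       : ℕ
    class      : A → Fin size
    surjective : StrictlySurjective _≡_ class
    classifies : ∀ {x y} → class x ≡ class y ⇔ R x y

-- A finite cell decomposition, with at least one edge, of a connected closed
-- surface.  The flags are the triangles of its barycentric subdivision: each
-- has one corner at a vertex, one at the midpoint of an edge and one in the
-- interior of a face.  The flag τ₀ x (respectively τ₁ x, τ₂ x) is the one glued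
-- to x along the side opposite to the vertex (respectively edge, face) corner.
-- The 1-skeleton may have loops and parallel edges.  Fixed points of the τᵢ
-- would be boundary points of the surface; a fixed point of τ₀ ∘ τ₂ would be an
-- edge folded onto itself.
record CellDecomposition : Set₁ where
  field
    Flag           : Set
    #flags         : ℕ
    finite         : Flag ↔ Fin #flags
    nonempty       : 1 ≤ #flags
    τ₀ τ₁ τ₂       : Flag → Flag
    τ₀-involutive  : ∀ x → τ₀ (τ₀ x) ≡ x
    τ₁-involutive  : ∀ x → τ₁ (τ₁ x) ≡ x
    τ₂-involutive  : ∀ x → τ₂ (τ₂ x) ≡ x
    τ₀-τ₂-commute  : ∀ x → τ₀ (τ₂ x) ≡ τ₂ (τ₀ x)
    τ₀-fixfree     : ∀ x → τ₀ x ≢ x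
    τ₁-fixfree     : ∀ x → τ₁ x ≢ x
    τ₂-fixfree     : ∀ x → τ₂ x ≢ x
    τ₀τ₂-fixfree   : ∀ x → τ₀ (τ₂ x) ≢ x
    connected      : ∀ x y → Orbit₃ τ₀ τ₁ τ₂ x y
    vertices       : Classes (Orbit₂ τ₁ τ₂)
    edges          : Classes (Orbit₂ τ₀ τ₂)
    faces          : Classes (Orbit₂ τ₀ τ₁)

  #vertices #edges #faces : ℕ
  #vertices = Classes.size vertices
  #edges    = Classes.size edges
  #faces    = Classes.size faces

  vertexOf : Flag → Fin #vertices
  vertexOf = Classes.class vertices

  eulerCharacteristic : ℤ
  eulerCharacteristic = (+ #vertices ℤ.- + #edges) ℤ.+ + #faces

  -- The triangles can be oriented so that any two sharing a side are coherent.
  Orientable : Set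
  Orientable = Σ (Flag → Bool) λ orientation → ∀ x →
      orientation (τ₀ x) ≡ not (orientation x)
    × orientation (τ₁ x) ≡ not (orientation x)
    × orientation (τ₂ x) ≡ not (orientation x)

-- A closed connected surface is determined up to homeomorphism by its
-- orientability and its Euler characteristic.

DecomposesOrientable : ℕ → CellDecomposition → Set
DecomposesOrientable h S =
  Orientable × eulerCharacteristic ≡ + 2 ℤ.- + (2 * h)
  where open CellDecomposition S

DecomposesNonOrientable : ℕ → CellDecomposition → Set
DecomposesNonOrientable c S =
  ¬ Orientable × 1 ≤ c × eulerCharacteristic ≡ + 2 ℤ.- + c
  where open CellDecomposition S

-- G is a subgraph of the 1-skeleton of S.  Since G is simple and place is
-- injective, distinct edges of G are automatically sent to distinct edges of S.
-- Vertices and edges of S outside G are allowed, so the faces of G in the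
-- surface need not be discs.
record Subgraph (G : SimpleGraph) (S : CellDecomposition) : Set where
  open SimpleGraph G
  open CellDecomposition S
  field
    place           : Vertex → Fin #vertices
    place-injective : Injective _≡_ _≡_ place
    place-edge      : ∀ {u v} → Adjacent u v →
                      ∃[ x ] (vertexOf x ≡ place u × vertexOf (τ₀ x) ≡ place v)

-- A drawing of G in a surface, possibly with non-cellular faces, is a subcomplex
-- of the 1-skeleton of some cell decomposition of that surface.

EmbedsInOrientable : SimpleGraph → ℕ → Set₁
EmbedsInOrientable G h = ∃[ S ] (DecomposesOrientable h S × Subgraph G S)

EmbedsInNonOrientable : SimpleGraph → ℕ → Set₁
EmbedsInNonOrientable G c = ∃[ S ] (DecomposesNonOrientable c S × Subgraph G S)

Planar : SimpleGraph → Set₁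
Planar G = EmbedsInOrientable G 0

IsLeast : (ℕ → Set₁) → ℕ → Set₁
IsLeast P k = P k × (∀ j → P j → k ≤ j)

GraphGenus : SimpleGraph → ℕ → Set₁
GraphGenus G = IsLeast (EmbedsInOrientable G)

GraphNonOrientableGenus : SimpleGraph → ℕ → Set₁
GraphNonOrientableGenus G c =
    (Planar G × c ≡ 0)
  ⊎ (¬ Planar G × IsLeast (EmbedsInNonOrientable G) c)

-- Genus H g reads: the genus of H is g; likewise for NonOrientableGenus.

Genus : Hypergraph → ℕ → Set₁
Genus H = GraphGenus (leviGraph H)

NonOrientableGenus : Hypergraph → ℕ → Set₁
NonOrientableGenus H = GraphNonOrientableGenus (leviGraph H)

{-# OPTIONS --safe #-}

-- Lower bound.  Let the Levi graph G, with v vertices and e edges, be drawn in a surface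
-- with a cell decomposition into V vertices, E edges and F faces.  Add to G pendant edges
-- of the decomposition until it spans, and merge the faces across all other edges.  This
-- leaves f ≥ F − (E − e − (V − v)) regions.  Since G is bipartite, simple and without
-- vertices of degree 1, every region has at least four sides, whence 4 f ≤ 2 e and
-- V − E + F ≤ v − e / 2.
--
-- Construction.  Equality holds for quadrangulations of the surface by G.  Faces of such
-- a quadrangulation correspond to pairs {a , b} of elements together with a pair of
-- triples containing them, so the embedding is given by a fixed-point free matching
-- mate a b on the copies of the triples through a and b, such that at each element a
-- the matchings mate a b close up into a single circuit.  Write n = 2 k and call the
-- elements xᵢ and yᵢ (i < k).  The triples are the faces of the tetrahedra xᵢ yᵢ xⱼ yⱼ
-- and of the octahedra with antipodal pairs {xᵢ , yᵢ}, {xⱼ , yⱼ}, {xₗ , yₗ}.  Taking the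
-- boundaries of all of them, m times, gives matchings with many circuits; these are
-- joined by composing the matchings of xᵢ and yⱼ with cyclic permutations of triples
-- with equal orientation.  Reversing one tetrahedron destroys orientability and nothing
-- else.

module Submission where

open import Defs
open import Axiom.UniquenessOfIdentityProofs.WithK using (uip)
open import Algebra.Bundles using (CommutativeMonoid; CommutativeRing)
import Algebra.Properties.CommutativeMonoid.Sum as CommutativeMonoidSum
open import Data.Bool.Base using (Bool; true; false; not; _∧_; _xor_; if_then_else_)
import Data.Bool.Properties as Bool
open import Data.Empty using (⊥; ⊥-elim)
open import Data.Fin.Base using (Fin; zero; suc; toℕ; punchOut; punchIn)
import Data.Fin.Permutation as Perm
import Data.Fin.Properties as Fin
open import Data.Fin.Subset using (Subset; inside; outside; ∣_∣; ⁅_⁆; _∪_; _-_) renaming (_∈_ to _∈ₛ_; _⊆_ to _⊆ₛ_)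
import Data.Fin.Subset.Properties as Subset
import Data.Integer.Base as ℤ
import Data.Integer.Properties as ℤ
open import Data.Integer.Tactic.RingSolver renaming (solve-∀ to solve-∀-ℤ)
open import Data.List.Base using (List; []; _∷_; length; lookup; filter; tabulate; allFin; cartesianProduct)
import Data.List.Properties as List
open import Data.List.Membership.Propositional using (_∈_; _∉_)
open import Data.List.Membership.Propositional.Properties using (∈-filter⁺; ∈-filter⁻; ∈-tabulate⁺; ∈-tabulate⁻; ∈-lookup; ∈-allFin; ∈-cartesianProduct⁺)
import Data.List.Membership.DecPropositional as DecMembership
open import Data.List.Relation.Unary.All as All using (All; []; _∷_)
open import Data.List.Relation.Unary.Any as Any using (here; there)
import Data.List.Relation.Unary.Any.Properties as Any
open import Data.List.Relation.Unary.AllPairs using ([]; _∷_)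
open import Data.List.Relation.Unary.Unique.Propositional using (Unique)
import Data.List.Relation.Unary.Unique.Propositional.Properties as Unique
open import Data.Nat.Base using (ℕ; zero; suc; _+_; _*_; _∸_; _≤_; z≤n; s≤s; s≤s⁻¹; _<ᵇ_)
open import Data.Nat.Combinatorics using (_C_; nCk+nC[k+1]≡[n+1]C[k+1]; nC1≡n)
open import Data.Nat.Divisibility.Core using (_∣_; divides)
import Data.Nat.Properties as ℕ
open import Data.Nat.Tactic.RingSolver using (solve-∀)
open import Data.Product.Base using (Σ; ∃-syntax; _×_; _,_; proj₁; proj₂)
open import Data.Product.Function.NonDependent.Propositional using (_×-↔_)
import Data.Product.Properties as Product
open import Data.Sum.Base using (_⊎_; inj₁; inj₂; [_,_]′)
open import Data.Sum.Function.Propositional using (_⊎-↔_)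
open import Data.Vec.Base using ([]; _∷_; here; there)
open import Data.Vec.Properties.WithK using ([]=-irrelevant)
open import Function.Base using (_∘_; id)
open import Function.Bundles using (_↔_; _⇔_; mk↔ₛ′; mk⇔; Inverse; Equivalence)
import Function.Construct.Composition as Compose
import Function.Construct.Symmetry as Symmetry
import Function.Construct.Identity as Identity
open import Function.Definitions using (Injective; StrictlySurjective)
open import Relation.Binary.Core using (Rel)
open import Relation.Binary.Construct.Closure.ReflexiveTransitive using (ε; _◅_; _◅◅_; reverse)
open import Relation.Binary.Definitions using (Decidable; DecidableEquality)
open import Relation.Binary.PropositionalEquality
open import Relation.Binary.Structures using (IsEquivalence)
open import Relation.Nullary using (¬_; Dec; yes; no; contradiction; does; recompute)
open import Relation.Nullary.Decidable using (¬?; _×-dec_; _⊎-dec_; map′; dec-true; dec-false)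
open import Level using (0ℓ)

-- Finite sets

-- A triple either contains an antipodal pair, and is then a face of exactly one tetrahedron, or it
-- meets three pairs, and is then a face of exactly one octahedron; this is where evenness of n
-- enters. The delicate point is that each joining permutation acts in two links at once, that of
-- `xᵢ` and that of `yⱼ`, and must merge circuits in both without joining two circuits twice. The
-- parity `χ` of the order of three indices settles this: it changes when two indices are exchanged,
-- so in each link every octahedron is joined to exactly one tetrahedron. It also gives the
-- orientation of a face, so that orientability survives. Arguments that go around a vertex until
-- something happens are replaced by a parity count (`circuit`), which avoids cyclic orders. The
-- faces of the constructed surface are counted with the help of the lower bound, applied to that
-- surface itself. For n = 2 k the claimed genus is m (1² + ... + (k - 1)²) - (k - 1); in this form
-- it is free of fractions.

Finite : Set → Set
Finite A = ∃[ n ] (A ↔ Fin n)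

↔-injective : {A B : Set} (i : A ↔ B) → Injective _≡_ _≡_ (Inverse.to i)
↔-injective i {x} {y} eq = trans (sym (Inverse.strictlyInverseʳ i x))
  (trans (cong (Inverse.from i) eq) (Inverse.strictlyInverseʳ i y))

↔-card-injective : {A B : Set} {m n : ℕ} → A ↔ Fin m → B ↔ Fin n →
  (f : A → B) → Injective _≡_ _≡_ f → m ≤ n
↔-card-injective i j f f-inj =
  Fin.injective⇒≤ {f = Inverse.to j ∘ f ∘ Inverse.from i}
    (λ eq → ↔-injective (Symmetry.↔-sym i) (f-inj (↔-injective j eq)))

↔-card-surjective : {A B : Set} {m n : ℕ} → A ↔ Fin m → B ↔ Fin n →
  (f : A → B) → (∀ y → ∃[ x ] f x ≡ y) → n ≤ m
↔-card-surjective i j f f-surj = ↔-card-injective j i (proj₁ ∘ f-surj)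
  (λ {x} {y} eq → trans (sym (proj₂ (f-surj x))) (trans (cong f eq) (proj₂ (f-surj y))))

Unique⇒length≤ : {n : ℕ} {xs : List (Fin n)} → Unique xs → length xs ≤ n
Unique⇒length≤ {n} {xs} u = Fin.injective⇒≤ {f = lookup xs} (inj u)
  where
  inj : {ys : List (Fin n)} → Unique ys → Injective _≡_ _≡_ (lookup ys)
  inj (_ ∷ _)  {zero}  {zero}  _  = refl
  inj {y ∷ ys} (y∉ ∷ _) {zero}  {suc j} eq = ⊥-elim (All.lookup y∉ (∈-lookup j) eq)
  inj {y ∷ ys} (y∉ ∷ _) {suc i} {zero}  eq = ⊥-elim (All.lookup y∉ (∈-lookup i) (sym eq))
  inj (_ ∷ u)  {suc i} {suc j} eq = cong suc (inj u eq)

full⇒≤length : {n : ℕ} {xs : List (Fin n)} → (∀ i → i ∈ xs) → n ≤ length xs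
full⇒≤length {n} {xs} full = Fin.injective⇒≤ {f = λ i → Any.index (full i)}
  (λ {i} {j} eq → trans (Any.lookup-index (full i))
    (trans (cong (lookup xs) eq) (sym (Any.lookup-index (full j)))))

Σ-≡true : {A : Set} {P : A → Bool} {x y : A} {p : P x ≡ true} {q : P y ≡ true} →
  x ≡ y → (x , p) ≡ (_,_ {B = λ z → P z ≡ true} y q)
Σ-≡true {p = p} {q} refl = cong (_ ,_) (uip p q)

private
  Fin-filter : (n : ℕ) (P : Fin n → Bool) → Finite (∃[ i ] P i ≡ true)
  Fin-filter zero P = 0 , mk↔ₛ′ proj₁ (λ ()) (λ ()) (λ { (() , _) })
  Fin-filter (suc n) P with Fin-filter n (P ∘ suc) | P zero in eq
  ... | m , i | true = suc m , mk↔ₛ′ to from to∘from from∘to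
    where
    to : (∃[ i ] P i ≡ true) → Fin (suc m)
    to (zero  , p) = zero
    to (suc x , p) = suc (Inverse.to i (x , p))
    from : Fin (suc m) → ∃[ i ] P i ≡ true
    from zero    = zero , eq
    from (suc j) = suc (proj₁ (Inverse.from i j)) , proj₂ (Inverse.from i j)
    to∘from : ∀ j → to (from j) ≡ j
    to∘from zero    = refl
    to∘from (suc j) = cong suc (Inverse.strictlyInverseˡ i j)
    from∘to : ∀ x → from (to x) ≡ x
    from∘to (zero  , p) = Σ-≡true refl
    from∘to (suc x , p) = Σ-≡true (cong (suc ∘ proj₁) (Inverse.strictlyInverseʳ i (x , p)))
  ... | m , i | false = m , mk↔ₛ′ to from (Inverse.strictlyInverseˡ i) from∘to
    where
    to : (∃[ i ] P i ≡ true) → Fin m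
    to (zero  , p) with () ← trans (sym eq) p
    to (suc x , p) = Inverse.to i (x , p)
    from : Fin m → ∃[ i ] P i ≡ true
    from j = suc (proj₁ (Inverse.from i j)) , proj₂ (Inverse.from i j)
    from∘to : ∀ x → from (to x) ≡ x
    from∘to (zero  , p) with () ← trans (sym eq) p
    from∘to (suc x , p) = Σ-≡true (cong (suc ∘ proj₁) (Inverse.strictlyInverseʳ i (x , p)))

finite-filter : {A : Set} {n : ℕ} → A ↔ Fin n → (P : A → Bool) → Finite (∃[ x ] P x ≡ true)
finite-filter {A} {n} i P = m , Compose._↔-∘_ j restrict
  where
  m : ℕ
  m = proj₁ (Fin-filter n (P ∘ Inverse.from i))
  j : (∃[ x ] P (Inverse.from i x) ≡ true) ↔ Fin m
  j = proj₂ (Fin-filter n (P ∘ Inverse.from i))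
  restrict : (∃[ x ] P x ≡ true) ↔ (∃[ x ] P (Inverse.from i x) ≡ true)
  restrict = mk↔ₛ′
    (λ (x , p) → Inverse.to i x , trans (cong P (Inverse.strictlyInverseʳ i x)) p)
    (λ (x , p) → Inverse.from i x , p)
    (λ (x , p) → Σ-≡true (Inverse.strictlyInverseˡ i x))
    (λ (x , p) → Σ-≡true (Inverse.strictlyInverseʳ i x))

private
  Fin-classes : (n : ℕ) {R : Rel (Fin n) 0ℓ} → IsEquivalence R → Decidable R → Classes R
  Fin-classes zero eqv R? = record
    { size = 0 ; class = id ; surjective = λ () ; classifies = λ { {()} } }
  Fin-classes (suc n) {R} eqv R? with Fin-classes n {λ x y → R (suc x) (suc y)}
      (record { refl = E.refl ; sym = E.sym ; trans = E.trans }) (λ x y → R? (suc x) (suc y))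
    | Fin.any? (λ x → R? zero (suc x))
    where module E = IsEquivalence eqv
  ... | C | yes (r , Rr) = record
    { size       = C.size
    ; class      = class
    ; surjective = λ c → suc (proj₁ (C.surjective c)) , proj₂ (C.surjective c)
    ; classifies = λ {x} {y} → classifies x y
    }
    where
    module C = Classes C
    module E = IsEquivalence eqv
    class : Fin (suc n) → Fin C.size
    class zero    = C.class r
    class (suc x) = C.class x
    classifies : ∀ x y → class x ≡ class y ⇔ R x y
    classifies zero    zero    = mk⇔ (λ _ → E.refl) (λ _ → refl)
    classifies zero    (suc y) = mk⇔ (λ eq → E.trans Rr (Equivalence.to C.classifies eq))
      (λ Ry → Equivalence.from C.classifies (E.trans (E.sym Rr) Ry))
    classifies (suc x) zero    = mk⇔ (λ eq → E.trans (Equivalence.to C.classifies eq) (E.sym Rr))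
      (λ Rx → Equivalence.from C.classifies (E.trans Rx Rr))
    classifies (suc x) (suc y) = C.classifies
  ... | C | no ¬r = record
    { size       = suc C.size
    ; class      = class
    ; surjective = surjective
    ; classifies = λ {x} {y} → classifies x y
    }
    where
    module C = Classes C
    module E = IsEquivalence eqv
    class : Fin (suc n) → Fin (suc C.size)
    class zero    = zero
    class (suc x) = suc (C.class x)
    surjective : ∀ c → ∃[ x ] class x ≡ c
    surjective zero    = zero , refl
    surjective (suc c) = suc (proj₁ (C.surjective c)) , cong suc (proj₂ (C.surjective c))
    classifies : ∀ x y → class x ≡ class y ⇔ R x y
    classifies zero    zero    = mk⇔ (λ _ → E.refl) (λ _ → refl)
    classifies zero    (suc y) = mk⇔ (λ ()) (λ Ry → contradiction (y , Ry) ¬r)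
    classifies (suc x) zero    = mk⇔ (λ ()) (λ Rx → contradiction (x , E.sym Rx) ¬r)
    classifies (suc x) (suc y) = mk⇔ (Equivalence.to C.classifies ∘ Fin.suc-injective)
      (cong suc ∘ Equivalence.from C.classifies)

-- Serves for the faces of the constructed surface, whose classes have no explicit names, unlike its
-- vertices and edges.
decidable⇒classes : {A : Set} {n : ℕ} → A ↔ Fin n →
  {R : Rel A 0ℓ} → IsEquivalence R → Decidable R → Classes R
decidable⇒classes {A} {n} i {R} eqv R? = record
  { size       = C.size
  ; class      = C.class ∘ Inverse.to i
  ; surjective = λ c → Inverse.from i (proj₁ (C.surjective c)) ,
      trans (cong C.class (Inverse.strictlyInverseˡ i _)) (proj₂ (C.surjective c))
  ; classifies = λ {x} {y} → mk⇔
      (λ eq → subst₂ R (Inverse.strictlyInverseʳ i x) (Inverse.strictlyInverseʳ i y)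
        (Equivalence.to C.classifies eq))
      (λ Rxy → Equivalence.from C.classifies
        (subst₂ R (sym (Inverse.strictlyInverseʳ i x)) (sym (Inverse.strictlyInverseʳ i y)) Rxy))
  }
  where
  module E = IsEquivalence eqv
  C : Classes (λ x y → R (Inverse.from i x) (Inverse.from i y))
  C = Fin-classes n (record { refl = E.refl ; sym = E.sym ; trans = E.trans })
    (λ x y → R? (Inverse.from i x) (Inverse.from i y))
  module C = Classes C

-- Parity

private
  xorMonoid : CommutativeMonoid 0ℓ 0ℓ
  xorMonoid = CommutativeRing.+-commutativeMonoid Bool.xor-∧-commutativeRing

  module XorSum = CommutativeMonoidSum xorMonoid

parity : {n : ℕ} → (Fin n → Bool) → Bool
parity = XorSum.sum

<ᵇ-flip : ∀ {n} {x y : Fin n} → x ≢ y → (toℕ y <ᵇ toℕ x) ≡ not (toℕ x <ᵇ toℕ y)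
<ᵇ-flip {x = zero}  {zero}  ne = contradiction refl ne
<ᵇ-flip {x = zero}  {suc y} ne = refl
<ᵇ-flip {x = suc x} {zero}  ne = refl
<ᵇ-flip {x = suc x} {suc y} ne = <ᵇ-flip (ne ∘ cong suc)

private
  ∧-split : ∀ a b → a ≡ (a ∧ b) xor (a ∧ not b)
  ∧-split false b     = refl
  ∧-split true  false = refl
  ∧-split true  true  = refl

-- Every orbit of `τ` has two elements. Comparing their indices selects one of them, and `τ` carries
-- the selected elements of `Q` onto the remaining ones, so the two halves cancel.
parity-involution : {n : ℕ} (Q : Fin n → Bool) (τ : Fin n → Fin n) →
  (∀ x → τ (τ x) ≡ x) → (∀ x → τ x ≢ x) → (∀ x → Q (τ x) ≡ Q x) → parity Q ≡ false
parity-involution {n} Q τ invol fixfree inv = begin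
  parity Q                                          ≡⟨ XorSum.sum-cong-≗ (λ x → ∧-split (Q x) (low x)) ⟩
  parity (λ x → (Q x ∧ low x) xor (Q x ∧ not (low x)))
    ≡⟨ XorSum.∑-distrib-+ (λ x → Q x ∧ low x) (λ x → Q x ∧ not (low x)) ⟩
  parity Q₁ xor parity (λ x → Q x ∧ not (low x))   ≡⟨ cong (parity Q₁ xor_) eq ⟩
  parity Q₁ xor parity Q₁                          ≡⟨ Bool.xor-same (parity Q₁) ⟩
  false                                            ∎
  where
  open ≡-Reasoning
  low : Fin n → Bool
  low x = toℕ x <ᵇ toℕ (τ x)
  Q₁ : Fin n → Bool
  Q₁ x = Q x ∧ low x
  π : Perm.Permutation n n
  π = Perm.permutation τ τ invol invol
  eq : parity (λ x → Q x ∧ not (low x)) ≡ parity Q₁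
  eq = trans (XorSum.sum-permute (λ x → Q x ∧ not (low x)) π)
    (XorSum.sum-cong-≗ λ x → cong₂ _∧_ (inv x)
      (trans (cong (λ y → not (toℕ (τ x) <ᵇ toℕ y)) (invol x))
        (sym (<ᵇ-flip (fixfree x)))))

parity-indicator : {n : ℕ} (i : Fin n) → parity (λ x → does (x Fin.≟ i)) ≡ true
parity-indicator {suc n} i = trans (XorSum.sum-remove {i = i} (λ x → does (x Fin.≟ i)))
  (cong₂ _xor_ (dec-true (i Fin.≟ i) refl)
    (trans (XorSum.sum-cong-≗ {n} (λ x → dec-false (punchIn i x Fin.≟ i) (Fin.punchInᵢ≢i i x)))
      (XorSum.sum-replicate-zero n)))

-- Otherwise x₀ would be the only vertex of odd degree in the graph that τ₁ and τ₂
-- induce on Q.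
circuit : {A : Set} {n : ℕ} → A ↔ Fin n → (τ₁ τ₂ : A → A) →
  (∀ x → τ₁ (τ₁ x) ≡ x) → (∀ x → τ₂ (τ₂ x) ≡ x) →
  (∀ x → τ₁ x ≢ x) → (∀ x → τ₂ x ≢ x) →
  (Q : A → Bool) → (∀ x → Q (τ₁ x) ≡ Q x) →
  (x₀ : A) → Q x₀ ≡ true → (∀ x → x ≢ x₀ → Q x ≡ true → Q (τ₂ x) ≡ true) →
  Q (τ₂ x₀) ≡ true
circuit {A} {n} i τ₁ τ₂ invol₁ invol₂ fixfree₁ fixfree₂ Q inv₁ x₀ Qx₀ closed
  with Q (τ₂ x₀) in Qτx₀
... | true  = refl
... | false = contradiction (trans (sym even) odd) λ ()
  where
  to   = Inverse.to i
  from = Inverse.from i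
  conj : (A → A) → Fin n → Fin n
  conj τ = to ∘ τ ∘ from
  conj-invol : ∀ τ → (∀ x → τ (τ x) ≡ x) → ∀ x → conj τ (conj τ x) ≡ x
  conj-invol τ h x = trans (cong (to ∘ τ) (Inverse.strictlyInverseʳ i _))
    (trans (cong to (h _)) (Inverse.strictlyInverseˡ i x))
  conj-fixfree : ∀ τ → (∀ x → τ x ≢ x) → ∀ x → conj τ x ≢ x
  conj-fixfree τ h x eq = h (from x)
    (trans (sym (Inverse.strictlyInverseʳ i _)) (cong from eq))
  Q′ δ : Fin n → Bool
  Q′ = Q ∘ from
  δ x = does (x Fin.≟ to x₀)
  even : parity Q′ ≡ false
  even = parity-involution Q′ (conj τ₁) (conj-invol τ₁ invol₁) (conj-fixfree τ₁ fixfree₁)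
    (λ x → trans (cong Q (Inverse.strictlyInverseʳ i _)) (inv₁ (from x)))
  -- `Q` with `x₀` removed. If `τ₂ x₀` lies outside `Q`, this set is invariant under `τ₂`, hence
  -- even, while `Q` itself is even because of `τ₁`.
  D : A → Bool
  D y = Q y xor does (to y Fin.≟ to x₀)
  D-x₀ : D x₀ ≡ false
  D-x₀ rewrite dec-true (to x₀ Fin.≟ to x₀) refl | Qx₀ = refl
  D-other : ∀ y → y ≢ x₀ → D y ≡ Q y
  D-other y ne rewrite dec-false (to y Fin.≟ to x₀) (ne ∘ ↔-injective i) = Bool.xor-identityʳ (Q y)
  D-true : ∀ y → D y ≡ true → D (τ₂ y) ≡ true
  D-true y Dy = trans (D-other (τ₂ y) τy≢) (closed y y≢ Qy)
    where
    y≢ : y ≢ x₀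
    y≢ refl with () ← trans (sym Dy) D-x₀
    Qy : Q y ≡ true
    Qy = trans (sym (D-other y y≢)) Dy
    τy≢ : τ₂ y ≢ x₀
    τy≢ eq with () ← trans (sym Qy) (trans (cong Q (trans (sym (invol₂ y)) (cong τ₂ eq))) Qτx₀)
  D-inv : ∀ y → D (τ₂ y) ≡ D y
  D-inv y with D y in Dy | D (τ₂ y) in Dτy
  ... | true  | true  = refl
  ... | false | false = refl
  ... | true  | false = trans (sym Dτy) (D-true y Dy)
  ... | false | true  = trans (sym (D-true (τ₂ y) Dτy)) (trans (cong D (invol₂ y)) Dy)
  Dδ : ∀ x → Q′ x ≡ D (from x) xor δ x
  Dδ x rewrite Inverse.strictlyInverseˡ i x | Bool.xor-assoc (Q′ x) (δ x) (δ x)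
    | Bool.xor-same (δ x) = sym (Bool.xor-identityʳ (Q′ x))
  odd : parity Q′ ≡ true
  odd = trans (XorSum.sum-cong-≗ Dδ) (trans (XorSum.∑-distrib-+ (D ∘ from) δ)
    (cong₂ _xor_
      (parity-involution (D ∘ from) (conj τ₂) (conj-invol τ₂ invol₂) (conj-fixfree τ₂ fixfree₂)
        (λ x → trans (cong D (Inverse.strictlyInverseʳ i _)) (D-inv (from x))))
      (parity-indicator (to x₀))))

-- Orbits

orbit₂-isEquivalence : {A : Set} {f g : A → A} → (∀ x → f (f x) ≡ x) → (∀ x → g (g x) ≡ x) →
  IsEquivalence (Orbit₂ f g)
orbit₂-isEquivalence f-invol g-invol = record
  { refl  = ε
  ; sym   = reverse λ { {x} (inj₁ refl) → inj₁ (sym (f-invol x)) ; {x} (inj₂ refl) → inj₂ (sym (g-invol x)) }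
  ; trans = _◅◅_
  }

orbit₃-isEquivalence : {A : Set} {f g h : A → A} → (∀ x → f (f x) ≡ x) → (∀ x → g (g x) ≡ x) →
  (∀ x → h (h x) ≡ x) → IsEquivalence (Orbit₃ f g h)
orbit₃-isEquivalence f-invol g-invol h-invol = record
  { refl  = ε
  ; sym   = reverse λ { {x} (inj₁ refl) → inj₁ (sym (f-invol x))
                      ; {x} (inj₂ (inj₁ refl)) → inj₂ (inj₁ (sym (g-invol x)))
                      ; {x} (inj₂ (inj₂ refl)) → inj₂ (inj₂ (sym (h-invol x))) }
  ; trans = _◅◅_
  }

does⇒ : {X : Set} (d : Dec X) → does d ≡ true → X
does⇒ (yes x) _ = x

-- Around a vertex `τ₁` and `τ₂` alternate along a circuit of flags. A property that spreads along
-- it, except perhaps directly from `x₀` to `τ₂ x₀`, arrives at `τ₂ x₀` by the long way round.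
circuit-dec : {A : Set} {n : ℕ} → A ↔ Fin n → (τ₁ τ₂ : A → A) →
  (∀ x → τ₁ (τ₁ x) ≡ x) → (∀ x → τ₂ (τ₂ x) ≡ x) →
  (∀ x → τ₁ x ≢ x) → (∀ x → τ₂ x ≢ x) →
  (P : A → Set) → (∀ x → Dec (P x)) → (∀ x → P x → P (τ₁ x)) →
  (x₀ : A) → P x₀ → (∀ x → x ≢ x₀ → P x → P (τ₂ x)) → P (τ₂ x₀)
circuit-dec i τ₁ τ₂ invol₁ invol₂ fixfree₁ fixfree₂ P P? closed₁ x₀ Px₀ closed₂ =
  does⇒ (P? (τ₂ x₀)) (circuit i τ₁ τ₂ invol₁ invol₂ fixfree₁ fixfree₂ (λ x → does (P? x)) inv₁ x₀
    (dec-true (P? x₀) Px₀)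
    (λ x ne Px → dec-true (P? (τ₂ x)) (closed₂ x ne (does⇒ (P? x) Px))))
  where
  inv₁ : ∀ x → does (P? (τ₁ x)) ≡ does (P? x)
  inv₁ x with P? x | P? (τ₁ x)
  ... | yes p | yes q = refl
  ... | no ¬p | no ¬q = refl
  ... | yes p | no ¬q = contradiction (closed₁ x p) ¬q
  ... | no ¬p | yes q = contradiction (subst P (invol₁ x) (closed₁ (τ₁ x) q)) ¬p

-- Euler's inequality for subgraphs of the 1-skeleton

identify : {n : ℕ} (i j : Fin (suc n)) → j ≢ i →
  Σ (Fin (suc n) → Fin n) λ h → h j ≡ h i × StrictlySurjective _≡_ h
identify {n} i j j≢i = h , trans (h-at j refl) (sym (h-other i j≢i)) ,
    λ c → punchIn j c , trans (h-other (punchIn j c) (Fin.punchInᵢ≢i j c ∘ sym)) (Fin.punchOut-punchIn j)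
  where
  h : Fin (suc n) → Fin n
  h k with j Fin.≟ k
  ... | yes _  = punchOut j≢i
  ... | no j≢k = punchOut j≢k
  h-at : ∀ k → j ≡ k → h k ≡ punchOut j≢i
  h-at k eq with j Fin.≟ k
  ... | yes _  = refl
  ... | no j≢k = contradiction eq j≢k
  h-other : ∀ k (j≢k : j ≢ k) → h k ≡ punchOut j≢k
  h-other k j≢k with j Fin.≟ k
  ... | yes eq = contradiction eq j≢k
  ... | no _   = Fin.punchOut-cong j refl

module Cells (S : CellDecomposition) where
  open CellDecomposition S public

  edge : Flag → Fin #edges
  edge = Classes.class edges

  edge-τ₀ : ∀ x → edge (τ₀ x) ≡ edge x
  edge-τ₀ x = sym (Equivalence.from (Classes.classifies edges) (inj₁ refl ◅ ε))

  edge-τ₂ : ∀ x → edge (τ₂ x) ≡ edge x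
  edge-τ₂ x = sym (Equivalence.from (Classes.classifies edges) (inj₂ refl ◅ ε))

  vertexOf-τ₁ : ∀ x → vertexOf (τ₁ x) ≡ vertexOf x
  vertexOf-τ₁ x = sym (Equivalence.from (Classes.classifies vertices) (inj₁ refl ◅ ε))

  vertexOf-τ₂ : ∀ x → vertexOf (τ₂ x) ≡ vertexOf x
  vertexOf-τ₂ x = sym (Equivalence.from (Classes.classifies vertices) (inj₂ refl ◅ ε))

  -- Since `τ₀` and `τ₂` commute, their orbits have no further elements; the list permits case
  -- distinctions on the position of a flag along an edge.
  data OnEdge (x : Flag) : Flag → Set where
    here     : OnEdge x x
    at-τ₀    : OnEdge x (τ₀ x)
    at-τ₂    : OnEdge x (τ₂ x)
    at-τ₀τ₂  : OnEdge x (τ₀ (τ₂ x))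

  OnEdge-τ₀ : ∀ {x y} → OnEdge x y → OnEdge x (τ₀ y)
  OnEdge-τ₀     here    = at-τ₀
  OnEdge-τ₀ {x} at-τ₀   = subst (OnEdge x) (sym (τ₀-involutive _)) here
  OnEdge-τ₀     at-τ₂   = at-τ₀τ₂
  OnEdge-τ₀ {x} at-τ₀τ₂ = subst (OnEdge x) (sym (τ₀-involutive _)) at-τ₂

  OnEdge-τ₂ : ∀ {x y} → OnEdge x y → OnEdge x (τ₂ y)
  OnEdge-τ₂     here    = at-τ₂
  OnEdge-τ₂ {x} at-τ₀   = subst (OnEdge x) (τ₀-τ₂-commute x) at-τ₀τ₂
  OnEdge-τ₂ {x} at-τ₂   = subst (OnEdge x) (sym (τ₂-involutive _)) here
  OnEdge-τ₂ {x} at-τ₀τ₂ = subst (OnEdge x)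
    (trans (cong τ₀ (sym (τ₂-involutive x))) (τ₀-τ₂-commute (τ₂ x))) at-τ₀

  onEdge : ∀ {x y} → edge x ≡ edge y → OnEdge x y
  onEdge {x} eq = along here (Equivalence.to (Classes.classifies edges) eq)
    where
    along : ∀ {y z} → OnEdge x y → Orbit₂ τ₀ τ₂ y z → OnEdge x z
    along o ε                 = o
    along o (inj₁ refl ◅ ss) = along (OnEdge-τ₀ o) ss
    along o (inj₂ refl ◅ ss) = along (OnEdge-τ₂ o) ss

  ∈-resp-τ₀ : ∀ {K x} → edge x ∈ K → edge (τ₀ x) ∈ K
  ∈-resp-τ₀ {K} {x} = subst (_∈ K) (sym (edge-τ₀ x))

  -- The three nontrivial products of `τ₀` and `τ₂` have no fixed points, so the group of order four
  -- acts freely and each edge has four different flags.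
  #edges≤#flags : 4 * #edges ≤ #flags
  #edges≤#flags = subst (_≤ #flags) (ℕ.*-comm #edges 4)
    (↔-card-injective (Compose._↔-∘_ (Symmetry.↔-sym Fin.*↔×) (Identity.↔-id _ ×-↔ four)) finite f f-inj)
    where
    four : (Bool × Bool) ↔ Fin 4
    four = Compose._↔-∘_ (Symmetry.↔-sym (Fin.*↔× {2} {2}))
      (Symmetry.↔-sym Fin.2↔Bool ×-↔ Symmetry.↔-sym Fin.2↔Bool)
    rep : Fin #edges → Flag
    rep = proj₁ ∘ Classes.surjective edges
    act : Bool × Bool → Flag → Flag
    act (false , false) x = x
    act (true  , false) x = τ₀ x
    act (false , true)  x = τ₂ x
    act (true  , true)  x = τ₀ (τ₂ x)
    f : Fin #edges × Bool × Bool → Flag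
    f (e , w) = act w (rep e)
    edge-act : ∀ w x → edge (act w x) ≡ edge x
    edge-act (false , false) x = refl
    edge-act (true  , false) x = edge-τ₀ x
    edge-act (false , true)  x = edge-τ₂ x
    edge-act (true  , true)  x = trans (edge-τ₀ _) (edge-τ₂ x)
    act-inj : ∀ w w′ x → act w x ≡ act w′ x → w ≡ w′
    act-inj (false , false) (false , false) x eq = refl
    act-inj (false , false) (true  , false) x eq = contradiction (sym eq) (τ₀-fixfree x)
    act-inj (false , false) (false , true)  x eq = contradiction (sym eq) (τ₂-fixfree x)
    act-inj (false , false) (true  , true)  x eq = contradiction (sym eq) (τ₀τ₂-fixfree x)
    act-inj (true  , false) (false , false) x eq = contradiction eq (τ₀-fixfree x)
    act-inj (true  , false) (true  , false) x eq = refl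
    act-inj (true  , false) (false , true)  x eq =
      contradiction (trans (cong τ₀ (sym eq)) (τ₀-involutive x)) (τ₀τ₂-fixfree x)
    act-inj (true  , false) (true  , true)  x eq =
      contradiction (trans (sym (τ₀-involutive _)) (trans (cong τ₀ (sym eq)) (τ₀-involutive x))) (τ₂-fixfree x)
    act-inj (false , true)  (false , false) x eq = contradiction eq (τ₂-fixfree x)
    act-inj (false , true)  (true  , false) x eq =
      contradiction (trans (cong τ₀ eq) (τ₀-involutive x)) (τ₀τ₂-fixfree x)
    act-inj (false , true)  (false , true)  x eq = refl
    act-inj (false , true)  (true  , true)  x eq = contradiction (sym eq) (τ₀-fixfree (τ₂ x))
    act-inj (true  , true)  (false , false) x eq = contradiction eq (τ₀τ₂-fixfree x)
    act-inj (true  , true)  (true  , false) x eq =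
      contradiction (trans (sym (τ₀-involutive _)) (trans (cong τ₀ eq) (τ₀-involutive x))) (τ₂-fixfree x)
    act-inj (true  , true)  (false , true)  x eq = contradiction eq (τ₀-fixfree (τ₂ x))
    act-inj (true  , true)  (true  , true)  x eq = refl
    f-inj : Injective _≡_ _≡_ f
    f-inj {e , w} {e′ , w′} eq = cong₂ _,_ e≡e′
      (act-inj w w′ (rep e) (trans eq (cong (act w′ ∘ rep) (sym e≡e′))))
      where
      edge-f : ∀ e w → edge (f (e , w)) ≡ e
      edge-f e w = trans (edge-act w (rep e)) (proj₂ (Classes.surjective edges e))
      e≡e′ : e ≡ e′
      e≡e′ = trans (sym (edge-f e w)) (trans (cong edge eq) (edge-f e′ w′))

  -- A partition of the surface into unions of faces: faces on the two sides of an
  -- edge may have been merged.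
  record Labelling (size : ℕ) : Set where
    field
      label      : Flag → Fin size
      surjective : StrictlySurjective _≡_ label
      label-τ₀   : ∀ x → label (τ₀ x) ≡ label x
      label-τ₁   : ∀ x → label (τ₁ x) ≡ label x

    Across : Fin #edges → Set
    Across e = ∀ x → edge x ≡ e → label (τ₂ x) ≡ label x

    -- `τ₀` keeps labels and commutes with `τ₂`, so equality of the two sides needs testing at only
    -- one of the four flags of the edge.
    across : ∀ x → label (τ₂ x) ≡ label x → Across (edge x)
    across x eq y y∼x with onEdge (sym y∼x)
    ... | here    = eq
    ... | at-τ₀   = begin
      label (τ₂ (τ₀ x))  ≡⟨ cong label (τ₀-τ₂-commute x) ⟨
      label (τ₀ (τ₂ x))  ≡⟨ label-τ₀ (τ₂ x) ⟩
      label (τ₂ x)       ≡⟨ eq ⟩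
      label x            ≡⟨ label-τ₀ x ⟨
      label (τ₀ x)       ∎
      where open ≡-Reasoning
    ... | at-τ₂   = trans (cong label (τ₂-involutive x)) (sym eq)
    ... | at-τ₀τ₂ = begin
      label (τ₂ (τ₀ (τ₂ x)))  ≡⟨ cong label (τ₀-τ₂-commute (τ₂ x)) ⟨
      label (τ₀ (τ₂ (τ₂ x)))  ≡⟨ label-τ₀ _ ⟩
      label (τ₂ (τ₂ x))       ≡⟨ cong label (τ₂-involutive x) ⟩
      label x                 ≡⟨ eq ⟨
      label (τ₂ x)            ≡⟨ label-τ₀ (τ₂ x) ⟨
      label (τ₀ (τ₂ x))       ∎
      where open ≡-Reasoning

  module _ {size : ℕ} (L : Labelling (suc size)) where
    open Labelling L

    relabel : (h : Fin (suc size) → Fin size) → StrictlySurjective _≡_ h → Labelling size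
    relabel h h-surj = record
      { label      = h ∘ label
      ; surjective = λ c → proj₁ (surjective (proj₁ (h-surj c))) ,
          trans (cong h (proj₂ (surjective (proj₁ (h-surj c))))) (proj₂ (h-surj c))
      ; label-τ₀   = cong h ∘ label-τ₀
      ; label-τ₁   = cong h ∘ label-τ₁
      }

  -- An edge with the same label on both sides costs nothing; otherwise identifying the two labels
  -- costs one region. The inequality absorbs both cases.
  mergeFaces : (es : List (Fin #edges)) → ∃[ size ] Σ (Labelling size) λ L →
    (∀ e → e ∈ es → Labelling.Across L e) × #faces ≤ size + length es
  mergeFaces [] = #faces , record
    { label      = Classes.class faces
    ; surjective = Classes.surjective faces
    ; label-τ₀   = λ x → sym (Equivalence.from (Classes.classifies faces) (inj₁ refl ◅ ε))
    ; label-τ₁   = λ x → sym (Equivalence.from (Classes.classifies faces) (inj₂ refl ◅ ε))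
    } , (λ _ ()) , ℕ.m≤m+n #faces 0
  mergeFaces (e ∷ es) with mergeFaces es
  ... | zero , L , _ = ⊥-elim (Fin.¬Fin0 (Labelling.label L (proj₁ (Classes.surjective edges e))))
  ... | suc size , L , acr , bound
    with Classes.surjective edges e
  ... | x , refl with Labelling.label L x Fin.≟ Labelling.label L (τ₂ x)
  ... | yes eq = suc size , L ,
    (λ { _ (here refl) → Labelling.across L x (sym eq) ; e′ (there e′∈es) → acr e′ e′∈es }) ,
    ℕ.≤-trans bound (ℕ.+-monoʳ-≤ (suc size) (ℕ.n≤1+n (length es)))
  ... | no ne with identify (Labelling.label L x) (Labelling.label L (τ₂ x)) (ne ∘ sym)
  ... | h , hij , h-surj = size , relabel L h h-surj ,
    (λ { _ (here refl) → Labelling.across (relabel L h h-surj) x hij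
       ; e′ (there e′∈es) y eq → cong h (acr e′ e′∈es y eq) }) ,
    ℕ.≤-trans bound (ℕ.≤-reflexive (sym (ℕ.+-suc size (length es))))

  open DecMembership (Fin._≟_ {#edges}) using () renaming (_∈?_ to _∈E?_)
  open DecMembership (Fin._≟_ {#vertices}) using () renaming (_∈?_ to _∈V?_)

  -- Of the three involutions only `τ₀` can change the vertex, so a chain of flags that leaves `P`
  -- leaves it along an edge. This edge becomes pendant.
  crossing : {P : List (Fin #vertices)} → ∀ {x y} → vertexOf x ∈ P → vertexOf y ∉ P →
    ∃[ z ] (vertexOf z ∈ P × vertexOf (τ₀ z) ∉ P)
  crossing {P} {x} {y} x∈P y∉P = along (connected x y) x∈P
    where
    along : ∀ {x} → Orbit₃ τ₀ τ₁ τ₂ x y → vertexOf x ∈ P → ∃[ z ] (vertexOf z ∈ P × vertexOf (τ₀ z) ∉ P)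
    along ε x∈P = contradiction x∈P y∉P
    along {x} (inj₁ refl ◅ ss) x∈P with vertexOf (τ₀ x) ∈V? P
    ... | yes τx∈P = along ss τx∈P
    ... | no  τx∉P = x , x∈P , τx∉P
    along {x} (inj₂ (inj₁ refl) ◅ ss) x∈P = along ss (subst (_∈ P) (sym (vertexOf-τ₁ x)) x∈P)
    along {x} (inj₂ (inj₂ refl) ◅ ss) x∈P = along ss (subst (_∈ P) (sym (vertexOf-τ₂ x)) x∈P)

  -- Grow the subgraph with edges K and vertices P by pendant edges until it spans,
  -- then merge the faces across all remaining edges.  Around the leaf of a pendant
  -- edge every other edge has been merged across, so both sides of the pendant edge
  -- have the same label as well.
  regions : (fuel : ℕ) (K : List (Fin #edges)) (P : List (Fin #vertices)) → Unique K → Unique P →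
    (∀ x → edge x ∈ K → vertexOf x ∈ P) → (∃[ p ] p ∈ P) → suc #vertices ≤ fuel + length P →
    ∃[ size ] Σ (Labelling size) λ L → (∀ e → e ∉ K → Labelling.Across L e) ×
      #faces + length K + #vertices ≤ #edges + size + length P
  -- The fuel cannot run out: `P` has no repetitions, so its length never exceeds `#vertices`.
  regions zero K P uK uP _ _ bound = contradiction (ℕ.≤-trans bound (Unique⇒length≤ uP)) ℕ.1+n≰n
  regions (suc fuel) K P uK uP ends (p , p∈P) bound with Fin.all? (_∈V? P)
  ... | yes all = size , L , (λ e e∉K → acr e (∈-filter⁺ (λ e → ¬? (e ∈E? K)) (∈-allFin e) e∉K)) , (begin
      #faces + length K + #vertices              ≤⟨ ℕ.+-mono-≤ (ℕ.+-monoˡ-≤ (length K) face-bound) (full⇒≤length all) ⟩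
      size + length es + length K + length P     ≡⟨ cong (_+ length P) (ℕ.+-assoc size (length es) (length K)) ⟩
      size + (length es + length K) + length P   ≤⟨ ℕ.+-monoˡ-≤ (length P) (ℕ.+-monoʳ-≤ size es-bound) ⟩
      size + #edges + length P                   ≡⟨ cong (_+ length P) (ℕ.+-comm size #edges) ⟩
      #edges + size + length P                   ∎)
    where
    open ℕ.≤-Reasoning
    es : List (Fin #edges)
    es = filter (λ e → ¬? (e ∈E? K)) (allFin #edges)
    merged = mergeFaces es
    size = proj₁ merged
    L = proj₁ (proj₂ merged)
    acr = proj₁ (proj₂ (proj₂ merged))
    face-bound = proj₂ (proj₂ (proj₂ merged))
    es-bound : length es + length K ≤ #edges
    es-bound = subst (_≤ #edges) (List.length-++ es)
      (Unique⇒length≤ (Unique.++⁺ (Unique.filter⁺ (λ e → ¬? (e ∈E? K)) (Unique.allFin⁺ #edges)) uK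
        (λ (e∈es , e∈K) → proj₂ (∈-filter⁻ (λ e → ¬? (e ∈E? K)) {xs = allFin #edges} e∈es) e∈K)))
  ... | no ¬all with Fin.¬∀⟶∃¬ #vertices (_∈ P) (_∈V? P) ¬all
  ... | w , w∉P with Classes.surjective vertices p | Classes.surjective vertices w
  ... | xp , refl | xw , refl with crossing p∈P w∉P
  ... | x , x∈P , leaf∉P
    with regions fuel (edge x ∷ K) (vertexOf (τ₀ x) ∷ P)
      (All.tabulate (λ {e} e∈K eq → x∉K (subst (_∈ K) (sym eq) e∈K)) ∷ uK)
      (All.tabulate (λ {v} v∈P eq → leaf∉P (subst (_∈ P) (sym eq) v∈P)) ∷ uP)
      ends′ (p , there p∈P)
      (ℕ.≤-trans bound (ℕ.≤-reflexive (sym (ℕ.+-suc fuel (length P)))))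
    where
    x∉K : edge x ∉ K
    x∉K x∈K = leaf∉P (ends (τ₀ x) (∈-resp-τ₀ x∈K))
    ends′ : ∀ y → edge y ∈ edge x ∷ K → vertexOf y ∈ vertexOf (τ₀ x) ∷ P
    ends′ y (there y∈K) = there (ends y y∈K)
    ends′ y (here eq) with onEdge (sym eq)
    ... | here    = there x∈P
    ... | at-τ₀   = here refl
    ... | at-τ₂   = there (subst (_∈ P) (sym (vertexOf-τ₂ x)) x∈P)
    ... | at-τ₀τ₂ = here (trans (cong vertexOf (τ₀-τ₂-commute x)) (vertexOf-τ₂ (τ₀ x)))
  ... | size , L , acr , bound′ = size , L , acr′ , s≤s⁻¹ (subst₂ _≤_ lhs rhs bound′)
    where
    open Labelling L
    lhs : #faces + suc (length K) + #vertices ≡ suc (#faces + length K + #vertices)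
    lhs = cong (_+ #vertices) (ℕ.+-suc #faces (length K))
    rhs : #edges + size + suc (length P) ≡ suc (#edges + size + length P)
    rhs = ℕ.+-suc (#edges + size) (length P)
    z : Flag
    z = τ₀ x
    AtLeaf : Flag → Set
    AtLeaf y = vertexOf y ≡ vertexOf z × label y ≡ label z
    closed₂ : ∀ y → y ≢ z → AtLeaf y → AtLeaf (τ₂ y)
    closed₂ y y≢z (vy , ly) = trans (vertexOf-τ₂ y) vy , τ₂-label
      where
      τ₂-label : label (τ₂ y) ≡ label z
      τ₂-label with edge y ∈E? (edge x ∷ K)
      ... | no y∉         = trans (acr (edge y) y∉ y refl) ly
      ... | yes (there y∈K) = contradiction (subst (_∈ P) vy (ends y y∈K)) leaf∉P
      ... | yes (here eq) with onEdge (trans (edge-τ₀ x) (sym eq))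
      ... | here    = contradiction refl y≢z
      ... | at-τ₀   = contradiction (subst (_∈ P) (trans (cong vertexOf (sym (τ₀-involutive x))) vy) x∈P) leaf∉P
      ... | at-τ₂   = cong label (τ₂-involutive z)
      ... | at-τ₀τ₂ = contradiction (subst (_∈ P) vy′ x∈P) leaf∉P
        where
        vy′ : vertexOf x ≡ vertexOf z
        vy′ = trans (sym (vertexOf-τ₂ x)) (trans (cong (vertexOf ∘ τ₂) (sym (τ₀-involutive x)))
          (trans (cong vertexOf (sym (τ₀-τ₂-commute z))) vy))
    acr′ : ∀ e → e ∉ K → Across e
    acr′ e e∉K with e Fin.≟ edge x
    ... | no e≢x   = acr e λ { (here eq) → e≢x eq ; (there e∈K) → e∉K e∈K }
    ... | yes refl = subst Across (edge-τ₀ x) (across z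
      (proj₂ (circuit-dec finite τ₁ τ₂ τ₁-involutive τ₂-involutive τ₁-fixfree τ₂-fixfree AtLeaf
        (λ y → (vertexOf y Fin.≟ vertexOf z) ×-dec (label y Fin.≟ label z))
        (λ y (vy , ly) → trans (vertexOf-τ₁ y) vy , trans (label-τ₁ y) ly)
        z (refl , refl) closed₂)))

-- Regions of a bipartite subgraph have four sides

module BipartiteBound (S : CellDecomposition) {e : ℕ}
  (fl : Fin e → CellDecomposition.Flag S)
  (left right : Fin e → Fin (CellDecomposition.#vertices S))
  (at-left : ∀ j → CellDecomposition.vertexOf S (fl j) ≡ left j)
  (at-right : ∀ j → CellDecomposition.vertexOf S (CellDecomposition.τ₀ S (fl j)) ≡ right j)
  (bipartite : ∀ i j → left i ≢ right j)
  (simple : ∀ {i j} → left i ≡ left j → right i ≡ right j → i ≡ j)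
  (left-degree : ∀ j → ∃[ j′ ] (j′ ≢ j × left j′ ≡ left j))
  (right-degree : ∀ j → ∃[ j′ ] (j′ ≢ j × right j′ ≡ right j))
  (j₀ : Fin e)
  (P : List (Fin (CellDecomposition.#vertices S))) (uP : Unique P)
  (left∈P : ∀ j → left j ∈ P) (right∈P : ∀ j → right j ∈ P)
  where

  open Cells S

  private
    K : List (Fin #edges)
    K = tabulate (edge ∘ fl)

    OnG : Fin e → Flag → Set
    OnG j = OnEdge (fl j)

    side : ∀ {j x} → OnG j x → vertexOf x ≡ left j ⊎ vertexOf x ≡ right j
    side {j} here    = inj₁ (at-left j)
    side {j} at-τ₀   = inj₂ (at-right j)
    side {j} at-τ₂   = inj₁ (trans (vertexOf-τ₂ _) (at-left j))
    side {j} at-τ₀τ₂ = inj₂ (trans (cong vertexOf (τ₀-τ₂-commute _)) (trans (vertexOf-τ₂ _) (at-right j)))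

    edge-onG : ∀ {j x} → OnG j x → edge x ≡ edge (fl j)
    edge-onG here    = refl
    edge-onG at-τ₀   = edge-τ₀ _
    edge-onG at-τ₂   = edge-τ₂ _
    edge-onG at-τ₀τ₂ = trans (edge-τ₀ _) (edge-τ₂ _)

    -- A common edge forces common ends, possibly in exchanged order. Bipartiteness excludes the
    -- exchange, and simplicity does the rest.
    edge-inj : ∀ {i j} → edge (fl i) ≡ edge (fl j) → i ≡ j
    edge-inj {i} {j} eq with onEdge {fl j} {fl i} (sym eq) | onEdge {fl j} {τ₀ (fl i)} (trans (sym eq) (sym (edge-τ₀ _)))
    ... | o | o′ with side o | side o′
    ... | inj₁ l | inj₂ r = simple (trans (sym (at-left i)) l) (trans (sym (at-right i)) r)
    ... | inj₁ _ | inj₁ l = contradiction (trans (sym l) (at-right i)) (bipartite j i)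
    ... | inj₂ r | _      = contradiction (trans (sym (at-left i)) r) (bipartite i j)

    K-unique : Unique K
    K-unique = Unique.tabulate⁺ edge-inj

    K-ends : ∀ x → edge x ∈ K → vertexOf x ∈ P
    K-ends x x∈K with ∈-tabulate⁻ x∈K
    ... | j , eq with side (onEdge {fl j} (sym eq))
    ... | inj₁ l = subst (_∈ P) (sym l) (left∈P j)
    ... | inj₂ r = subst (_∈ P) (sym r) (right∈P j)

    module Regions {size : ℕ} (L : Labelling size)
      (acr : ∀ e′ → e′ ∉ tabulate (edge ∘ fl) → Labelling.Across L e′) where

      open Labelling L

      -- `fl j` and `τ₂ (fl j)` stand for the two sides of the edge, since labels do not change
      -- under `τ₀`.
      Borders : Fin size → Fin e → Set
      Borders c j = label (fl j) ≡ c ⊎ label (τ₂ (fl j)) ≡ c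

      borders? : ∀ c j → Dec (Borders c j)
      borders? c j = (label (fl j) Fin.≟ c) ⊎-dec (label (τ₂ (fl j)) Fin.≟ c)

      onG⇒borders : ∀ {c j x} → OnG j x → label x ≡ c → Borders c j
      onG⇒borders here    eq = inj₁ eq
      onG⇒borders at-τ₀   eq = inj₁ (trans (sym (label-τ₀ _)) eq)
      onG⇒borders at-τ₂   eq = inj₂ eq
      onG⇒borders at-τ₀τ₂ eq = inj₂ (trans (sym (label-τ₀ _)) eq)

      ∈K? : ∀ x → (∃[ j ] OnG j x) ⊎ label (τ₂ x) ≡ label x
      ∈K? x with Fin.any? (λ j → edge (fl j) Fin.≟ edge x)
      ... | yes (j , eq) = inj₁ (j , onEdge eq)
      ... | no none      = inj₂ (acr (edge x) x∉K x refl)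
        where
        x∉K : edge x ∉ K
        x∉K x∈K with ∈-tabulate⁻ x∈K
        ... | j , eq = none (j , sym eq)

      -- A region that meets no edge of the graph can be left by none of the involutions. By
      -- connectedness it would be the whole surface, which contains the edge `j₀`.
      borders : ∀ c → ∃[ j ] Borders c j
      borders c with Fin.any? (borders? c)
      ... | yes found = found
      ... | no none with surjective c
      ... | z , refl = contradiction (j₀ , inj₁ (along (connected z (fl j₀)) refl)) none
        where
        along : ∀ {x y} → Orbit₃ τ₀ τ₁ τ₂ x y → label x ≡ label z → label y ≡ label z
        along ε eq = eq
        along {x} (inj₁ refl ◅ ss) eq = along ss (trans (label-τ₀ x) eq)
        along {x} (inj₂ (inj₁ refl) ◅ ss) eq = along ss (trans (label-τ₁ x) eq)
        along {x} (inj₂ (inj₂ refl) ◅ ss) eq with ∈K? x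
        ... | inj₁ (j , o) = contradiction (j , onG⇒borders o eq) none
        ... | inj₂ eq′     = along ss (trans eq′ eq)

      -- Rotating around the vertex of x inside its region, the next edge of the graph is
      -- found at a flag which is neither x nor τ₂ x, unless the region has no other edge
      -- of the graph there.
      another : ∀ j x → OnG j x → vertexOf (τ₀ x) ≢ vertexOf x →
        (∃[ j′ ] (j′ ≢ j × ∃[ y ] (OnG j′ y × vertexOf y ≡ vertexOf x))) →
        ∃[ j′ ] (j′ ≢ j × ∃[ y ] (OnG j′ y × vertexOf y ≡ vertexOf x × label y ≡ label x))
      another j x o x-link (j′ , j′≢j , y′ , o′ , vy′)
        with Fin.any? (λ i → ¬? (i Fin.≟ j) ×-dec
               Fin.any? (λ k → let y = Inverse.from finite k in
                 (edge (fl i) Fin.≟ edge y) ×-dec (vertexOf y Fin.≟ vertexOf x) ×-dec (label y Fin.≟ label x)))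
      ... | yes (i , i≢j , k , eq , vy , ly) = i , i≢j , Inverse.from finite k , onEdge eq , vy , ly
      ... | no none = contradiction (all y′ vy′) λ ly′ → none′ j′ j′≢j y′ o′ vy′ ly′
        where
        none′ : ∀ i → i ≢ j → ∀ y → OnG i y → vertexOf y ≡ vertexOf x → label y ≢ label x
        none′ i i≢j y o vy ly = none (i , i≢j , Inverse.to finite y ,
          subst (λ z → edge (fl i) ≡ edge z × vertexOf z ≡ vertexOf x × label z ≡ label x)
            (sym (Inverse.strictlyInverseʳ finite y)) (sym (edge-onG o) , vy , ly))
        Here : Flag → Set
        Here y = vertexOf y ≡ vertexOf x × label y ≡ label x
        closed₁ : ∀ y → Here y → Here (τ₁ y)
        closed₁ y (vy , ly) = trans (vertexOf-τ₁ y) vy , trans (label-τ₁ y) ly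
        not-opposite : ∀ y → Here y → OnEdge x y → y ≡ x ⊎ y ≡ τ₂ x
        not-opposite y _ here  = inj₁ refl
        not-opposite y _ at-τ₂ = inj₂ refl
        not-opposite y (vy , _) at-τ₀   = contradiction vy x-link
        not-opposite y (vy , _) at-τ₀τ₂ = contradiction
          (trans (sym (trans (cong vertexOf (τ₀-τ₂-commute x)) (vertexOf-τ₂ _))) vy) x-link
        closed₂ : ∀ y → y ≢ x → Here y → Here (τ₂ y)
        closed₂ y y≢x h@(vy , ly) with ∈K? y
        ... | inj₂ eq = trans (vertexOf-τ₂ y) vy , trans eq ly
        ... | inj₁ (i , oᵢ) with i Fin.≟ j
        ... | no i≢j = contradiction ly (none′ i i≢j y oᵢ vy)
        ... | yes refl with not-opposite y h (onEdge (trans (edge-onG o) (sym (edge-onG oᵢ))))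
        ... | inj₁ y≡x  = contradiction y≡x y≢x
        ... | inj₂ refl = cong vertexOf (τ₂-involutive x) , cong label (τ₂-involutive x)
        -- With no other edge of the graph in this region at the vertex, the region could be left
        -- only across the edge of `x`; the long way round shows that this is not so either. The
        -- region then fills the whole surrounding of the vertex and contains the edge `j′`.
        here-τ₂x : Here (τ₂ x)
        here-τ₂x = circuit-dec finite τ₁ τ₂ τ₁-involutive τ₂-involutive τ₁-fixfree τ₂-fixfree Here
          (λ y → (vertexOf y Fin.≟ vertexOf x) ×-dec (label y Fin.≟ label x))
          closed₁ x (refl , refl) closed₂
        closed₂′ : ∀ y → Here y → Here (τ₂ y)
        closed₂′ y h with Inverse.to finite y Fin.≟ Inverse.to finite x
        ... | yes eq = subst (Here ∘ τ₂) (sym (↔-injective finite eq)) here-τ₂x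
        ... | no ne  = closed₂ y (ne ∘ cong (Inverse.to finite)) h
        all : ∀ y → vertexOf y ≡ vertexOf x → label y ≡ label x
        all y vy = proj₂ (along (Equivalence.to (Classes.classifies vertices) (sym vy)) (refl , refl))
          where
          along : ∀ {z} → Orbit₂ τ₁ τ₂ z y → Here z → Here y
          along ε h = h
          along {z} (inj₁ refl ◅ ss) h = along ss (closed₁ z h)
          along {z} (inj₂ refl ◅ ss) h = along ss (closed₂′ z h)

      another-left : ∀ {c} j → Borders c j → ∃[ j′ ] (j′ ≢ j × left j′ ≡ left j × Borders c j′)
      another-left {c} j b with left-degree j
      ... | i , i≢j , li with at b
        where
        at : Borders c j → ∃[ x ] (OnG j x × label x ≡ c × vertexOf x ≡ left j × vertexOf (τ₀ x) ≡ right j)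
        at (inj₁ eq) = fl j , here , eq , at-left j , at-right j
        at (inj₂ eq) = τ₂ (fl j) , at-τ₂ , eq , trans (vertexOf-τ₂ _) (at-left j) ,
          trans (cong vertexOf (τ₀-τ₂-commute _)) (trans (vertexOf-τ₂ _) (at-right j))
      ... | x , o , lx , vx , v′x
        with another j x o (λ eq → bipartite j j (trans (sym vx) (trans (sym eq) v′x)))
               (i , i≢j , fl i , here , trans (at-left i) (trans li (sym vx)))
      ... | j′ , j′≢j , y , o′ , vy , ly with side o′
      ... | inj₁ l = j′ , j′≢j , trans (sym l) (trans vy vx) , onG⇒borders o′ (trans ly lx)
      ... | inj₂ r = contradiction (trans (sym vx) (trans (sym vy) r)) (bipartite j j′)

      another-right : ∀ {c} j → Borders c j → ∃[ j′ ] (j′ ≢ j × right j′ ≡ right j × Borders c j′)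
      another-right {c} j b with right-degree j
      ... | i , i≢j , ri with at b
        where
        at : Borders c j → ∃[ x ] (OnG j x × label x ≡ c × vertexOf x ≡ right j × vertexOf (τ₀ x) ≡ left j)
        at (inj₁ eq) = τ₀ (fl j) , at-τ₀ , trans (label-τ₀ _) eq , at-right j ,
          trans (cong vertexOf (τ₀-involutive _)) (at-left j)
        at (inj₂ eq) = τ₀ (τ₂ (fl j)) , at-τ₀τ₂ , trans (label-τ₀ _) eq ,
          trans (cong vertexOf (τ₀-τ₂-commute _)) (trans (vertexOf-τ₂ _) (at-right j)) ,
          trans (cong vertexOf (τ₀-involutive _)) (trans (vertexOf-τ₂ _) (at-left j))
      ... | x , o , lx , vx , v′x
        with another j x o (λ eq → bipartite j j (trans (sym v′x) (trans eq vx)))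
               (i , i≢j , τ₀ (fl i) , at-τ₀ , trans (at-right i) (trans ri (sym vx)))
      ... | j′ , j′≢j , y , o′ , vy , ly with side o′
      ... | inj₁ l = contradiction (trans (sym l) (trans vy vx)) (bipartite j′ j)
      ... | inj₂ r = j′ , j′≢j , trans (sym r) (trans vy vx) , onG⇒borders o′ (trans ly lx)

      -- Takes the place of a boundary walk, since a region may have several of them. Turning at the
      -- two ends of `j₀` gives `j₁` and `j₂`, and turning at the far end of `j₂` gives `j₃`.
      -- Simplicity separates the left ends of `j₀` and `j₂`, whence all four edges differ.
      path : ∀ c → Σ (Fin 4 → Fin e) λ p → Injective _≡_ _≡_ p × (∀ i → Borders c (p i))
      path c with borders c
      ... | j₀ , b₀ with another-left j₀ b₀ | another-right j₀ b₀
      ... | j₁ , 1≢0 , l₁ , b₁ | j₂ , 2≢0 , r₂ , b₂ with another-left j₂ b₂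
      ... | j₃ , 3≢2 , l₃ , b₃ = p , (λ {i} {k} → p-inj i k) ,
          λ { zero → b₀ ; (suc zero) → b₁ ; (suc (suc zero)) → b₂ ; (suc (suc (suc zero))) → b₃ }
        where
        l₀≢l₂ : left j₀ ≢ left j₂
        l₀≢l₂ eq = 2≢0 (simple (sym eq) r₂)
        p : Fin 4 → Fin e
        p zero                   = j₀
        p (suc zero)             = j₁
        p (suc (suc zero))       = j₂
        p (suc (suc (suc zero))) = j₃
        0≢2 : j₀ ≢ j₂
        0≢2 = 2≢0 ∘ sym
        0≢3 : j₀ ≢ j₃
        0≢3 eq = l₀≢l₂ (trans (cong left eq) l₃)
        1≢2 : j₁ ≢ j₂
        1≢2 eq = l₀≢l₂ (trans (sym l₁) (cong left eq))
        1≢3 : j₁ ≢ j₃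
        1≢3 eq = l₀≢l₂ (trans (sym l₁) (trans (cong left eq) l₃))
        p-inj : ∀ i k → p i ≡ p k → i ≡ k
        p-inj zero zero _ = refl
        p-inj zero (suc zero) eq = contradiction (sym eq) 1≢0
        p-inj zero (suc (suc zero)) eq = contradiction eq 0≢2
        p-inj zero (suc (suc (suc zero))) eq = contradiction eq 0≢3
        p-inj (suc zero) zero eq = contradiction eq 1≢0
        p-inj (suc zero) (suc zero) _ = refl
        p-inj (suc zero) (suc (suc zero)) eq = contradiction eq 1≢2
        p-inj (suc zero) (suc (suc (suc zero))) eq = contradiction eq 1≢3
        p-inj (suc (suc zero)) zero eq = contradiction (sym eq) 0≢2
        p-inj (suc (suc zero)) (suc zero) eq = contradiction (sym eq) 1≢2
        p-inj (suc (suc zero)) (suc (suc zero)) _ = refl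
        p-inj (suc (suc zero)) (suc (suc (suc zero))) eq = contradiction (sym eq) 3≢2
        p-inj (suc (suc (suc zero))) zero eq = contradiction (sym eq) 0≢3
        p-inj (suc (suc (suc zero))) (suc zero) eq = contradiction (sym eq) 1≢3
        p-inj (suc (suc (suc zero))) (suc (suc zero)) eq = contradiction eq 3≢2
        p-inj (suc (suc (suc zero))) (suc (suc (suc zero))) _ = refl

      -- Double counting of pairs of a region and a bordering edge. An edge together with the side
      -- recorded by `which` determines the region, so each edge is counted at most twice.
      paths⇒size*4≤e*2 : (∀ c → Σ (Fin 4 → Fin e) λ p → Injective _≡_ _≡_ p × (∀ i → Borders c (p i))) →
        size * 4 ≤ e * 2
      paths⇒size*4≤e*2 path = ↔-card-injective (Symmetry.↔-sym Fin.*↔×)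
          (Compose._↔-∘_ (Symmetry.↔-sym Fin.*↔×) (Identity.↔-id _ ×-↔ Symmetry.↔-sym Fin.2↔Bool))
          f (λ {x} {y} → f-inj x y)
        where
        which : ∀ {c j} → Borders c j → Bool
        which (inj₁ _) = true
        which (inj₂ _) = false
        f : Fin size × Fin 4 → Fin e × Bool
        f (c , i) = proj₁ (path c) i , which (proj₂ (proj₂ (path c)) i)
        which-inj : ∀ {c c′ j j′} (b : Borders c j) (b′ : Borders c′ j′) → j ≡ j′ → which b ≡ which b′ → c ≡ c′
        which-inj (inj₁ p) (inj₁ q) refl _ = trans (sym p) q
        which-inj (inj₂ p) (inj₂ q) refl _ = trans (sym p) q
        path-inj : ∀ {c c′ i i′} → c ≡ c′ → proj₁ (path c) i ≡ proj₁ (path c′) i′ → (c , i) ≡ (c′ , i′)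
        path-inj {c} refl eq = cong (c ,_) (proj₁ (proj₂ (path c)) eq)
        f-inj : ∀ x y → f x ≡ f y → x ≡ y
        f-inj (c , i) (c′ , i′) eq = path-inj
          (which-inj (proj₂ (proj₂ (path c)) i) (proj₂ (proj₂ (path c′)) i′) (cong proj₁ eq) (cong proj₂ eq))
          (cong proj₁ eq)

      size*4≤e*2 : size * 4 ≤ e * 2
      size*4≤e*2 = paths⇒size*4≤e*2 path

  euler-bound : 2 * (#vertices + #faces) + e ≤ 2 * #edges + 2 * length P
  euler-bound with regions (suc #vertices) K P K-unique uP K-ends (left j₀ , left∈P j₀) (ℕ.m≤m+n (suc #vertices) (length P))
  ... | size , L , acr , euler = ℕ.+-cancelʳ-≤ e _ _ (begin
    2 * (#vertices + #faces) + e + e       ≡⟨ regroup₁ #vertices #faces e ⟩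
    2 * (#faces + e + #vertices)           ≡⟨ cong (λ k → 2 * (#faces + k + #vertices)) (List.length-tabulate (edge ∘ fl)) ⟨
    2 * (#faces + length K + #vertices)    ≤⟨ ℕ.*-monoʳ-≤ 2 euler ⟩
    2 * (#edges + size + length P)         ≡⟨ regroup₂ #edges size (length P) ⟩
    2 * #edges + 2 * length P + size * 2   ≤⟨ ℕ.+-monoʳ-≤ (2 * #edges + 2 * length P) size*2≤e ⟩
    2 * #edges + 2 * length P + e          ∎)
    where
    open ℕ.≤-Reasoning
    regroup₁ : ∀ v f e → 2 * (v + f) + e + e ≡ 2 * (f + e + v)
    regroup₁ = solve-∀
    regroup₂ : ∀ e s p → 2 * (e + s + p) ≡ 2 * e + 2 * p + s * 2
    regroup₂ = solve-∀
    size*2≤e : size * 2 ≤ e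
    size*2≤e = ℕ.*-cancelʳ-≤ (size * 2) e 2 (subst (_≤ e * 2) (sym (ℕ.*-assoc size 2 2)) (Regions.size*4≤e*2 L acr))

-- Three-element subsets

members : {n : ℕ} (s : Subset n) → (∃[ i ] i ∈ₛ s) ↔ Fin ∣ s ∣
members [] = mk↔ₛ′ (λ { (() , _) }) (λ ()) (λ ()) (λ { (() , _) })
members (outside ∷ s) = mk↔ₛ′ to from (Inverse.strictlyInverseˡ (members s)) from∘to
  where
  to : (∃[ i ] i ∈ₛ (outside ∷ s)) → Fin ∣ s ∣
  to (suc i , there i∈s) = Inverse.to (members s) (i , i∈s)
  from : Fin ∣ s ∣ → ∃[ i ] i ∈ₛ (outside ∷ s)
  from p = suc (proj₁ (Inverse.from (members s) p)) , there (proj₂ (Inverse.from (members s) p))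
  from∘to : ∀ x → from (to x) ≡ x
  from∘to (suc i , there i∈s) = cong (λ (j , j∈s) → suc j , there j∈s) (Inverse.strictlyInverseʳ (members s) (i , i∈s))
members (inside ∷ s) = mk↔ₛ′ to from to∘from from∘to
  where
  to : (∃[ i ] i ∈ₛ (inside ∷ s)) → Fin (suc ∣ s ∣)
  to (zero  , here)      = zero
  to (suc i , there i∈s) = suc (Inverse.to (members s) (i , i∈s))
  from : Fin (suc ∣ s ∣) → ∃[ i ] i ∈ₛ (inside ∷ s)
  from zero    = zero , here
  from (suc p) = suc (proj₁ (Inverse.from (members s) p)) , there (proj₂ (Inverse.from (members s) p))
  to∘from : ∀ p → to (from p) ≡ p
  to∘from zero    = refl
  to∘from (suc p) = cong suc (Inverse.strictlyInverseˡ (members s) p)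
  from∘to : ∀ x → from (to x) ≡ x
  from∘to (zero  , here)      = refl
  from∘to (suc i , there i∈s) = cong (λ (j , j∈s) → suc j , there j∈s) (Inverse.strictlyInverseʳ (members s) (i , i∈s))

SubsetOfSize : (n k : ℕ) → Set
SubsetOfSize n k = ∃[ s ] ∣_∣ {n} s ≡ k

SubsetOfSize-≡ : {n k : ℕ} {S T : SubsetOfSize n k} → proj₁ S ≡ proj₁ T → S ≡ T
SubsetOfSize-≡ {S = _ , p} {_ , q} refl = cong (_ ,_) (uip p q)

-- Distinguishing by the first entry of the subset turns Pascal's rule into a bijection.
subsets : (n k : ℕ) → SubsetOfSize n k ↔ Fin (n C k)
subsets zero    zero    = mk↔ₛ′ (λ _ → zero) (λ _ → [] , refl) (λ { zero → refl }) (λ { ([] , _) → SubsetOfSize-≡ refl })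
subsets zero    (suc k) = mk↔ₛ′ (λ { ([] , ()) }) (λ ()) (λ ()) (λ { ([] , ()) })
subsets (suc n) zero    = mk↔ₛ′ (λ _ → zero) (λ _ → outside ∷ proj₁ S , proj₂ S) (λ { zero → refl })
    (λ { (inside ∷ s , ()) ; (outside ∷ s , p) → SubsetOfSize-≡ (cong (λ T → outside ∷ proj₁ T)
      (trans (cong (Inverse.from (subsets n zero)) (only (Inverse.to (subsets n zero) (s , p))))
        (Inverse.strictlyInverseʳ (subsets n zero) (s , p)))) })
  where
  S : SubsetOfSize n zero
  S = Inverse.from (subsets n zero) zero
  only : ∀ i → zero ≡ i
  only zero = refl
subsets (suc n) (suc k) = subst (λ c → SubsetOfSize (suc n) (suc k) ↔ Fin c) (nCk+nC[k+1]≡[n+1]C[k+1] n k)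
    (Compose._↔-∘_ (Compose._↔-∘_ (Symmetry.↔-sym Fin.+↔⊎) (subsets n k ⊎-↔ subsets n (suc k)))
      (mk↔ₛ′ to from to∘from from∘to))
  where
  to : SubsetOfSize (suc n) (suc k) → SubsetOfSize n k ⊎ SubsetOfSize n (suc k)
  to (inside  ∷ s , p) = inj₁ (s , ℕ.suc-injective p)
  to (outside ∷ s , p) = inj₂ (s , p)
  from : SubsetOfSize n k ⊎ SubsetOfSize n (suc k) → SubsetOfSize (suc n) (suc k)
  from (inj₁ (s , p)) = inside ∷ s , cong suc p
  from (inj₂ (s , p)) = outside ∷ s , p
  to∘from : ∀ x → to (from x) ≡ x
  to∘from (inj₁ _) = cong inj₁ (SubsetOfSize-≡ refl)
  to∘from (inj₂ _) = refl
  from∘to : ∀ x → from (to x) ≡ x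
  from∘to (inside  ∷ s , p) = SubsetOfSize-≡ refl
  from∘to (outside ∷ s , p) = refl

2*[1+n]C2 : ∀ n → 2 * (suc n C 2) ≡ suc n * n
2*[1+n]C2 zero    = refl
2*[1+n]C2 (suc n) = begin
  2 * (suc (suc n) C 2)                  ≡⟨ cong (2 *_) (nCk+nC[k+1]≡[n+1]C[k+1] (suc n) 1) ⟨
  2 * (suc n C 1 + suc n C 2)            ≡⟨ cong (λ c → 2 * (c + suc n C 2)) (nC1≡n (suc n)) ⟩
  2 * (suc n + suc n C 2)                ≡⟨ ℕ.*-distribˡ-+ 2 (suc n) (suc n C 2) ⟩
  2 * suc n + 2 * (suc n C 2)            ≡⟨ cong (2 * suc n +_) (2*[1+n]C2 n) ⟩
  2 * suc n + suc n * n                  ≡⟨ rearrange n ⟩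
  suc (suc n) * suc n                    ∎
  where
  open ≡-Reasoning
  rearrange : ∀ n → 2 * suc n + suc n * n ≡ suc (suc n) * suc n
  rearrange = solve-∀

6*[2+n]C3 : ∀ n → 6 * (suc (suc n) C 3) ≡ suc (suc n) * suc n * n
6*[2+n]C3 zero    = refl
6*[2+n]C3 (suc n) = begin
  6 * (suc (suc (suc n)) C 3)                              ≡⟨ cong (6 *_) (nCk+nC[k+1]≡[n+1]C[k+1] (suc (suc n)) 2) ⟨
  6 * (suc (suc n) C 2 + suc (suc n) C 3)                  ≡⟨ distrib (suc (suc n) C 2) (suc (suc n) C 3) ⟩
  3 * (2 * (suc (suc n) C 2)) + 6 * (suc (suc n) C 3)      ≡⟨ cong₂ (λ a b → 3 * a + b) (2*[1+n]C2 (suc n)) (6*[2+n]C3 n) ⟩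
  3 * (suc (suc n) * suc n) + suc (suc n) * suc n * n      ≡⟨ rearrange n ⟩
  suc (suc (suc n)) * suc (suc n) * suc n                  ∎
  where
  open ≡-Reasoning
  distrib : ∀ a b → 6 * (a + b) ≡ 3 * (2 * a) + 6 * b
  distrib = solve-∀
  rearrange : ∀ n → 3 * (suc (suc n) * suc n) + suc (suc n) * suc n * n ≡ suc (suc (suc n)) * suc (suc n) * suc n
  rearrange = solve-∀

Distinct : {A : Set} → A → A → A → Set
Distinct a b c = a ≢ b × a ≢ c × b ≢ c

rotate : Fin 3 → Fin 3
rotate zero             = suc zero
rotate (suc zero)       = suc (suc zero)
rotate (suc (suc zero)) = zero

rotations : ∀ p q → q ≡ p ⊎ q ≡ rotate p ⊎ q ≡ rotate (rotate p)
rotations zero             zero             = inj₁ refl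
rotations zero             (suc zero)       = inj₂ (inj₁ refl)
rotations zero             (suc (suc zero)) = inj₂ (inj₂ refl)
rotations (suc zero)       zero             = inj₂ (inj₂ refl)
rotations (suc zero)       (suc zero)       = inj₁ refl
rotations (suc zero)       (suc (suc zero)) = inj₂ (inj₁ refl)
rotations (suc (suc zero)) zero             = inj₂ (inj₁ refl)
rotations (suc (suc zero)) (suc zero)       = inj₂ (inj₂ refl)
rotations (suc (suc zero)) (suc (suc zero)) = inj₁ refl

rotate-≢ : ∀ p → rotate p ≢ p
rotate-≢ zero ()
rotate-≢ (suc zero) ()
rotate-≢ (suc (suc zero)) ()

rotate²-≢ : ∀ p → rotate (rotate p) ≢ p
rotate²-≢ zero ()
rotate²-≢ (suc zero) ()
rotate²-≢ (suc (suc zero)) ()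

module _ {n : ℕ} where

  Triple : Set
  Triple = SubsetOfSize n 3

  abstract
    triple-members : (S : Triple) → (∃[ i ] i ∈ₛ proj₁ S) ↔ Fin 3
    triple-members (s , p) = subst (λ c → (∃[ i ] i ∈ₛ s) ↔ Fin c) p (members s)

  member : Triple → Fin 3 → Fin n
  member S p = proj₁ (Inverse.from (triple-members S) p)

  member-∈ : ∀ S p → member S p ∈ₛ proj₁ S
  member-∈ S p = proj₂ (Inverse.from (triple-members S) p)

  position : ∀ S {i} → i ∈ₛ proj₁ S → Fin 3
  position S i∈S = Inverse.to (triple-members S) (_ , i∈S)

  member-position : ∀ S {i} (i∈S : i ∈ₛ proj₁ S) → member S (position S i∈S) ≡ i
  member-position S i∈S = cong proj₁ (Inverse.strictlyInverseʳ (triple-members S) (_ , i∈S))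

  member-injective : ∀ S {p q} → member S p ≡ member S q → p ≡ q
  member-injective S {p} {q} eq = ↔-injective (Symmetry.↔-sym (triple-members S))
    (Product.Σ-≡,≡→≡ (eq , []=-irrelevant _ _))

  ⟨_,_,_⟩ : Fin n → Fin n → Fin n → Subset n
  ⟨ a , b , c ⟩ = ⁅ a ⁆ ∪ (⁅ b ⁆ ∪ ⁅ c ⁆)

  ∈⟨⟩⁻ : ∀ {a b c x} → x ∈ₛ ⟨ a , b , c ⟩ → x ≡ a ⊎ x ≡ b ⊎ x ≡ c
  ∈⟨⟩⁻ {a} {b} {c} x∈ with Subset.x∈p∪q⁻ ⁅ a ⁆ (⁅ b ⁆ ∪ ⁅ c ⁆) x∈
  ... | inj₁ x∈a = inj₁ (Subset.x∈⁅y⁆⇒x≡y a x∈a)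
  ... | inj₂ x∈bc with Subset.x∈p∪q⁻ ⁅ b ⁆ ⁅ c ⁆ x∈bc
  ... | inj₁ x∈b = inj₂ (inj₁ (Subset.x∈⁅y⁆⇒x≡y b x∈b))
  ... | inj₂ x∈c = inj₂ (inj₂ (Subset.x∈⁅y⁆⇒x≡y c x∈c))

  ∈⟨⟩⁺ : ∀ {a b c x} → x ≡ a ⊎ x ≡ b ⊎ x ≡ c → x ∈ₛ ⟨ a , b , c ⟩
  ∈⟨⟩⁺ {a} {b} {c} (inj₁ refl)        = Subset.x∈p∪q⁺ (inj₁ (Subset.x∈⁅x⁆ a))
  ∈⟨⟩⁺ {a} {b} {c} (inj₂ (inj₁ refl)) = Subset.x∈p∪q⁺ (inj₂ (Subset.x∈p∪q⁺ (inj₁ (Subset.x∈⁅x⁆ b))))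
  ∈⟨⟩⁺ {a} {b} {c} (inj₂ (inj₂ refl)) = Subset.x∈p∪q⁺ (inj₂ (Subset.x∈p∪q⁺ (inj₂ (Subset.x∈⁅x⁆ c))))

  ⟨⟩-⊆ : ∀ {a b c s} → a ∈ₛ s → b ∈ₛ s → c ∈ₛ s → ⟨ a , b , c ⟩ ⊆ₛ s
  ⟨⟩-⊆ a∈ b∈ c∈ x∈ with ∈⟨⟩⁻ x∈
  ... | inj₁ refl        = a∈
  ... | inj₂ (inj₁ refl) = b∈
  ... | inj₂ (inj₂ refl) = c∈

  ⟨⟩-rotate : ∀ a b c → ⟨ a , b , c ⟩ ≡ ⟨ b , c , a ⟩
  ⟨⟩-rotate a b c = Subset.⊆-antisym
    (⟨⟩-⊆ (∈⟨⟩⁺ (inj₂ (inj₂ refl))) (∈⟨⟩⁺ (inj₁ refl)) (∈⟨⟩⁺ (inj₂ (inj₁ refl))))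
    (⟨⟩-⊆ (∈⟨⟩⁺ (inj₂ (inj₁ refl))) (∈⟨⟩⁺ (inj₂ (inj₂ refl))) (∈⟨⟩⁺ (inj₁ refl)))

  ⟨⟩-swap : ∀ a b c → ⟨ a , b , c ⟩ ≡ ⟨ a , c , b ⟩
  ⟨⟩-swap a b c = Subset.⊆-antisym
    (⟨⟩-⊆ (∈⟨⟩⁺ (inj₁ refl)) (∈⟨⟩⁺ (inj₂ (inj₂ refl))) (∈⟨⟩⁺ (inj₂ (inj₁ refl))))
    (⟨⟩-⊆ (∈⟨⟩⁺ (inj₁ refl)) (∈⟨⟩⁺ (inj₂ (inj₂ refl))) (∈⟨⟩⁺ (inj₂ (inj₁ refl))))

  ∣⟨⟩∣ : ∀ {a b c} → Distinct a b c → ∣ ⟨ a , b , c ⟩ ∣ ≡ 3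
  ∣⟨⟩∣ {a} {b} {c} (a≢b , a≢c , b≢c) = ℕ.≤-antisym
    (↔-card-surjective (Identity.↔-id _) (members ⟨ a , b , c ⟩) f f-surj)
    (↔-card-injective (Identity.↔-id _) (members ⟨ a , b , c ⟩) f (λ {p} {q} eq → f-inj p q (cong proj₁ eq)))
    where
    f : Fin 3 → ∃[ i ] i ∈ₛ ⟨ a , b , c ⟩
    f zero             = a , ∈⟨⟩⁺ (inj₁ refl)
    f (suc zero)       = b , ∈⟨⟩⁺ (inj₂ (inj₁ refl))
    f (suc (suc zero)) = c , ∈⟨⟩⁺ (inj₂ (inj₂ refl))
    f-surj : ∀ y → ∃[ p ] f p ≡ y
    f-surj (x , x∈) with ∈⟨⟩⁻ x∈
    ... | inj₁ refl        = zero , cong (_ ,_) ([]=-irrelevant _ _)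
    ... | inj₂ (inj₁ refl) = suc zero , cong (_ ,_) ([]=-irrelevant _ _)
    ... | inj₂ (inj₂ refl) = suc (suc zero) , cong (_ ,_) ([]=-irrelevant _ _)
    f-inj : ∀ p q → proj₁ (f p) ≡ proj₁ (f q) → p ≡ q
    f-inj zero             zero             _  = refl
    f-inj zero             (suc zero)       eq = contradiction eq a≢b
    f-inj zero             (suc (suc zero)) eq = contradiction eq a≢c
    f-inj (suc zero)       zero             eq = contradiction (sym eq) a≢b
    f-inj (suc zero)       (suc zero)       _  = refl
    f-inj (suc zero)       (suc (suc zero)) eq = contradiction eq b≢c
    f-inj (suc (suc zero)) zero             eq = contradiction (sym eq) a≢c
    f-inj (suc (suc zero)) (suc zero)       eq = contradiction (sym eq) b≢c
    f-inj (suc (suc zero)) (suc (suc zero)) _  = refl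

  triple : ∀ {a b c} → Distinct a b c → Triple
  triple {a} {b} {c} d = ⟨ a , b , c ⟩ , ∣⟨⟩∣ d

  next₁ next₂ : Triple → Fin 3 → Fin n
  next₁ S p = member S (rotate p)
  next₂ S p = member S (rotate (rotate p))

  member-distinct : ∀ S p → Distinct (member S p) (next₁ S p) (next₂ S p)
  member-distinct S p = (rotate-≢ p ∘ sym ∘ member-injective S) ,
    (rotate²-≢ p ∘ sym ∘ member-injective S) , (rotate-≢ (rotate p) ∘ sym ∘ member-injective S)

  triple-member : ∀ S p → ⟨ member S p , next₁ S p , next₂ S p ⟩ ≡ proj₁ S
  triple-member S p = Subset.⊆-antisym
    (⟨⟩-⊆ (member-∈ S p) (member-∈ S (rotate p)) (member-∈ S (rotate (rotate p))))
    λ x∈S → ∈⟨⟩⁺ (subst (λ x → x ≡ member S p ⊎ x ≡ next₁ S p ⊎ x ≡ next₂ S p) (member-position S x∈S)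
      (at (position S x∈S)))
    where
    at : ∀ q → member S q ≡ member S p ⊎ member S q ≡ next₁ S p ⊎ member S q ≡ next₂ S p
    at q with rotations p q
    ... | inj₁ refl        = inj₁ refl
    ... | inj₂ (inj₁ refl) = inj₂ (inj₁ refl)
    ... | inj₂ (inj₂ refl) = inj₂ (inj₂ refl)

  other-pair : ∀ {a b c b′ c′} → Distinct a b c → Distinct a b′ c′ → ⟨ a , b , c ⟩ ≡ ⟨ a , b′ , c′ ⟩ →
    (b′ ≡ b × c′ ≡ c) ⊎ (b′ ≡ c × c′ ≡ b)
  other-pair {a} {b} {c} {b′} {c′} (a≢b , a≢c , b≢c) (a≢b′ , a≢c′ , b′≢c′) eq
    with ∈⟨⟩⁻ (subst (b′ ∈ₛ_) (sym eq) (∈⟨⟩⁺ {x = b′} (inj₂ (inj₁ refl))))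
       | ∈⟨⟩⁻ (subst (c′ ∈ₛ_) (sym eq) (∈⟨⟩⁺ {x = c′} (inj₂ (inj₂ refl))))
  ... | inj₁ eq₁         | _                = contradiction (sym eq₁) a≢b′
  ... | inj₂ _           | inj₁ eq₂         = contradiction (sym eq₂) a≢c′
  ... | inj₂ (inj₁ eq₁)  | inj₂ (inj₁ eq₂)  = contradiction (trans eq₁ (sym eq₂)) b′≢c′
  ... | inj₂ (inj₂ eq₁)  | inj₂ (inj₂ eq₂)  = contradiction (trans eq₁ (sym eq₂)) b′≢c′
  ... | inj₂ (inj₁ eq₁)  | inj₂ (inj₂ eq₂)  = inj₁ (eq₁ , eq₂)
  ... | inj₂ (inj₂ eq₁)  | inj₂ (inj₁ eq₂)  = inj₂ (eq₁ , eq₂)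

  fourth : 4 ≤ n → ∀ (S : Triple) → ∃[ d ] ¬ (d ∈ₛ proj₁ S)
  fourth 4≤n (s , p) with Fin.all? (Subset._∈? s)
  ... | no ¬all = Fin.¬∀⟶∃¬ n (_∈ₛ s) (Subset._∈? s) ¬all
  ... | yes all = contradiction (ℕ.≤-trans 4≤n (subst (n ≤_) p
      (↔-card-injective (Identity.↔-id _) (members s) (λ i → i , all i) (cong proj₁)))) ℕ.1+n≰n

-- The Levi graph of the complete hypergraph

module Levi (m n : ℕ) where

  #triples : ℕ
  #triples = (n C 3) * m

  -- An edge is given as a copy of a triple with the position of one of its members, so that the
  -- number of edges is `#triples * 3` by construction.
  LeviVertex LeviEdge : Set
  LeviVertex = Fin n ⊎ (Triple {n} × Fin m)
  LeviEdge   = (Triple {n} × Fin m) × Fin 3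

  abstract
    leviVertices : LeviVertex ↔ Fin (n + #triples)
    leviVertices = Compose._↔-∘_ (Symmetry.↔-sym Fin.+↔⊎) (Identity.↔-id _ ⊎-↔
      Compose._↔-∘_ (Symmetry.↔-sym Fin.*↔×) (subsets n 3 ×-↔ Identity.↔-id _))

    leviEdges : LeviEdge ↔ Fin (#triples * 3)
    leviEdges = Compose._↔-∘_ (Symmetry.↔-sym Fin.*↔×) (
      Compose._↔-∘_ (Symmetry.↔-sym Fin.*↔×) (subsets n 3 ×-↔ Identity.↔-id _) ×-↔ Identity.↔-id _)

  elementEnd : LeviEdge → Fin n
  elementEnd ((S , t) , p) = member S p

  tripleEnd : LeviEdge → Triple × Fin m
  tripleEnd (St , p) = St

  ends-injective : ∀ {j j′} → elementEnd j ≡ elementEnd j′ → tripleEnd j ≡ tripleEnd j′ → j ≡ j′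
  ends-injective {(S , t) , p} {.(S , t) , p′} eq refl = cong ((S , t) ,_) (member-injective S eq)

  -- Replacing one of the two other members of the triple by an element outside it gives a second
  -- triple through the same element.
  element-degree : 4 ≤ n → ∀ j → ∃[ j′ ] (j′ ≢ j × elementEnd j′ ≡ elementEnd j)
  element-degree 4≤n ((S , t) , p) with fourth 4≤n S
  ... | d , d∉S = ((S′ , t) , position S′ a∈S′) , S′≢S , member-position S′ a∈S′
    where
    a b : Fin n
    a = member S p
    b = next₁ S p
    a≢b = proj₁ (member-distinct S p)
    S′ : Triple
    S′ = triple {a = a} {b} {d} (a≢b , (λ { refl → d∉S (member-∈ S p) }) , (λ { refl → d∉S (member-∈ S (rotate p)) }))
    a∈S′ : a ∈ₛ proj₁ S′
    a∈S′ = ∈⟨⟩⁺ (inj₁ refl)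
    S′≢S : ((S′ , t) , position S′ a∈S′) ≢ ((S , t) , p)
    S′≢S eq = d∉S (subst (λ j → d ∈ₛ proj₁ (proj₁ (tripleEnd j))) eq (∈⟨⟩⁺ (inj₂ (inj₂ refl))))

  triple-degree : ∀ j → ∃[ j′ ] (j′ ≢ j × tripleEnd j′ ≡ tripleEnd j)
  triple-degree (St , p) = (St , rotate p) , (λ eq → rotate-≢ p (cong proj₂ eq)) , refl

  module _ {S : CellDecomposition} (G : Subgraph (leviGraph (completeHypergraph m n)) S) where
    open CellDecomposition S
    open Subgraph G

    private
      edgeOf : Fin (#triples * 3) → LeviEdge
      edgeOf = Inverse.from leviEdges

      flag : ∀ j → ∃[ x ] (vertexOf x ≡ place (inj₁ (elementEnd j)) × vertexOf (τ₀ x) ≡ place (inj₂ (tripleEnd j)))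
      flag ((T , t) , p) = place-edge {inj₁ (member T p)} {inj₂ (T , t)} (member-∈ T p)

      transport : ∀ {X : Set} (f : LeviEdge → X) → (∀ j → ∃[ j′ ] (j′ ≢ j × f j′ ≡ f j)) →
        (g : X → Fin #vertices) → ∀ i → ∃[ i′ ] (i′ ≢ i × g (f (edgeOf i′)) ≡ g (f (edgeOf i)))
      transport f degree g i with degree (edgeOf i)
      ... | j′ , j′≢j , eq = Inverse.to leviEdges j′ ,
        (λ { refl → j′≢j (sym (Inverse.strictlyInverseʳ leviEdges j′)) }) ,
        cong g (trans (cong f (Inverse.strictlyInverseʳ leviEdges j′)) eq)

      leviPlaces : List (Fin #vertices)
      leviPlaces = tabulate (place ∘ Inverse.from leviVertices)

      place∈ : ∀ v → place v ∈ leviPlaces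
      place∈ v = subst (λ w → place w ∈ leviPlaces) (Inverse.strictlyInverseʳ leviVertices v)
        (∈-tabulate⁺ (Inverse.to leviVertices v))

    levi-euler-bound : 4 ≤ n → Fin (#triples * 3) →
      2 * (#vertices + #faces) + #triples * 3 ≤ 2 * #edges + 2 * (n + #triples)
    levi-euler-bound 4≤n j₀ = subst (λ l → 2 * (#vertices + #faces) + #triples * 3 ≤ 2 * #edges + 2 * l)
      (List.length-tabulate (place ∘ Inverse.from leviVertices))
      (BipartiteBound.euler-bound S
        (λ i → proj₁ (flag (edgeOf i)))
        (λ i → place (inj₁ (elementEnd (edgeOf i)))) (λ i → place (inj₂ (tripleEnd (edgeOf i))))
        (λ i → proj₁ (proj₂ (flag (edgeOf i)))) (λ i → proj₂ (proj₂ (flag (edgeOf i))))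
        (λ i i′ eq → inj₁≢inj₂ (place-injective eq))
        (λ l r → ↔-injective (Symmetry.↔-sym leviEdges)
          (ends-injective (inj₁-inj (place-injective l)) (inj₂-inj (place-injective r))))
        (transport elementEnd (element-degree 4≤n) (place ∘ inj₁))
        (transport tripleEnd triple-degree (place ∘ inj₂))
        j₀ leviPlaces
        (Unique.tabulate⁺ (λ eq → ↔-injective (Symmetry.↔-sym leviVertices) (place-injective eq)))
        (λ i → place∈ _) (λ i → place∈ _))
      where
      inj₁≢inj₂ : ∀ {a b} → _≢_ {A = LeviVertex} (inj₁ a) (inj₂ b)
      inj₁≢inj₂ ()
      inj₁-inj : ∀ {a b} → _≡_ {A = LeviVertex} (inj₁ a) (inj₁ b) → a ≡ b
      inj₁-inj refl = refl
      inj₂-inj : ∀ {a b} → _≡_ {A = LeviVertex} (inj₂ a) (inj₂ b) → a ≡ b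
      inj₂-inj refl = refl

-- Cyclic permutations

module Cycle {A : Set} (_≟_ : DecidableEquality A) where

  swap : A → A → A → A
  swap a b x with a ≟ x | b ≟ x
  ... | yes _ | _     = b
  ... | no _  | yes _ = a
  ... | no _  | no _  = x

  swap-left : ∀ a b → swap a b a ≡ b
  swap-left a b with a ≟ a
  ... | yes _ = refl
  ... | no ne = contradiction refl ne

  swap-right : ∀ a b → swap a b b ≡ a
  swap-right a b with a ≟ b | b ≟ b
  ... | yes refl | _     = refl
  ... | no _     | yes _ = refl
  ... | no _     | no ne = contradiction refl ne

  swap-other : ∀ {a b x} → x ≢ a → x ≢ b → swap a b x ≡ x
  swap-other {a} {b} {x} x≢a x≢b with a ≟ x | b ≟ x
  ... | yes eq | _      = contradiction (sym eq) x≢a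
  ... | no _   | yes eq = contradiction (sym eq) x≢b
  ... | no _   | no _   = refl

  swap-involutive : ∀ a b x → swap a b (swap a b x) ≡ x
  swap-involutive a b x with a ≟ x in eqa | b ≟ x in eqb
  ... | yes refl | _        = swap-right a b
  ... | no _     | yes refl = swap-left a b
  ... | no ne    | no ne′   = swap-other (ne ∘ sym) (ne′ ∘ sym)

  -- cycle i (l₁ ∷ … ∷ lᵣ ∷ []) is the cyclic permutation i ↦ l₁ ↦ … ↦ lᵣ ↦ i.
  cycle cycle⁻¹ : A → List A → A → A
  cycle i []       x = x
  cycle i (l ∷ ls) x = cycle i ls (swap i l x)
  cycle⁻¹ i []       x = x
  cycle⁻¹ i (l ∷ ls) x = swap i l (cycle⁻¹ i ls x)

  cycle-inverseˡ : ∀ i ls x → cycle i ls (cycle⁻¹ i ls x) ≡ x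
  cycle-inverseˡ i []       x = refl
  cycle-inverseˡ i (l ∷ ls) x = trans (cong (cycle i ls) (swap-involutive i l _)) (cycle-inverseˡ i ls x)

  cycle-inverseʳ : ∀ i ls x → cycle⁻¹ i ls (cycle i ls x) ≡ x
  cycle-inverseʳ i []       x = refl
  cycle-inverseʳ i (l ∷ ls) x = trans (cong (swap i l) (cycle-inverseʳ i ls _)) (swap-involutive i l x)

  cycle-fixes : ∀ {i ls x} → x ≢ i → x ∉ ls → cycle i ls x ≡ x
  cycle-fixes {ls = []}     x≢i x∉ = refl
  cycle-fixes {i} {l ∷ ls} x≢i x∉ = trans (cong (cycle i ls) (swap-other x≢i (x∉ ∘ here)))
    (cycle-fixes x≢i (x∉ ∘ there))

  cycle-preserves : {B : Set} (q : A → B) → ∀ {i ls} → (∀ l → l ∈ ls → q l ≡ q i) → ∀ x → q (cycle i ls x) ≡ q x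
  cycle-preserves q {ls = []} const x = refl
  cycle-preserves q {i} {l ∷ ls} const x =
    trans (cycle-preserves q (λ l′ l′∈ → const l′ (there l′∈)) (swap i l x)) (at x)
    where
    at : ∀ x → q (swap i l x) ≡ q x
    at x with i ≟ x | l ≟ x
    ... | yes refl | _        = const l (here refl)
    ... | no _     | yes refl = sym (const l (here refl))
    ... | no _     | no _     = refl

  -- A cycle stays connected when one arc is deleted. The arc that starts at `i` is the deleted one:
  -- in the links it belongs to the tetrahedron, for which no independent connection is known
  -- beforehand.
  cycle-connects : {B : Set} {R : Rel B 0ℓ} → IsEquivalence R → (f : A → B) → ∀ {i ls} → Unique (i ∷ ls) →
    (∀ l → l ∈ ls → R (f (cycle i ls l)) (f l)) → ∀ l → l ∈ i ∷ ls → R (f l) (f (cycle i ls i))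
  cycle-connects eqv f {ls = []} u steps l (here refl) = IsEquivalence.refl eqv
  cycle-connects {R = R} eqv f {i} {l ∷ ls} ((i≢l ∷ i∉ls) ∷ l∉ls ∷ u) steps = all
    where
    open IsEquivalence eqv renaming (refl to ~refl; sym to ~sym; trans to ~trans)
    ihyp : ∀ l′ → l′ ∈ i ∷ ls → R (f l′) (f (cycle i ls i))
    ihyp = cycle-connects {R = R} eqv f {i} {ls} (i∉ls ∷ u)
      λ l′ l′∈ → subst (λ x → R (f (cycle i ls x)) (f l′))
        (swap-other (λ { refl → All.lookup i∉ls l′∈ refl }) (λ { refl → All.lookup l∉ls l′∈ refl }))
        (steps l′ (there l′∈))
    last : R (f (cycle i ls i)) (f l)
    last = subst (λ x → R (f (cycle i ls x)) (f l)) (swap-right i l) (steps l (here refl))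
    image : cycle i (l ∷ ls) i ≡ l
    image = trans (cong (cycle i ls) (swap-left i l)) (cycle-fixes (i≢l ∘ sym) (λ l∈ → All.lookup l∉ls l∈ refl))
    to-l : ∀ l′ → l′ ∈ i ∷ l ∷ ls → R (f l′) (f l)
    to-l l′ (here eq)            = ~trans (ihyp l′ (here eq)) last
    to-l l′ (there (here refl))  = ~refl
    to-l l′ (there (there l′∈))  = ~trans (ihyp l′ (there l′∈)) last
    all : ∀ l′ → l′ ∈ i ∷ l ∷ ls → R (f l′) (f (cycle i (l ∷ ls) i))
    all l′ l′∈ = subst (λ x → R (f l′) (f x)) (sym image) (to-l l′ l′∈)

  rotation rotation⁻¹ : List A → A → A
  rotation []       x = x
  rotation (l ∷ ls) x = cycle l ls x
  rotation⁻¹ []       x = x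
  rotation⁻¹ (l ∷ ls) x = cycle⁻¹ l ls x

  rotation-inverseˡ : ∀ ls x → rotation ls (rotation⁻¹ ls x) ≡ x
  rotation-inverseˡ []       x = refl
  rotation-inverseˡ (l ∷ ls) x = cycle-inverseˡ l ls x

  rotation-inverseʳ : ∀ ls x → rotation⁻¹ ls (rotation ls x) ≡ x
  rotation-inverseʳ []       x = refl
  rotation-inverseʳ (l ∷ ls) x = cycle-inverseʳ l ls x

  rotation-fixes : ∀ {ls x} → x ∉ ls → rotation ls x ≡ x
  rotation-fixes {[]}     x∉ = refl
  rotation-fixes {l ∷ ls} x∉ = cycle-fixes (x∉ ∘ here) (x∉ ∘ there)

  rotation-preserves : {B : Set} (q : A → B) → ∀ {ls} → (∀ l l′ → l ∈ ls → l′ ∈ ls → q l ≡ q l′) →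
    ∀ x → q (rotation ls x) ≡ q x
  rotation-preserves q {[]}     const x = refl
  rotation-preserves q {l ∷ ls} const x = cycle-preserves q (λ l′ l′∈ → const l′ l (there l′∈) (here refl)) x

  rotation-connects : {B : Set} {R : Rel B 0ℓ} → IsEquivalence R → (f : A → B) → ∀ {ls} → Unique ls →
    (∀ l → l ∈ ls → R (f (rotation ls l)) (f l)) → ∀ l l′ → l ∈ ls → l′ ∈ ls → R (f l) (f l′)
  rotation-connects eqv f {x ∷ ls} u steps l l′ l∈ l′∈ = IsEquivalence.trans eqv
    (cycle-connects eqv f u (λ y y∈ → steps y (there y∈)) l l∈)
    (IsEquivalence.sym eqv (cycle-connects eqv f u (λ y y∈ → steps y (there y∈)) l′ l′∈))

  -- If `x` were fixed, the rotation would respect the partition into `x` and everything else,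
  -- although it connects `x` with `y`.
  rotation-moves : ∀ {ls} → Unique ls → ∀ {x y} → x ∈ ls → y ∈ ls → x ≢ y → rotation ls x ≢ x
  rotation-moves {ls} u {x} {y} x∈ y∈ x≢y fixed =
    x≢y (sym (proj₁ (rotation-connects R-eqv id u step x y x∈ y∈) refl))
    where
    R : Rel A 0ℓ
    R a b = (a ≡ x → b ≡ x) × (b ≡ x → a ≡ x)
    R-eqv : IsEquivalence R
    R-eqv = record
      { refl = id , id ; sym = λ (f , g) → g , f ; trans = λ (f , g) (f′ , g′) → f′ ∘ f , g ∘ g′ }
    step : ∀ l → l ∈ ls → R (rotation ls l) l
    step l _ = (λ eq → trans (sym (rotation-inverseʳ ls l))
        (trans (cong (rotation⁻¹ ls) (trans eq (sym fixed))) (rotation-inverseʳ ls x))) ,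
      λ { refl → fixed }

-- The transitions of the links.  The vertices (i , false) and (i , true) play the
-- roles of xᵢ and yᵢ.  Before the cycles are applied, mate describes m copies of
-- the boundaries of the tetrahedra xᵢ yᵢ xⱼ yⱼ and of the octahedra with antipodal
-- pairs xᵢ yᵢ, xⱼ yⱼ, xₗ yₗ.  Where θ i l t is true, the roles of xₗ and yₗ are
-- exchanged in the transition between xᵢ and yᵢ, which reverses the t-th copy of the
-- tetrahedron there.

module Mates (k m : ℕ) (θ : Fin k → Fin k → Fin m → Bool) (θ-diagonal : ∀ i t → θ i i t ≡ false) where

  Point Corner Index : Set
  Point  = Fin k × Bool
  Corner = Point × Fin m
  Index  = Fin k × Fin m

  _≟P_ : DecidableEquality Point
  _≟P_ = Product.≡-dec Fin._≟_ Bool._≟_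

  _≟I_ : DecidableEquality Index
  _≟I_ = Product.≡-dec Fin._≟_ Fin._≟_

  open Cycle (Fin._≟_ {k}) public using () renaming
    ( swap to swapᵢ ; swap-left to swapᵢ-left ; swap-right to swapᵢ-right ; swap-other to swapᵢ-other
    ; swap-involutive to swapᵢ-involutive ; cycle to cycleᵢ ; cycle⁻¹ to cycleᵢ⁻¹
    ; cycle-inverseˡ to cycleᵢ-inverseˡ ; cycle-inverseʳ to cycleᵢ-inverseʳ ; cycle-fixes to cycleᵢ-fixes
    ; cycle-preserves to cycleᵢ-preserves ; cycle-connects to cycleᵢ-connects )
  open Cycle _≟I_ public using
    ( rotation ; rotation⁻¹ ; rotation-inverseˡ ; rotation-inverseʳ ; rotation-fixes
    ; rotation-preserves ; rotation-connects ; rotation-moves )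

  infix 4 _<?ᵇ_
  _<?ᵇ_ : Fin k → Fin k → Bool
  i <?ᵇ j = toℕ i <ᵇ toℕ j

  -- The parity of the order of three distinct indices: invariant under rotation and negated by an
  -- exchange. As `χ i j l` and `χ i l j` differ, the octahedron of `i`, `j`, `l` is joined, in the
  -- link of `xᵢ`, at exactly one of `yⱼ` and `yₗ`.
  χ : Fin k → Fin k → Fin k → Bool
  χ i j l = (i <?ᵇ j) xor ((j <?ᵇ l) xor (l <?ᵇ i))

  -- Selects the octahedra whose face `xᵢ yⱼ yₗ` has the same orientation along `xᵢ yⱼ` as the face
  -- `xᵢ yⱼ yᵢ` of the tetrahedron.
  InGroup : Fin k → Fin k → Fin k → Set
  InGroup i j l = l ≢ i × l ≢ j × χ i j l ≡ true

  inGroup? : ∀ i j l → Dec (InGroup i j l)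
  inGroup? i j l = ¬? (l Fin.≟ i) ×-dec ¬? (l Fin.≟ j) ×-dec (χ i j l Bool.≟ true)

  group : Fin k → Fin k → List (Fin k)
  group i j = filter (inGroup? i j) (allFin k)

  ∈-group⁺ : ∀ {i j l} → InGroup i j l → l ∈ group i j
  ∈-group⁺ {i} {j} {l} = ∈-filter⁺ (inGroup? i j) (∈-allFin l)

  ∈-group⁻ : ∀ {i j l} → l ∈ group i j → InGroup i j l
  ∈-group⁻ {i} {j} l∈ = proj₂ (∈-filter⁻ (inGroup? i j) {xs = allFin k} l∈)

  group-unique : ∀ i j → Unique (i ∷ group i j)
  group-unique i j = All.tabulate (λ l∈ eq → proj₁ (∈-group⁻ l∈) (sym eq)) ∷
    Unique.filter⁺ (inGroup? i j) (Unique.allFin⁺ k)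

  -- `(l , t)` stands for the t-th copy of the tetrahedron `xᵢ yᵢ xₗ yₗ`, whose trace in the links
  -- of `xᵢ` and `yᵢ` is a triangle.
  triangles : Fin k → List Index
  triangles i = filter (λ x → ¬? (proj₁ x Fin.≟ i)) (cartesianProduct (allFin k) (allFin m))

  ∈-triangles⁺ : ∀ {i l t} → l ≢ i → (l , t) ∈ triangles i
  ∈-triangles⁺ {i} {l} {t} = ∈-filter⁺ (λ x → ¬? (proj₁ x Fin.≟ i)) (∈-cartesianProduct⁺ (∈-allFin l) (∈-allFin t))

  ∈-triangles⁻ : ∀ {i x} → x ∈ triangles i → proj₁ x ≢ i
  ∈-triangles⁻ {i} x∈ = proj₂ (∈-filter⁻ (λ x → ¬? (proj₁ x Fin.≟ i)) {xs = cartesianProduct (allFin k) (allFin m)} x∈)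

  triangles-unique : ∀ i → Unique (triangles i)
  triangles-unique i = Unique.filter⁺ (λ x → ¬? (proj₁ x Fin.≟ i))
    (Unique.cartesianProduct⁺ (Unique.allFin⁺ k) (Unique.allFin⁺ m))

  twist : Fin k → Corner → Corner
  twist i ((l , p) , t) = (l , p xor θ i l t) , t

  -- A corner is the third element of a triple through the given pair, with the number of the copy.
  -- At `xᵢ xⱼ` the two faces of the tetrahedron have third elements `yᵢ` and `yⱼ`, those of an
  -- octahedron `xₗ` and `yₗ`; `cross` is the analogue for `xᵢ yⱼ`, and `loop` for `xᵢ yᵢ`. Corners
  -- at the pair itself belong to no triple; they are exchanged with each other, which makes the
  -- maps total involutions.
  same cross : Fin k → Fin k → Corner → Corner
  loop : Fin k → Corner → Corner

  same i j ((l , p) , t) with i Fin.≟ l | j Fin.≟ l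
  ... | yes _ | _     = (j , p) , t
  ... | no _  | yes _ = (i , p) , t
  ... | no _  | no _  = (l , not p) , t

  cross i j ((l , true)  , t) = (swapᵢ i j (cycleᵢ i (group i j) l) , false) , t
  cross i j ((l , false) , t) = (cycleᵢ⁻¹ i (group i j) (swapᵢ i j l) , true) , t

  loop i ((l , true)  , t) = (proj₁ (rotation (triangles i) (l , t)) , false) , proj₂ (rotation (triangles i) (l , t))
  loop i ((l , false) , t) = (proj₁ (rotation⁻¹ (triangles i) (l , t)) , true) , proj₂ (rotation⁻¹ (triangles i) (l , t))

  mixed : Fin k → Fin k → Corner → Corner
  mixed i j with i Fin.≟ j
  ... | yes _ = λ c → twist i (loop i (twist i c))
  ... | no _  = cross i j

  mixed-loop : ∀ i c → mixed i i c ≡ twist i (loop i (twist i c))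
  mixed-loop i c with i Fin.≟ i
  ... | yes _ = refl
  ... | no ne = contradiction refl ne

  mixed-cross : ∀ {i j} → i ≢ j → ∀ c → mixed i j c ≡ cross i j c
  mixed-cross {i} {j} i≢j c with i Fin.≟ j
  ... | yes eq = contradiction eq i≢j
  ... | no _   = refl

  mate : Point → Point → Corner → Corner
  mate (i , false) (j , false) = same i j
  mate (i , true)  (j , true)  = same i j
  mate (i , false) (j , true)  = mixed i j
  mate (i , true)  (j , false) = mixed j i

  same-left : ∀ i j p t → same i j ((i , p) , t) ≡ ((j , p) , t)
  same-left i j p t with i Fin.≟ i
  ... | yes _ = refl
  ... | no ne = contradiction refl ne

  same-right : ∀ i j p t → same i j ((j , p) , t) ≡ ((i , p) , t)
  same-right i j p t with i Fin.≟ j | j Fin.≟ j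
  ... | yes refl | _     = refl
  ... | no _     | yes _ = refl
  ... | no _     | no ne = contradiction refl ne

  same-other : ∀ {i j l} p t → l ≢ i → l ≢ j → same i j ((l , p) , t) ≡ ((l , not p) , t)
  same-other {i} {j} {l} p t l≢i l≢j with i Fin.≟ l | j Fin.≟ l
  ... | yes eq | _      = contradiction (sym eq) l≢i
  ... | no _   | yes eq = contradiction (sym eq) l≢j
  ... | no _   | no _   = refl

  same-sym : ∀ i j c → same i j c ≡ same j i c
  same-sym i j ((l , p) , t) with i Fin.≟ l | j Fin.≟ l
  ... | yes refl | yes refl = refl
  ... | yes _    | no _     = refl
  ... | no _     | yes _    = refl
  ... | no _     | no _     = refl

  mate-sym : ∀ a b c → mate a b c ≡ mate b a c
  mate-sym (i , false) (j , false) = same-sym i j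
  mate-sym (i , true)  (j , true)  = same-sym i j
  mate-sym (i , false) (j , true)  c = refl
  mate-sym (i , true)  (j , false) c = refl

  same-involutive : ∀ i j c → same i j (same i j c) ≡ c
  same-involutive i j ((l , p) , t) with i Fin.≟ l in eqi | j Fin.≟ l in eqj
  ... | yes refl | _        = same-right i j p t
  ... | no _     | yes refl = same-left i j p t
  ... | no ne    | no ne′   = trans (same-other (not p) t (ne ∘ sym) (ne′ ∘ sym))
    (cong (λ q → (l , q) , t) (Bool.not-involutive p))

  cross-involutive : ∀ i j c → cross i j (cross i j c) ≡ c
  cross-involutive i j ((l , true)  , t) = cong (λ x → (x , true) , t)
    (trans (cong (cycleᵢ⁻¹ i (group i j)) (swapᵢ-involutive i j _)) (cycleᵢ-inverseʳ i (group i j) l))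
  cross-involutive i j ((l , false) , t) = cong (λ x → (x , false) , t)
    (trans (cong (swapᵢ i j) (cycleᵢ-inverseˡ i (group i j) _)) (swapᵢ-involutive i j l))

  loop-involutive : ∀ i c → loop i (loop i c) ≡ c
  loop-involutive i ((l , true)  , t) = cong (λ (l , t) → (l , true) , t) (rotation-inverseʳ (triangles i) (l , t))
  loop-involutive i ((l , false) , t) = cong (λ (l , t) → (l , false) , t) (rotation-inverseˡ (triangles i) (l , t))

  twist-involutive : ∀ i c → twist i (twist i c) ≡ c
  twist-involutive i ((l , p) , t) = cong (λ q → (l , q) , t)
    (trans (Bool.xor-assoc p (θ i l t) (θ i l t)) (trans (cong (p xor_) (Bool.xor-same (θ i l t))) (Bool.xor-identityʳ p)))

  mixed-involutive : ∀ i j c → mixed i j (mixed i j c) ≡ c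
  mixed-involutive i j c with i Fin.≟ j
  ... | no _  = cross-involutive i j c
  ... | yes _ = trans (cong (twist i ∘ loop i) (twist-involutive i (loop i (twist i c))))
    (trans (cong (twist i) (loop-involutive i (twist i c))) (twist-involutive i c))

  mate-involutive : ∀ a b c → mate a b (mate a b c) ≡ c
  mate-involutive (i , false) (j , false) = same-involutive i j
  mate-involutive (i , true)  (j , true)  = same-involutive i j
  mate-involutive (i , false) (j , true)  = mixed-involutive i j
  mate-involutive (i , true)  (j , false) = mixed-involutive j i

  same-fixfree : ∀ {i j} → i ≢ j → ∀ c → same i j c ≢ c
  same-fixfree {i} {j} i≢j ((l , p) , t) eq with i Fin.≟ l | j Fin.≟ l
  ... | yes refl | _        = i≢j (sym (cong (proj₁ ∘ proj₁) eq))
  ... | no _     | yes refl = i≢j (cong (proj₁ ∘ proj₁) eq)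
  ... | no _     | no _     = Bool.not-¬ refl (sym (cong (proj₂ ∘ proj₁) eq))

  cross-fixfree : ∀ i j c → cross i j c ≢ c
  cross-fixfree i j ((l , true)  , t) ()
  cross-fixfree i j ((l , false) , t) ()

  loop-fixfree : ∀ i c → loop i c ≢ c
  loop-fixfree i ((l , true)  , t) ()
  loop-fixfree i ((l , false) , t) ()

  mixed-fixfree : ∀ i j c → mixed i j c ≢ c
  mixed-fixfree i j c eq with i Fin.≟ j
  ... | no _  = cross-fixfree i j c eq
  ... | yes _ = loop-fixfree i (twist i c) (trans (sym (twist-involutive i (loop i (twist i c)))) (cong (twist i) eq))

  mate-fixfree : ∀ {a b} → a ≢ b → ∀ c → mate a b c ≢ c
  mate-fixfree {i , false} {j , false} a≢b = same-fixfree (a≢b ∘ cong (_, false))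
  mate-fixfree {i , true}  {j , true}  a≢b = same-fixfree (a≢b ∘ cong (_, true))
  mate-fixfree {i , false} {j , true}  _   = mixed-fixfree i j
  mate-fixfree {i , true}  {j , false} _   = mixed-fixfree j i

  j∉group : ∀ {i j} → j ∉ group i j
  j∉group j∈ = proj₁ (proj₂ (∈-group⁻ j∈)) refl

  mixed-left : ∀ i j t → proj₁ (mixed i j ((i , false) , t)) ≡ (j , true)
  mixed-right : ∀ i j t → proj₁ (mixed i j ((j , true) , t)) ≡ (i , false)
  mixed-right i j t with i Fin.≟ j
  ... | no i≢j = cong (_, false) (trans (cong (swapᵢ i j) (cycleᵢ-fixes (i≢j ∘ sym) j∉group)) (swapᵢ-right i j))
  ... | yes refl rewrite θ-diagonal i t
    | rotation-fixes {triangles i} {i , t} (λ x∈ → ∈-triangles⁻ x∈ refl) | θ-diagonal i t = refl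
  mixed-left i j t = trans (cong (proj₁ ∘ mixed i j) (sym at-right))
    (cong proj₁ (mixed-involutive i j ((j , true) , t)))
    where
    at-right : mixed i j ((j , true) , t) ≡ ((i , false) , t)
    at-right = cong₂ _,_ (mixed-right i j t) time
      where
      time : proj₂ (mixed i j ((j , true) , t)) ≡ t
      time with i Fin.≟ j
      ... | no _ = refl
      ... | yes refl rewrite θ-diagonal i t | rotation-fixes {triangles i} {i , t} (λ x∈ → ∈-triangles⁻ x∈ refl) = refl

  mate-left : ∀ a b t → proj₁ (mate a b (a , t)) ≡ b
  mate-left (i , false) (j , false) t = cong proj₁ (same-left i j false t)
  mate-left (i , true)  (j , true)  t = cong proj₁ (same-left i j true t)
  mate-left (i , false) (j , true)  t = mixed-left i j t
  mate-left (i , true)  (j , false) t = mixed-right j i t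

  mate-right : ∀ a b t → proj₁ (mate a b (b , t)) ≡ a
  mate-right a b t = trans (cong proj₁ (mate-sym a b (b , t))) (mate-left b a t)

  -- The corners at `a` and at `b` are sent to one another, so an involution cannot send any other
  -- corner there. Hence mates of genuine triples are genuine triples.
  mate-avoids : ∀ {a b c t} → c ≢ a → c ≢ b → proj₁ (mate a b (c , t)) ≢ a × proj₁ (mate a b (c , t)) ≢ b
  mate-avoids {a} {b} {c} {t} c≢a c≢b =
    (λ eq → c≢b (trans (back a eq) (mate-left a b _))) , (λ eq → c≢a (trans (back b eq) (mate-right a b _)))
    where
    back : ∀ d → proj₁ (mate a b (c , t)) ≡ d → c ≡ proj₁ (mate a b (d , proj₂ (mate a b (c , t))))
    back d refl = sym (cong proj₁ (mate-involutive a b (c , t)))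

-- Connectedness of the links

module Link {k m : ℕ} (i : Fin k) (s : Bool) where

  private
    Point′ Edge′ : Set
    Point′ = Fin k × Bool
    Edge′  = Point′ × (Point′ × Fin m)

  -- `X i` is the element whose link is considered, and `s` its kind. Naming the kinds relative to
  -- it treats the links of `xᵢ` and `yᵢ` together.
  X Y : Fin k → Point′
  X j = j , s
  Y j = j , not s

  private
    data View : Point′ → Set where
      isX : ∀ {j} → j ≢ i → View (X j)
      isY : ∀ {j} → j ≢ i → View (Y j)
      isO : View (Y i)

    view : ∀ b → b ≢ X i → View b
    view (j , p) ne with p Bool.≟ s | j Fin.≟ i
    ... | yes refl | yes refl = contradiction refl ne
    ... | yes refl | no j≢i   = isX j≢i
    ... | no p≢s   | j≟i      rewrite Bool.¬-not p≢s with j≟i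
    ... | yes refl = isO
    ... | no j≢i   = isY j≢i

  -- The edges of the link of X i are connected through the transitions at X j and Y j
  -- first inside each copy of a tetrahedron or an octahedron, then, for each j, between
  -- the tetrahedron {i , j} and the octahedra {i , j , l} with G j l.  The transitions
  -- at Y i finally connect all copies of the tetrahedra.
  connected-link : {R : Rel Edge′ 0ℓ} → IsEquivalence R →
    (G : Fin k → Fin k → Set) → (∀ {j l} → j ≢ i → l ≢ i → j ≢ l → (G j l × ¬ G l j) ⊎ (G l j × ¬ G j l)) →
    (∀ b c t → R (b , c , t) (c , b , t)) →
    (∀ j t → j ≢ i → R (X j , Y i , t) (X j , Y j , t)) →
    (∀ j l t → j ≢ i → l ≢ i → l ≢ j → R (X j , X l , t) (X j , Y l , t)) →
    (∀ j l t → j ≢ i → l ≢ i → l ≢ j → ¬ G j l → R (Y j , Y l , t) (Y j , X l , t)) →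
    (∀ j t → j ≢ i → (∀ l → l ≢ i → l ≢ j → G j l → R (Y j , Y l , t) (Y j , X l , t)) →
      R (Y j , Y i , t) (Y j , X j , t) × (∀ l → l ≢ i → l ≢ j → G j l → R (Y j , Y l , t) (Y j , X j , t))) →
    ((∀ l p t → l ≢ i → R (Y i , (l , p) , t) (Y l , X l , t)) →
      ∀ l l′ t t′ → l ≢ i → l′ ≢ i → R (Y l , X l , t) (Y l′ , X l′ , t′)) →
    ∀ {b c t b′ c′ t′} → b ≢ X i → c ≢ X i → b ≢ c → b′ ≢ X i → c′ ≢ X i → b′ ≢ c′ →
    R (b , c , t) (b′ , c′ , t′)
  connected-link {R} eqv G G-anti flip X-tetra X-octa Y-octa Y-chain O-chain
    {b} {c} {t} {b′} {c′} {t′} b≢ c≢ b≢c b′≢ c′≢ b′≢c′ =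
    meet (to-triangle (view b b≢) (view c c≢) b≢c) (to-triangle (view b′ b′≢) (view c′ c′≢) b′≢c′)
    where
    open IsEquivalence eqv renaming (refl to ~refl; sym to ~sym; trans to ~trans)

    -- The side opposite to `Y i` in the triangle that the tetrahedron leaves in the link.
    -- Everything is first connected to one of these sides.
    D : Fin k → Fin m → Edge′
    D l t = Y l , X l , t

    -- The octahedron leaves a quadrilateral in the link. When it is cut open at `Y j`, its other
    -- corners `Y l`, `X j`, `X l` still have their original transitions and connect the two ends.
    opposite : ∀ {j l} t → j ≢ i → l ≢ i → j ≢ l → ¬ G l j → R (Y j , Y l , t) (Y j , X l , t)
    opposite {j} {l} t j≢i l≢i j≢l ¬G =
      ~trans (flip _ _ _) (~trans (Y-octa l j t l≢i j≢i j≢l ¬G)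
      (~trans (flip _ _ _) (~trans (~sym (X-octa j l t j≢i l≢i (j≢l ∘ sym)))
      (~trans (flip _ _ _) (~trans (X-octa l j t l≢i j≢i j≢l) (flip _ _ _))))))

    chain : ∀ j t → j ≢ i →
      R (Y j , Y i , t) (D j t) × (∀ l → l ≢ i → l ≢ j → G j l → R (Y j , Y l , t) (D j t))
    chain j t j≢i = Y-chain j t j≢i λ l l≢i l≢j Gjl → opposite t j≢i l≢i (l≢j ∘ sym) (¬back l≢i l≢j Gjl)
      where
      ¬back : ∀ {l} → l ≢ i → l ≢ j → G j l → ¬ G l j
      ¬back l≢i l≢j Gjl with G-anti j≢i l≢i (l≢j ∘ sym)
      ... | inj₁ (_ , ¬Glj) = ¬Glj
      ... | inj₂ (_ , ¬Gjl) = contradiction Gjl ¬Gjl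

    Octa : Fin k → Fin k → Fin m → Edge′ → Set
    Octa j l t d = R (Y j , Y l , t) d × R (Y j , X l , t) d × R (X j , X l , t) d × R (X j , Y l , t) d

    octa : ∀ j l t → j ≢ i → l ≢ i → j ≢ l → G j l → ¬ G l j → Octa j l t (D j t)
    octa j l t j≢i l≢i j≢l Gjl ¬Glj = yy , yx , xx , ~trans (~sym (X-octa j l t j≢i l≢i (j≢l ∘ sym))) xx
      where
      yy : R (Y j , Y l , t) (D j t)
      yy = proj₂ (chain j t j≢i) l l≢i (j≢l ∘ sym) Gjl
      yx : R (Y j , X l , t) (D j t)
      yx = ~trans (~sym (opposite t j≢i l≢i j≢l ¬Glj)) yy
      xx : R (X j , X l , t) (D j t)
      xx = ~trans (flip _ _ _) (~trans (X-octa l j t l≢i j≢i j≢l) (~trans (flip _ _ _) yx))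

    octa-flip : ∀ {j l t d} → Octa l j t d → Octa j l t d
    octa-flip (yy , yx , xx , xy) = ~trans (flip _ _ _) yy , ~trans (flip _ _ _) xy ,
      ~trans (flip _ _ _) xx , ~trans (flip _ _ _) yx

    octa′ : ∀ j l t → j ≢ i → l ≢ i → j ≢ l → ∃[ h ] (h ≢ i × Octa j l t (D h t))
    octa′ j l t j≢i l≢i j≢l with G-anti j≢i l≢i j≢l
    ... | inj₁ (Gjl , ¬Glj) = j , j≢i , octa j l t j≢i l≢i j≢l Gjl ¬Glj
    ... | inj₂ (Glj , ¬Gjl) = l , l≢i , octa-flip (octa l j t l≢i j≢i (j≢l ∘ sym) Glj ¬Gjl)

    XO : ∀ j t → j ≢ i → R (X j , Y i , t) (D j t)
    XO j t j≢i = ~trans (X-tetra j t j≢i) (flip _ _ _)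

    YO : ∀ j t → j ≢ i → R (Y j , Y i , t) (D j t)
    YO j t j≢i = proj₁ (chain j t j≢i)

    to-triangle : ∀ {b c t} → View b → View c → b ≢ c → ∃[ h ] (h ≢ i × R (b , c , t) (D h t))
    to-triangle isO isO b≢c = contradiction refl b≢c
    to-triangle isO (isX {j} j≢i) _ = j , j≢i , ~trans (flip _ _ _) (XO j _ j≢i)
    to-triangle isO (isY {j} j≢i) _ = j , j≢i , ~trans (flip _ _ _) (YO j _ j≢i)
    to-triangle (isX {j} j≢i) isO _ = j , j≢i , XO j _ j≢i
    to-triangle (isY {j} j≢i) isO _ = j , j≢i , YO j _ j≢i
    to-triangle {t = t} (isX {j} j≢i) (isX {l} l≢i) b≢c with octa′ j l t j≢i l≢i (b≢c ∘ cong X)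
    ... | h , h≢i , _ , _ , r , _ = h , h≢i , r
    to-triangle {t = t} (isY {j} j≢i) (isY {l} l≢i) b≢c with octa′ j l t j≢i l≢i (b≢c ∘ cong Y)
    ... | h , h≢i , r , _ = h , h≢i , r
    to-triangle {t = t} (isX {j} j≢i) (isY {l} l≢i) _ with j Fin.≟ l
    ... | yes refl = j , j≢i , flip _ _ _
    ... | no j≢l with octa′ j l t j≢i l≢i j≢l
    ... | h , h≢i , _ , _ , _ , r = h , h≢i , r
    to-triangle {t = t} (isY {j} j≢i) (isX {l} l≢i) _ with j Fin.≟ l
    ... | yes refl = j , j≢i , ~refl
    ... | no j≢l with octa′ j l t j≢i l≢i j≢l
    ... | h , h≢i , _ , r , _ = h , h≢i , r

    at-O : ∀ l p t → l ≢ i → R (Y i , (l , p) , t) (D l t)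
    at-O l p t l≢i with p Bool.≟ s
    ... | yes refl = ~trans (flip _ _ _) (XO l t l≢i)
    ... | no p≢s rewrite Bool.¬-not p≢s = ~trans (flip _ _ _) (YO l t l≢i)

    meet : ∀ {x y t t′} → ∃[ h ] (h ≢ i × R x (D h t)) → ∃[ h ] (h ≢ i × R y (D h t′)) → R x y
    meet {t = t} {t′} (h , h≢i , r) (h′ , h′≢i , r′) =
      ~trans r (~trans (O-chain at-O h h′ t t′ h≢i h′≢i) (~sym r′))

xor-reverse : ∀ a b c → not c xor (not b xor not a) ≡ not (a xor (b xor c))
xor-reverse false false false = refl
xor-reverse false false true  = refl
xor-reverse false true  false = refl
xor-reverse false true  true  = refl
xor-reverse true  false false = refl
xor-reverse true  false true  = refl
xor-reverse true  true  false = refl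
xor-reverse true  true  true  = refl

xor-rotate : ∀ a b c → b xor (c xor a) ≡ a xor (b xor c)
xor-rotate a b c = trans (sym (Bool.xor-assoc b c a)) (Bool.xor-comm (b xor c) a)

module Design (k m : ℕ) (θ : Fin k → Fin k → Fin m → Bool) (θ-diagonal : ∀ i t → θ i i t ≡ false) where
  open Mates k m θ θ-diagonal public

  χ-rotate : ∀ i j l → χ j l i ≡ χ i j l
  χ-rotate i j l = xor-rotate (i <?ᵇ j) (j <?ᵇ l) (l <?ᵇ i)

  χ-swap : ∀ {i j l} → i ≢ j → i ≢ l → j ≢ l → χ i l j ≡ not (χ i j l)
  χ-swap {i} {j} {l} i≢j i≢l j≢l rewrite <ᵇ-flip (i≢l ∘ sym) | <ᵇ-flip j≢l | <ᵇ-flip i≢j =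
    xor-reverse (i <?ᵇ j) (j <?ᵇ l) (l <?ᵇ i)

  private
    exclusive : ∀ {x y} → x ≡ not y → (x ≡ true × ¬ y ≡ true) ⊎ (y ≡ true × ¬ x ≡ true)
    exclusive {true}  {false} _ = inj₁ (refl , λ ())
    exclusive {false} {true}  _ = inj₂ (refl , λ ())

  cross-true : ∀ {i j l t} → i ≢ j → mixed i j ((l , true) , t) ≡ ((swapᵢ i j (cycleᵢ i (group i j) l) , false) , t)
  cross-true i≢j = mixed-cross i≢j _

  cross-true-fixed : ∀ {i j l t} → i ≢ j → l ≢ i → l ≢ j → ¬ χ i j l ≡ true →
    mixed i j ((l , true) , t) ≡ ((l , false) , t)
  cross-true-fixed {i} {j} {l} {t} i≢j l≢i l≢j ¬χ = trans (cross-true i≢j)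
    (cong (λ x → (x , false) , t)
      (trans (cong (swapᵢ i j) (cycleᵢ-fixes l≢i λ l∈ → ¬χ (proj₂ (proj₂ (∈-group⁻ l∈))))) (swapᵢ-other l≢i l≢j)))

  cross-false-fixed : ∀ {i j l t} → i ≢ j → l ≢ i → l ≢ j → ¬ χ i j l ≡ true →
    mixed i j ((l , false) , t) ≡ ((l , true) , t)
  cross-false-fixed {i} {j} i≢j l≢i l≢j ¬χ = trans (cong (mixed i j) (sym (cross-true-fixed i≢j l≢i l≢j ¬χ)))
    (mixed-involutive i j _)

  σ-≢ : ∀ {i l t} → l ≢ i → proj₁ (rotation (triangles i) (l , t)) ≢ i
  σ-≢ {i} {l} {t} l≢i eq = contradiction
    (trans (sym (dec-true (proj₁ (rotation (triangles i) (l , t)) Fin.≟ i) eq))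
      (trans (rotation-preserves (λ x → does (proj₁ x Fin.≟ i)) const (l , t)) (dec-false (l Fin.≟ i) l≢i)))
    λ ()
    where
    const : ∀ x y → x ∈ triangles i → y ∈ triangles i → does (proj₁ x Fin.≟ i) ≡ does (proj₁ y Fin.≟ i)
    const x y x∈ y∈ = trans (dec-false (proj₁ x Fin.≟ i) (∈-triangles⁻ x∈))
      (sym (dec-false (proj₁ y Fin.≟ i) (∈-triangles⁻ y∈)))

  loop-twisted : ∀ i l t → mixed i i (twist i ((l , true) , t)) ≡ twist i (loop i ((l , true) , t))
  loop-twisted i l t = trans (mixed-loop i (twist i ((l , true) , t)))
    (cong (twist i ∘ loop i) (twist-involutive i ((l , true) , t)))

  module _ {R : Rel (Point × Corner) 0ℓ} (eqv : IsEquivalence R) (a : Point)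
    (flip : ∀ b c t → R (b , c , t) (c , b , t))
    (turn : ∀ b c → b ≢ a → R (b , c) (b , mate a b c)) where

    private
      open IsEquivalence eqv renaming (refl to ~refl; sym to ~sym; trans to ~trans)

      turn-to : ∀ {b c c′} → b ≢ a → mate a b c ≡ c′ → R (b , c) (b , c′)
      turn-to {b} {c} b≢a refl = turn b c b≢a

    -- In the link of `xᵢ` the cyclic permutations act at the `yⱼ`, in that of `yᵢ` at the `xⱼ`. The
    -- pair is always listed with its x first, so the joining relation is `χ i j l` in one case and
    -- `χ j i l` in the other; both are antisymmetric in `j` and `l`.
    link-connected : ∀ {b c t b′ c′ t′} → b ≢ a → c ≢ a → b ≢ c → b′ ≢ a → c′ ≢ a → b′ ≢ c′ →
      R (b , c , t) (b′ , c′ , t′)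
    link-connected = at a refl
      where
      O-chain : ∀ i s → (∀ c → R ((i , not s) , c) ((i , not s) , mixed i i c)) →
        (∀ l p t → l ≢ i → R ((i , not s) , (l , p) , t) ((l , not s) , (l , s) , t)) →
        ∀ l l′ t t′ → l ≢ i → l′ ≢ i → R ((l , not s) , (l , s) , t) ((l′ , not s) , (l′ , s) , t′)
      O-chain i s turn-O at-O l l′ t t′ l≢i l′≢i =
        rotation-connects eqv D (triangles-unique i) step (l , t) (l′ , t′) (∈-triangles⁺ l≢i) (∈-triangles⁺ l′≢i)
        where
        D : Index → Point × Corner
        D (l , t) = (l , not s) , (l , s) , t
        step : ∀ x → x ∈ triangles i → R (D (rotation (triangles i) x)) (D x)
        -- A twist may change which of `xₗ` and `yₗ` is met, but never which tetrahedron. As `at-O`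
        -- covers both, twisting does not affect connectedness.
        step (l , t) x∈ = ~trans (~sym (at-O _ _ _ (σ-≢ l≢)))
          (~trans (~sym (subst (λ c → R ((i , not s) , twist i ((l , true) , t)) ((i , not s) , c)) (loop-twisted i l t) (turn-O _)))
            (at-O _ _ _ l≢))
          where
          l≢ : l ≢ i
          l≢ = ∈-triangles⁻ x∈

      at : ∀ a′ → a ≡ a′ → ∀ {b c t b′ c′ t′} → b ≢ a → c ≢ a → b ≢ c → b′ ≢ a → c′ ≢ a → b′ ≢ c′ →
        R (b , c , t) (b′ , c′ , t′)
      at (i , false) refl = Link.connected-link i false eqv
        (λ j l → χ i j l ≡ true)
        (λ {j} {l} j≢i l≢i j≢l → exclusive (χ-swap (l≢i ∘ sym) (j≢i ∘ sym) (j≢l ∘ sym)))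
        flip
        (λ j t j≢i → turn-to (j≢i ∘ cong proj₁) (same-left i j true t))
        (λ j l t j≢i l≢i l≢j → turn-to (j≢i ∘ cong proj₁) (same-other false t l≢i l≢j))
        (λ j l t j≢i l≢i l≢j ¬χ → turn-to (j≢i ∘ cong proj₁) (cross-true-fixed (j≢i ∘ sym) l≢i l≢j ¬χ))
        Y-chain
        (O-chain i false (λ c → turn-to (λ ()) refl))
        where
        Y-chain : ∀ j t → j ≢ i →
          (∀ l → l ≢ i → l ≢ j → χ i j l ≡ true → R ((j , true) , (l , true) , t) ((j , true) , (l , false) , t)) →
          R ((j , true) , (i , true) , t) ((j , true) , (j , false) , t) ×
          (∀ l → l ≢ i → l ≢ j → χ i j l ≡ true → R ((j , true) , (l , true) , t) ((j , true) , (j , false) , t))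
        Y-chain j t j≢i opposite = ~trans (turned i) (~trans (~sym (all i (here refl))) f-i) ,
          λ l l≢i l≢j χ → ~trans (opposite l l≢i l≢j χ)
            (~trans (f-other l≢i l≢j) (~trans (all l (there (∈-group⁺ (l≢i , l≢j , χ)))) (~trans (~sym (all i (here refl))) f-i)))
          where
          f : Fin k → Point × Corner
          f l = (j , true) , (swapᵢ i j l , false) , t
          turned : ∀ l → R ((j , true) , (l , true) , t) (f (cycleᵢ i (group i j) l))
          turned l = turn-to (j≢i ∘ cong proj₁) (cross-true (j≢i ∘ sym))
          f-i : R (f i) ((j , true) , (j , false) , t)
          f-i = subst (λ x → R (f i) ((j , true) , (x , false) , t)) (swapᵢ-left i j) ~refl
          f-other : ∀ {l} → l ≢ i → l ≢ j → R ((j , true) , (l , false) , t) (f l)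
          f-other {l} l≢i l≢j = subst (λ x → R ((j , true) , (x , false) , t) (f l)) (swapᵢ-other l≢i l≢j) ~refl
          -- Each octahedron of the group bridges its own cut by `opposite`, which supplies all arcs
          -- except the one starting at `i`, that is, at the tetrahedron.
          all : ∀ l → l ∈ i ∷ group i j → R (f l) (f (cycleᵢ i (group i j) i))
          all = cycleᵢ-connects eqv f (group-unique i j) λ l l∈ →
            let (l≢i , l≢j , χ) = ∈-group⁻ l∈ in
            ~trans (~sym (turned l)) (~trans (opposite l l≢i l≢j χ) (f-other l≢i l≢j))
      at (i , true) refl = Link.connected-link i true eqv
        (λ j l → χ j i l ≡ true)
        (λ {j} {l} j≢i l≢i j≢l → exclusive
          (trans (sym (χ-rotate j i l)) (trans (χ-swap (j≢i ∘ sym) (l≢i ∘ sym) j≢l) (cong not (χ-rotate l i j)))))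
        flip
        (λ j t j≢i → turn-to (j≢i ∘ cong proj₁) (same-left i j false t))
        (λ j l t j≢i l≢i l≢j → turn-to (j≢i ∘ cong proj₁) (same-other true t l≢i l≢j))
        (λ j l t j≢i l≢i l≢j ¬χ → turn-to (j≢i ∘ cong proj₁) (cross-false-fixed j≢i l≢j l≢i ¬χ))
        Y-chain
        (O-chain i true (λ c → turn-to (λ ()) refl))
        where
        Y-chain : ∀ j t → j ≢ i →
          (∀ l → l ≢ i → l ≢ j → χ j i l ≡ true → R ((j , false) , (l , false) , t) ((j , false) , (l , true) , t)) →
          R ((j , false) , (i , false) , t) ((j , false) , (j , true) , t) ×
          (∀ l → l ≢ i → l ≢ j → χ j i l ≡ true → R ((j , false) , (l , false) , t) ((j , false) , (j , true) , t))
        Y-chain j t j≢i opposite = to-j (~trans (~sym f-j) (all j (here refl))) ,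
          λ l l≢i l≢j χ → to-j (~trans (f-other l≢i l≢j) (all l (there (∈-group⁺ (l≢j , l≢i , χ)))))
          where
          f : Fin k → Point × Corner
          f l = (j , false) , (swapᵢ j i l , false) , t
          turned : ∀ l → R ((j , false) , (l , true) , t) (f (cycleᵢ j (group j i) l))
          turned l = turn-to (j≢i ∘ cong proj₁) (cross-true j≢i)
          to-j : ∀ {x} → R x (f (cycleᵢ j (group j i) j)) → R x ((j , false) , (j , true) , t)
          to-j r = ~trans r (~sym (turned j))
          f-j : R (f j) ((j , false) , (i , false) , t)
          f-j = subst (λ x → R (f j) ((j , false) , (x , false) , t)) (swapᵢ-left j i) ~refl
          f-other : ∀ {l} → l ≢ i → l ≢ j → R ((j , false) , (l , false) , t) (f l)
          f-other {l} l≢i l≢j = subst (λ x → R ((j , false) , (x , false) , t) (f l)) (swapᵢ-other l≢j l≢i) ~refl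
          all : ∀ l → l ∈ j ∷ group j i → R (f l) (f (cycleᵢ j (group j i) j))
          all = cycleᵢ-connects eqv f (group-unique j i) λ l l∈ →
            let (l≢j , l≢i , χ) = ∈-group⁻ l∈ in
            ~trans (~sym (turned l)) (~trans (~sym (opposite l l≢i l≢j χ)) (f-other l≢i l≢j))

-- Orientations of the tetrahedra and octahedra

module Oriented (k m : ℕ) (θ : Fin k → Fin k → Fin m → Bool) (θ-diagonal : ∀ i t → θ i i t ≡ false) where
  open Design k m θ θ-diagonal public

  less : Point → Point → Bool
  less (i , p) (j , q) with i Fin.≟ j
  ... | yes _ = not p ∧ q
  ... | no _  = i <?ᵇ j

  -- The parity of the order of `a`, `b`, `c`, changed once for every `yᵢ` among them. On each
  -- tetrahedron and octahedron this is a boundary orientation: two faces that share an edge induce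
  -- opposite values on it.
  o : Point → Point → Point → Bool
  o a b c = (less a b xor (less b c xor less c a)) xor (proj₂ a xor (proj₂ b xor proj₂ c))

  private
    less-same : ∀ i p q → less (i , p) (i , q) ≡ not p ∧ q
    less-same i p q with i Fin.≟ i
    ... | yes _ = refl
    ... | no ne = contradiction refl ne

    less-other : ∀ {i j} p q → i ≢ j → less (i , p) (j , q) ≡ (i <?ᵇ j)
    less-other {i} {j} p q i≢j with i Fin.≟ j
    ... | yes eq = contradiction eq i≢j
    ... | no _   = refl

    less-flip : ∀ {a b} → a ≢ b → less b a ≡ not (less a b)
    less-flip {i , p} {j , q} a≢b with i Fin.≟ j | j Fin.≟ i
    ... | yes refl | no ne    = contradiction refl ne
    ... | no ne    | yes refl = contradiction refl ne
    ... | no i≢j   | no _     = <ᵇ-flip i≢j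
    ... | yes refl | yes refl with p | q
    ... | false | false = contradiction refl a≢b
    ... | false | true  = refl
    ... | true  | false = refl
    ... | true  | true  = contradiction refl a≢b

    reverse₁ : ∀ a b c p q r → (not a xor (not c xor not b)) xor (q xor (p xor r)) ≡ not ((a xor (b xor c)) xor (p xor (q xor r)))
    reverse₁ a b c p q r = trans
      (cong₂ _xor_
        (trans (xor-rotate (not b) (not a) (not c)) (trans (xor-rotate (not c) (not b) (not a)) (xor-reverse a b c)))
        (signs p q r))
      (sym (Bool.not-distribˡ-xor (a xor (b xor c)) (p xor (q xor r))))
      where
      signs : ∀ p q r → q xor (p xor r) ≡ p xor (q xor r)
      signs p q r = trans (sym (Bool.xor-assoc q p r)) (trans (cong (_xor r) (Bool.xor-comm q p)) (Bool.xor-assoc p q r))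

  o-swap₁ : ∀ {a b c} → a ≢ b → a ≢ c → b ≢ c → o b a c ≡ not (o a b c)
  o-swap₁ {a} {b} {c} a≢b a≢c b≢c rewrite less-flip a≢b | less-flip (a≢c ∘ sym) | less-flip b≢c =
    reverse₁ (less a b) (less b c) (less c a) (proj₂ a) (proj₂ b) (proj₂ c)

  o-rotate : ∀ a b c → o b c a ≡ o a b c
  o-rotate a b c = cong₂ _xor_ (xor-rotate (less a b) (less b c) (less c a)) (xor-rotate (proj₂ a) (proj₂ b) (proj₂ c))

  o-swap₂ : ∀ {a b c} → a ≢ b → a ≢ c → b ≢ c → o a c b ≡ not (o a b c)
  o-swap₂ {a} {b} {c} a≢b a≢c b≢c = trans (sym (o-rotate a c b))
    (trans (o-swap₁ b≢c (a≢b ∘ sym) (a≢c ∘ sym)) (cong not (o-rotate a b c)))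

  o-octahedron : ∀ {i j l} p q r → i ≢ j → i ≢ l → j ≢ l →
    o (i , p) (j , q) (l , r) ≡ χ i j l xor (p xor (q xor r))
  o-octahedron p q r i≢j i≢l j≢l
    rewrite less-other p q i≢j | less-other q r j≢l | less-other r p (i≢l ∘ sym) = refl

  o-octahedron-flip : ∀ {i j l} p q r → i ≢ j → i ≢ l → j ≢ l →
    o (i , p) (j , q) (l , not r) ≡ not (o (i , p) (j , q) (l , r))
  o-octahedron-flip {i} {j} {l} p q r i≢j i≢l j≢l
    rewrite o-octahedron p q (not r) i≢j i≢l j≢l | o-octahedron p q r i≢j i≢l j≢l
    | sym (Bool.not-distribʳ-xor q r) | sym (Bool.not-distribʳ-xor p (q xor r)) =
    sym (Bool.not-distribʳ-xor (χ i j l) (p xor (q xor r)))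

  o-tetrahedron₁ : ∀ {i j} p q → i ≢ j → o (i , p) (j , q) (i , not p) ≡ p xor q
  o-tetrahedron₁ {i} {j} p q i≢j
    rewrite less-other p q i≢j | less-other q (not p) (i≢j ∘ sym) | less-same i (not p) p | <ᵇ-flip i≢j = at (i <?ᵇ j) p q
    where
    at : ∀ x p q → (x xor (not x xor (not (not p) ∧ p))) xor (p xor (q xor not p)) ≡ p xor q
    at false false false = refl
    at false false true  = refl
    at false true  false = refl
    at false true  true  = refl
    at true  false false = refl
    at true  false true  = refl
    at true  true  false = refl
    at true  true  true  = refl

  o-tetrahedron₂ : ∀ {i j} p q → i ≢ j → o (i , p) (j , q) (j , not q) ≡ not (p xor q)
  o-tetrahedron₂ {i} {j} p q i≢j
    rewrite less-other p q i≢j | less-other (not q) p (i≢j ∘ sym) | less-same j q (not q) | <ᵇ-flip i≢j = at (i <?ᵇ j) p q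
    where
    at : ∀ x p q → (x xor ((not q ∧ not q) xor not x)) xor (p xor (q xor not q)) ≡ not (p xor q)
    at false false false = refl
    at false false true  = refl
    at false true  false = refl
    at false true  true  = refl
    at true  false false = refl
    at true  false true  = refl
    at true  true  false = refl
    at true  true  true  = refl

  -- The value is independent of `l`, so the transitions at `xᵢ yᵢ` may permute the tetrahedra
  -- arbitrarily without harm to the orientation.
  o-tetrahedron₃ : ∀ {i l} r → l ≢ i → o (i , false) (i , true) (l , r) ≡ not r
  o-tetrahedron₃ {i} {l} r l≢i
    rewrite less-same i false true | less-other true r (l≢i ∘ sym) | less-other r false l≢i | <ᵇ-flip (l≢i ∘ sym) = at (i <?ᵇ l) r
    where
    at : ∀ x r → (true xor (x xor not x)) xor (true xor r) ≡ not r
    at false false = refl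
    at false true  = refl
    at true  false = refl
    at true  true  = refl

  private
    o-same : ∀ {i j} p c → i ≢ j → proj₁ c ≢ (i , p) → proj₁ c ≢ (j , p) →
      o (i , p) (j , p) (proj₁ (same i j c)) ≡ not (o (i , p) (j , p) (proj₁ c))
    o-same {i} {j} p ((l , q) , t) i≢j c≢i c≢j = at l (l Fin.≟ i) (l Fin.≟ j) c≢i c≢j
      where
      at : ∀ l → Dec (l ≡ i) → Dec (l ≡ j) → (l , q) ≢ (i , p) → (l , q) ≢ (j , p) →
        o (i , p) (j , p) (proj₁ (same i j ((l , q) , t))) ≡ not (o (i , p) (j , p) (l , q))
      at l (yes refl) _ c≢i _ rewrite same-left i j q t | Bool.¬-not {q} {p} (c≢i ∘ cong (i ,_)) =
        trans (o-tetrahedron₂ p p i≢j) (cong not (sym (o-tetrahedron₁ p p i≢j)))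
      at l (no _) (yes refl) _ c≢j rewrite same-right i j q t | Bool.¬-not {q} {p} (c≢j ∘ cong (j ,_)) =
        trans (o-tetrahedron₁ p p i≢j)
          (trans (sym (Bool.not-involutive _)) (cong not (sym (o-tetrahedron₂ p p i≢j))))
      at l (no l≢i) (no l≢j) _ _ rewrite same-other {i} {j} q t l≢i l≢j =
        o-octahedron-flip p p q i≢j (l≢i ∘ sym) (l≢j ∘ sym)

    module _ {i j : Fin k} (i≢j : i ≢ j) where

      -- The orientation of the face `xᵢ yⱼ yₗ` along `xᵢ yⱼ`, at a tetrahedron for `l` equal to `i`
      -- and at an octahedron otherwise. It is constant on the cyclically permuted indices.
      sign : Fin k → Bool
      sign l = if does (l Fin.≟ i) then true else χ i j l

      sign-i : sign i ≡ true
      sign-i rewrite dec-true (i Fin.≟ i) refl = refl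

      sign-other : ∀ {l} → l ≢ i → sign l ≡ χ i j l
      sign-other {l} l≢i rewrite dec-false (l Fin.≟ i) l≢i = refl

      sign-true : ∀ l → l ≢ j → o (i , false) (j , true) (l , true) ≡ sign l
      sign-true l l≢j = at l (l Fin.≟ i) l≢j
        where
        at : ∀ l → Dec (l ≡ i) → l ≢ j → o (i , false) (j , true) (l , true) ≡ sign l
        at l (yes refl) _  = trans (o-tetrahedron₁ false true i≢j) (sym sign-i)
        at l (no l≢i)  l≢j = trans (o-octahedron false true true i≢j (l≢i ∘ sym) (l≢j ∘ sym))
          (trans (Bool.xor-identityʳ _) (sym (sign-other l≢i)))

      sign-false : ∀ l → l ≢ j → o (i , false) (j , true) (swapᵢ i j l , false) ≡ not (sign l)
      sign-false l l≢j = at l (l Fin.≟ i) l≢j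
        where
        at : ∀ l → Dec (l ≡ i) → l ≢ j → o (i , false) (j , true) (swapᵢ i j l , false) ≡ not (sign l)
        at l (yes refl) _ = trans (cong (λ x → o (i , false) (j , true) (x , false)) (swapᵢ-left i j))
          (trans (o-tetrahedron₂ false true i≢j) (cong not (sym sign-i)))
        at l (no l≢i) l≢j = trans (cong (λ x → o (i , false) (j , true) (x , false)) (swapᵢ-other l≢i l≢j))
          (trans (o-octahedron false true false i≢j (l≢i ∘ sym) (l≢j ∘ sym))
            (trans (Bool.xor-comm (χ i j l) true) (cong not (sym (sign-other l≢i)))))

      sign-group : ∀ l → l ∈ group i j → sign l ≡ sign i
      sign-group l l∈ = trans (sign-other (proj₁ (∈-group⁻ l∈)))
        (trans (proj₂ (proj₂ (∈-group⁻ l∈))) (sym sign-i))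

      o-cross-true : ∀ l t → l ≢ j →
        o (i , false) (j , true) (proj₁ (mixed i j ((l , true) , t))) ≡ not (o (i , false) (j , true) (l , true))
      o-cross-true l t l≢j rewrite cross-true {l = l} {t} i≢j =
        trans (sign-false (cycleᵢ i (group i j) l) πl≢j)
          (cong not (trans (cycleᵢ-preserves sign sign-group l) (sym (sign-true l l≢j))))
        where
        πl≢j : cycleᵢ i (group i j) l ≢ j
        πl≢j eq = l≢j (trans (sym (cycleᵢ-inverseʳ i (group i j) l))
          (trans (cong (cycleᵢ⁻¹ i (group i j)) (trans eq (sym (cycleᵢ-fixes (i≢j ∘ sym) j∉group))))
            (cycleᵢ-inverseʳ i (group i j) j)))

      -- The mate of this corner is of the other kind, so `o-cross-true` applies there, and the
      -- involution carries its conclusion back.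
      o-cross-false : ∀ l t → (l , false) ≢ (i , false) →
        o (i , false) (j , true) (proj₁ (mixed i j ((l , false) , t))) ≡ not (o (i , false) (j , true) (l , false))
      o-cross-false l t c≢a = sym (begin
        not (o (i , false) (j , true) (l , false))
          ≡⟨ cong (not ∘ o (i , false) (j , true) ∘ proj₁) (mixed-involutive i j ((l , false) , t)) ⟨
        not (o (i , false) (j , true) (proj₁ (mixed i j (mixed i j ((l , false) , t)))))
          ≡⟨ cong (not ∘ o (i , false) (j , true) ∘ proj₁ ∘ mixed i j) (mixed-cross i≢j ((l , false) , t)) ⟩
        not (o (i , false) (j , true) (proj₁ (mixed i j ((l′ , true) , t))))
          ≡⟨ cong not (o-cross-true l′ t l′≢j) ⟩
        not (not (o (i , false) (j , true) (l′ , true)))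
          ≡⟨ Bool.not-involutive _ ⟩
        o (i , false) (j , true) (l′ , true)
          ≡⟨ cong (o (i , false) (j , true) ∘ proj₁) (mixed-cross i≢j ((l , false) , t)) ⟨
        o (i , false) (j , true) (proj₁ (mixed i j ((l , false) , t))) ∎)
        where
        open ≡-Reasoning
        l′ : Fin k
        l′ = cycleᵢ⁻¹ i (group i j) (swapᵢ i j l)
        l′≢j : l′ ≢ j
        l′≢j eq = proj₂ (mate-avoids {i , false} {j , true} {l , false} {t} c≢a (λ ()))
          (trans (cong proj₁ (mixed-cross i≢j ((l , false) , t))) (cong (_, true) eq))

    module _ {i : Fin k} (untwisted : ∀ l t → θ i l t ≡ false) where

      twist-id : ∀ c → twist i c ≡ c
      twist-id ((l , p) , t) rewrite untwisted l t = cong (λ q → (l , q) , t) (Bool.xor-identityʳ p)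

      mixed-untwisted : ∀ c → mixed i i c ≡ loop i c
      mixed-untwisted c = trans (mixed-loop i c) (trans (twist-id _) (cong (loop i) (twist-id c)))

      o-loop : ∀ c → proj₁ c ≢ (i , false) → proj₁ c ≢ (i , true) →
        o (i , false) (i , true) (proj₁ (mixed i i c)) ≡ not (o (i , false) (i , true) (proj₁ c))
      o-loop ((l , true) , t) _ c≢b = trans (cong (o (i , false) (i , true) ∘ proj₁) (mixed-untwisted ((l , true) , t)))
        (trans (o-tetrahedron₃ false (σ-≢ l≢i)) (cong not (sym (o-tetrahedron₃ true l≢i))))
        where
        l≢i : l ≢ i
        l≢i = c≢b ∘ cong (_, true)
      o-loop ((l , false) , t) c≢a _ = trans (cong (o (i , false) (i , true) ∘ proj₁) (mixed-untwisted ((l , false) , t)))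
        (trans (o-tetrahedron₃ true σ⁻¹-≢) (cong not (sym (o-tetrahedron₃ false l≢i))))
        where
        l≢i : l ≢ i
        l≢i = c≢a ∘ cong (_, false)
        σ⁻¹-≢ : proj₁ (rotation⁻¹ (triangles i) (l , t)) ≢ i
        σ⁻¹-≢ eq = l≢i (trans (cong proj₁ (trans (sym (rotation-inverseˡ (triangles i) (l , t)))
          (rotation-fixes {triangles i} λ x∈ → ∈-triangles⁻ x∈ eq))) eq)

  o-mixed : ∀ {i j} c → (i ≡ j → ∀ l t → θ i l t ≡ false) →
    proj₁ c ≢ (i , false) → proj₁ c ≢ (j , true) →
    o (i , false) (j , true) (proj₁ (mixed i j c)) ≡ not (o (i , false) (j , true) (proj₁ c))
  o-mixed {i} {j} c untwisted = at j (i Fin.≟ j) c untwisted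
    where
    at : ∀ j → Dec (i ≡ j) → ∀ c → (i ≡ j → ∀ l t → θ i l t ≡ false) →
      proj₁ c ≢ (i , false) → proj₁ c ≢ (j , true) →
      o (i , false) (j , true) (proj₁ (mixed i j c)) ≡ not (o (i , false) (j , true) (proj₁ c))
    at j (yes refl) c untwisted = o-loop (untwisted refl) c
    at j (no i≢j) ((l , true)  , t) _ _   c≢b = o-cross-true i≢j l t (c≢b ∘ cong (_, true))
    at j (no i≢j) ((l , false) , t) _ c≢a _   = o-cross-false i≢j l t c≢a

  o-mate : ∀ {a b} c → (∀ i → (a ≡ (i , false) × b ≡ (i , true)) ⊎ (a ≡ (i , true) × b ≡ (i , false)) → ∀ l t → θ i l t ≡ false) →
    a ≢ b → proj₁ c ≢ a → proj₁ c ≢ b → o a b (proj₁ (mate a b c)) ≡ not (o a b (proj₁ c))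
  o-mate {i , false} {j , false} c _ a≢b = o-same false c (a≢b ∘ cong (_, false))
  o-mate {i , true}  {j , true}  c _ a≢b = o-same true c (a≢b ∘ cong (_, true))
  o-mate {i , false} {j , true}  c untwisted a≢b c≢a c≢b =
    o-mixed c (λ { refl → untwisted i (inj₁ (refl , refl)) }) c≢a c≢b
  o-mate {i , true}  {j , false} c untwisted a≢b c≢a c≢b =
    trans (o-swap₁ (a≢b ∘ sym) (proj₂ avoid ∘ sym) (proj₁ avoid ∘ sym))
      (cong not (trans (o-mixed c (λ { refl → untwisted i (inj₂ (refl , refl)) }) c≢b c≢a)
        (sym (o-swap₁ (a≢b ∘ sym) (c≢b ∘ sym) (c≢a ∘ sym)))))
    where
    avoid = mate-avoids {i , true} {j , false} {proj₁ c} {proj₂ c} c≢a c≢b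

-- The quadrangular embedding

abstract
  point↔ : (k : ℕ) → (Fin k × Bool) ↔ Fin (k * 2)
  point↔ k = Compose._↔-∘_ (Symmetry.↔-sym Fin.*↔×) (Identity.↔-id _ ×-↔ Symmetry.↔-sym Fin.2↔Bool)

module Surface (k m : ℕ) (θ : Fin k → Fin k → Fin m → Bool) (θ-diagonal : ∀ i t → θ i i t ≡ false)
  (other : (j : Fin k) → ∃[ j′ ] j′ ≢ j) (t₀ : Fin m) (i₀ : Fin k) where
  open Oriented k m θ θ-diagonal public
  open Levi m (k * 2)

  private
    n : ℕ
    n = k * 2

  element : Point → Fin n
  element = Inverse.to (point↔ k)

  point : Fin n → Point
  point = Inverse.from (point↔ k)

  element-point : ∀ i → element (point i) ≡ i
  element-point = Inverse.strictlyInverseˡ (point↔ k)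

  swap₁ : {a b c : Point} → Distinct a b c → Distinct b a c
  swap₁ (a≢b , a≢c , b≢c) = a≢b ∘ sym , b≢c , a≢c

  swap₂ : {a b c : Point} → Distinct a b c → Distinct a c b
  swap₂ (a≢b , a≢c , b≢c) = a≢c , a≢b , b≢c ∘ sym

  distinct-mate : ∀ {a b c} t → Distinct a b c → Distinct a b (proj₁ (mate a b (c , t)))
  distinct-mate {a} {b} {c} t (a≢b , a≢c , b≢c) = a≢b , proj₁ avoids ∘ sym , proj₂ avoids ∘ sym
    where
    avoids = mate-avoids {a} {b} {c} {t} (a≢c ∘ sym) (b≢c ∘ sym)

  distinct-mate⁻ : ∀ {a b c} t → Distinct a b (proj₁ (mate a b (c , t))) → Distinct a b c
  distinct-mate⁻ {a} {b} {c} t d = subst (Distinct a b ∘ proj₁) (mate-involutive a b (c , t)) (distinct-mate _ d)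

  distinct? : (a b c : Point) → Dec (Distinct a b c)
  distinct? a b c = ¬? (a ≟P b) ×-dec ¬? (a ≟P c) ×-dec ¬? (b ≟P c)

  relevant : ∀ {a b c} → .(Distinct a b c) → Distinct a b c
  relevant {a} {b} {c} d = recompute (distinct? a b c) d

  -- flag a b c t e lies on the edge joining a to the t-th copy of the triple {a , b , c},
  -- on the side of the face that contains b, at the element a if e is false and at the
  -- triple if e is true.
  data Flag : Set where
    flag : (a b c : Point) (t : Fin m) (e : Bool) → .(Distinct a b c) → Flag

  private
    flag-≡ : ∀ {a b c b′ c′ t t′ e} .{d d′} → b ≡ b′ → (c , t) ≡ (c′ , t′) → flag a b c t e d ≡ flag a b′ c′ t′ e d′
    flag-≡ refl refl = refl

  abstract
    finiteFlag : Finite Flag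
    finiteFlag = proj₁ finite , Compose._↔-∘_ (proj₂ finite) (mk↔ₛ′ to from to∘from from∘to)
      where
      PreFlag : Set
      PreFlag = (Point × Point) × Corner × Bool
      valid : PreFlag → Bool
      valid ((a , b) , (c , t) , e) = does (distinct? a b c)
      finite : Finite (∃[ x ] valid x ≡ true)
      finite = finite-filter (Compose._↔-∘_ (Symmetry.↔-sym Fin.*↔×)
        (Compose._↔-∘_ (Symmetry.↔-sym Fin.*↔×) (point↔ k ×-↔ point↔ k) ×-↔
        (Compose._↔-∘_ (Symmetry.↔-sym Fin.*↔×) (
          Compose._↔-∘_ (Symmetry.↔-sym Fin.*↔×) (point↔ k ×-↔ Identity.↔-id _) ×-↔ Symmetry.↔-sym Fin.2↔Bool)))) valid
      to : Flag → ∃[ x ] valid x ≡ true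
      to (flag a b c t e d) = ((a , b) , (c , t) , e) , dec-true (distinct? a b c) (relevant d)
      from : (∃[ x ] valid x ≡ true) → Flag
      from (((a , b) , (c , t) , e) , v) = flag a b c t e (does⇒ (distinct? a b c) v)
      to∘from : ∀ x → to (from x) ≡ x
      to∘from (((a , b) , (c , t) , e) , v) = Σ-≡true refl
      from∘to : ∀ x → from (to x) ≡ x
      from∘to (flag a b c t e d) = refl

  -- A face is a quadrilateral whose corners are alternately `a`, a triple, `b`, and the mate of
  -- that triple. `exchange` interchanges its two elements and `reflect` its two triples, so `τ₁` is
  -- one or the other according to the corner of the flag.
  τ₀ τ₁ τ₂ exchange reflect : Flag → Flag
  τ₀ (flag a b c t e d) = flag a b c t (not e) d
  exchange (flag a b c t e d) = flag b a c t e (swap₁ d)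
  reflect (flag a b c t e d) = flag a b (proj₁ (mate a b (c , t))) (proj₂ (mate a b (c , t))) e (distinct-mate t d)
  τ₁ x@(flag _ _ _ _ true _)  = exchange x
  τ₁ x@(flag _ _ _ _ false _) = reflect x
  τ₂ (flag a b c t e d) = flag a c b t e (swap₂ d)

  τ₀-invol : ∀ x → τ₀ (τ₀ x) ≡ x
  τ₀-invol (flag a b c t true  d) = refl
  τ₀-invol (flag a b c t false d) = refl

  exchange-invol : ∀ x → exchange (exchange x) ≡ x
  exchange-invol (flag a b c t e d) = refl

  reflect-invol : ∀ x → reflect (reflect x) ≡ x
  reflect-invol (flag a b c t e d) = flag-≡ refl (mate-involutive a b (c , t))

  τ₁-invol : ∀ x → τ₁ (τ₁ x) ≡ x
  τ₁-invol x@(flag _ _ _ _ true _)  = exchange-invol x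
  τ₁-invol x@(flag _ _ _ _ false _) = reflect-invol x

  τ₂-invol : ∀ x → τ₂ (τ₂ x) ≡ x
  τ₂-invol (flag a b c t e d) = refl

  endOf : Flag → Bool
  endOf (flag _ _ _ _ e _) = e

  pointOf : Flag → Point
  pointOf (flag a _ _ _ _ _) = a

  private
    not-≢ : ∀ b → not b ≢ b
    not-≢ true ()
    not-≢ false ()

    flagLink : {R : Rel Flag 0ℓ} → IsEquivalence R → ∀ a →
      (∀ b c t .d → R (flag a b c t false d) (τ₁ (flag a b c t false d))) →
      (∀ b c t .d → R (flag a b c t false d) (τ₂ (flag a b c t false d))) →
      ∀ {b c t b′ c′ t′} .d .d′ → R (flag a b c t false d) (flag a b′ c′ t′ false d′)
    flagLink {R} eqv a step₁ step₂ {b} {c} {t} {b′} {c′} {t′} d d′ =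
      let (a≢b , a≢c , b≢c) = relevant d
          (a≢b′ , a≢c′ , b′≢c′) = relevant d′ in
      proj₂ (proj₂ (link-connected R′-eqv a flip turn {b} {c} {t} {b′} {c′} {t′}
        (a≢b ∘ sym) (a≢c ∘ sym) b≢c (a≢b′ ∘ sym) (a≢c′ ∘ sym) b′≢c′)) d d′
      where
      open IsEquivalence eqv renaming (refl to ~refl; sym to ~sym; trans to ~trans)
      -- The link argument also passes over triples with repeated entries, where no flag exists;
      -- carrying distinctness in both directions restricts it to flags.
      R′ : Rel (Point × Corner) 0ℓ
      R′ (b , c , t) (b′ , c′ , t′) = (Distinct a b c → Distinct a b′ c′) × (Distinct a b′ c′ → Distinct a b c) ×
        (∀ .d .d′ → R (flag a b c t false d) (flag a b′ c′ t′ false d′))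
      R′-eqv : IsEquivalence R′
      R′-eqv = record
        { refl  = id , id , λ d d′ → ~refl
        ; sym   = λ (f , g , r) → g , f , λ d d′ → ~sym (r d′ d)
        ; trans = λ (f , g , r) (f′ , g′ , r′) → f′ ∘ f , g ∘ g′ , λ d d″ → ~trans (r d (f d)) (r′ (f d) d″)
        }
      flip : ∀ b c t → R′ (b , c , t) (c , b , t)
      flip b c t = swap₂ , swap₂ , λ d d′ → step₂ b c t d
      turn : ∀ b c → b ≢ a → R′ (b , c) (b , mate a b c)
      turn b (c , t) _ = distinct-mate t , distinct-mate⁻ t , λ d d′ → step₁ b c t d

  Exceptional : Point → Point → Set
  Exceptional a b = (a ≡ (i₀ , false) × b ≡ (i₀ , true)) ⊎ (a ≡ (i₀ , true) × b ≡ (i₀ , false))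

  private
    Ordinary : Point → Set
    Ordinary a = a ≢ (i₀ , false) × a ≢ (i₀ , true)

    ordinary? : ∀ a → Ordinary a ⊎ (a ≡ (i₀ , false) ⊎ a ≡ (i₀ , true))
    ordinary? a with a ≟P (i₀ , false) | a ≟P (i₀ , true)
    ... | yes eq | _      = inj₂ (inj₁ eq)
    ... | no _   | yes eq = inj₂ (inj₂ eq)
    ... | no ne  | no ne′ = inj₁ (ne , ne′)

  -- A triple has three members, so one of them is neither of the exceptional two; the link of that
  -- member is connected by transitions that do not join the exceptional pair. Leaving out those
  -- transitions lets the lemma serve the twisted surface, where only they violate the orientation.
  flagsConnected : {R : Rel Flag 0ℓ} → IsEquivalence R →
    (∀ x → R x (τ₀ x)) → (∀ x → R x (τ₂ x)) →
    (∀ a b c t .d → R (flag a b c t true d) (τ₁ (flag a b c t true d))) →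
    (∀ a b c t .d → ¬ Exceptional a b → R (flag a b c t false d) (τ₁ (flag a b c t false d))) →
    ∀ x y → R x y
  flagsConnected {R} eqv step₀ step₂ step₁ step₁′ x y = meet (to-ordinary x) (to-ordinary y)
    where
    open IsEquivalence eqv renaming (refl to ~refl; sym to ~sym; trans to ~trans)
    ToOrdinary : Flag → Set
    ToOrdinary x = ∃[ a ] (Ordinary a × ∃[ b ] ∃[ c ] ∃[ t ] Σ (Distinct a b c) λ d → R x (flag a b c t false d))
    at-element : ∀ a b c t → .(d : Distinct a b c) → ToOrdinary (flag a b c t false d)
    at-element a b c t d with ordinary? a | ordinary? b | ordinary? c
    ... | inj₁ oa | _ | _ = a , oa , b , c , t , relevant d , ~refl
    ... | inj₂ _ | inj₁ ob | _ = b , ob , a , c , t , swap₁ (relevant d) ,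
      ~trans (step₀ _) (~trans (step₁ a b c t d) (step₀ _))
    ... | inj₂ _ | inj₂ _ | inj₁ oc = c , oc , a , b , t , swap₁ (swap₂ (relevant d)) ,
      ~trans (step₂ _) (~trans (step₀ _) (~trans (step₁ a c b t (swap₂ d)) (step₀ _)))
    ... | inj₂ ea | inj₂ eb | inj₂ ec = ⊥-elim (two-values ea eb ec (relevant d))
      where
      two-values : a ≡ (i₀ , false) ⊎ a ≡ (i₀ , true) → b ≡ (i₀ , false) ⊎ b ≡ (i₀ , true) →
        c ≡ (i₀ , false) ⊎ c ≡ (i₀ , true) → Distinct a b c → ⊥
      two-values (inj₁ p) (inj₁ q) _        (a≢b , _)       = a≢b (trans p (sym q))
      two-values (inj₂ p) (inj₂ q) _        (a≢b , _)       = a≢b (trans p (sym q))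
      two-values (inj₁ p) (inj₂ _) (inj₁ r) (_ , a≢c , _)   = a≢c (trans p (sym r))
      two-values (inj₂ p) (inj₁ _) (inj₂ r) (_ , a≢c , _)   = a≢c (trans p (sym r))
      two-values (inj₂ _) (inj₁ q) (inj₁ r) (_ , _ , b≢c)   = b≢c (trans q (sym r))
      two-values (inj₁ _) (inj₂ q) (inj₂ r) (_ , _ , b≢c)   = b≢c (trans q (sym r))
    to-ordinary : ∀ x → ToOrdinary x
    to-ordinary (flag a b c t false d) = at-element a b c t d
    to-ordinary (flag a b c t true d) with at-element a b c t d
    ... | a′ , o , b′ , c′ , t′ , d′ , r = a′ , o , b′ , c′ , t′ , d′ , ~trans (step₀ _) r
    link : ∀ {a b c t b′ c′ t′} → Ordinary a → ∀ .d .d′ → R (flag a b c t false d) (flag a b′ c′ t′ false d′)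
    link {a} (a≢x , a≢y) = flagLink eqv a
      (λ b c t d → step₁′ a b c t d λ { (inj₁ (eq , _)) → a≢x eq ; (inj₂ (eq , _)) → a≢y eq })
      (λ b c t d → step₂ _)
    join : ∀ {a a′ b c t b′ c′ t′} → Dec (a ≡ a′) → Ordinary a → Ordinary a′ → ∀ .d .d′ →
      R (flag a b c t false d) (flag a′ b′ c′ t′ false d′)
    join (yes refl) o o′ d d′ = link o d d′
    join {a} {a′} (no a≢a′) o o′ d d′ = ~trans (link o d d₀) (~trans (step₀ _)
      (~trans (step₁ a a′ (i₀ , false) t₀ d₀) (~trans (step₀ _) (link o′ (swap₁ d₀) d′))))
      where
      -- Two ordinary elements together with `(i₀ , false)` form a triple, at which one can pass
      -- from the first element to the second.
      d₀ : Distinct a a′ (i₀ , false)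
      d₀ = a≢a′ , proj₁ o , proj₁ o′
    meet : ∀ {x y} → ToOrdinary x → ToOrdinary y → R x y
    meet (a , o , b , c , t , d , r) (a′ , o′ , b′ , c′ , t′ , d′ , r′) =
      ~trans r (~trans (join (a ≟P a′) o o′ d d′) (~sym r′))

  element-distinct : ∀ {a b c} → .(Distinct a b c) → Distinct (element a) (element b) (element c)
  element-distinct d = let (a≢b , a≢c , b≢c) = relevant d in
    a≢b ∘ ↔-injective (point↔ k) , a≢c ∘ ↔-injective (point↔ k) , b≢c ∘ ↔-injective (point↔ k)

  tripleOf : Flag → Triple × Fin m
  tripleOf (flag a b c t e d) = triple (element-distinct d) , t

  pointOf∈tripleOf : ∀ x → element (pointOf x) ∈ₛ proj₁ (proj₁ (tripleOf x))
  pointOf∈tripleOf (flag _ _ _ _ _ _) = ∈⟨⟩⁺ (inj₁ refl)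

  edgeOf : Flag → LeviEdge
  edgeOf x = tripleOf x , position (proj₁ (tripleOf x)) (pointOf∈tripleOf x)

  elementEnd-edgeOf : ∀ x → elementEnd (edgeOf x) ≡ element (pointOf x)
  elementEnd-edgeOf x = member-position (proj₁ (tripleOf x)) (pointOf∈tripleOf x)

  edgeOf-≡ : ∀ x y → pointOf x ≡ pointOf y → tripleOf x ≡ tripleOf y → edgeOf x ≡ edgeOf y
  edgeOf-≡ x y p q = ends-injective
    (trans (elementEnd-edgeOf x) (trans (cong element p) (sym (elementEnd-edgeOf y)))) q

  edgeOf-≡⁻ : ∀ x y → edgeOf x ≡ edgeOf y → pointOf x ≡ pointOf y × tripleOf x ≡ tripleOf y
  edgeOf-≡⁻ x y eq = ↔-injective (point↔ k)
      (trans (sym (elementEnd-edgeOf x)) (trans (cong elementEnd eq) (elementEnd-edgeOf y))) ,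
    cong proj₁ eq

  vertexAt : Flag → LeviVertex
  vertexAt x@(flag _ _ _ _ false _) = inj₁ (element (pointOf x))
  vertexAt x@(flag _ _ _ _ true _)  = inj₂ (tripleOf x)

  tripleOf-exchange : ∀ x → tripleOf (exchange x) ≡ tripleOf x
  tripleOf-exchange (flag a b c t e d) = cong (_, t) (SubsetOfSize-≡ (trans (⟨⟩-rotate _ _ _) (⟨⟩-swap _ _ _)))

  tripleOf-τ₂ : ∀ x → tripleOf (τ₂ x) ≡ tripleOf x
  tripleOf-τ₂ (flag a b c t e d) = cong (_, t) (SubsetOfSize-≡ (⟨⟩-swap _ _ _))

  tripleOf-τ₀ : ∀ x → tripleOf (τ₀ x) ≡ tripleOf x
  tripleOf-τ₀ (flag a b c t e d) = refl

  pointOf-τ₀ : ∀ x → pointOf (τ₀ x) ≡ pointOf x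
  pointOf-τ₀ (flag a b c t e d) = refl

  endOf-τ₀ : ∀ x → endOf (τ₀ x) ≡ not (endOf x)
  endOf-τ₀ (flag a b c t e d) = refl

  pointOf-τ₂ : ∀ x → pointOf (τ₂ x) ≡ pointOf x
  pointOf-τ₂ (flag a b c t e d) = refl

  module _ (j : LeviEdge) where
    private
      S : Triple
      S = proj₁ (tripleEnd j)
      p : Fin 3
      p = proj₂ j
      d = member-distinct S p

    flagOn : Flag
    flagOn = flag (point (member S p)) (point (next₁ S p)) (point (next₂ S p)) (proj₂ (tripleEnd j)) false
      (proj₁ d ∘ inj , proj₁ (proj₂ d) ∘ inj , proj₂ (proj₂ d) ∘ inj)
      where
      inj : ∀ {x y} → point x ≡ point y → x ≡ y
      inj = ↔-injective (Symmetry.↔-sym (point↔ k))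

    tripleOf-flagOn : tripleOf flagOn ≡ tripleEnd j
    tripleOf-flagOn = cong (_, proj₂ (tripleEnd j)) (SubsetOfSize-≡
      (trans (cong₂ (λ x (y , z) → ⟨ x , y , z ⟩) (element-point _) (cong₂ _,_ (element-point _) (element-point _)))
        (triple-member S p)))

    edgeOf-flagOn : edgeOf flagOn ≡ j
    edgeOf-flagOn = ends-injective (trans (elementEnd-edgeOf flagOn) (element-point _)) tripleOf-flagOn

  private
    same-edge-side : ∀ x y → pointOf x ≡ pointOf y → tripleOf x ≡ tripleOf y → endOf x ≡ endOf y → y ≡ x ⊎ y ≡ τ₂ x
    same-edge-side (flag a b c t e d) (flag .a b′ c′ t′ .e d′) refl eq refl
      with other-pair (element-distinct d) (element-distinct d′) (cong (proj₁ ∘ proj₁) eq)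
    ... | inj₁ (p , q) = inj₁ (flag-≡ (↔-injective (point↔ k) p) (cong₂ _,_ (↔-injective (point↔ k) q) (sym (cong proj₂ eq))))
    ... | inj₂ (p , q) = inj₂ (flag-≡ (↔-injective (point↔ k) p) (cong₂ _,_ (↔-injective (point↔ k) q) (sym (cong proj₂ eq))))

  edgeClasses : Classes (Orbit₂ τ₀ τ₂)
  edgeClasses = record
    { size       = #triples * 3
    ; class      = Inverse.to leviEdges ∘ edgeOf
    ; surjective = λ c → flagOn (Inverse.from leviEdges c) ,
        trans (cong (Inverse.to leviEdges) (edgeOf-flagOn (Inverse.from leviEdges c))) (Inverse.strictlyInverseˡ leviEdges c)
    ; classifies = λ {x} {y} → mk⇔ (λ eq → to x y (edgeOf-≡⁻ x y (↔-injective leviEdges eq))) (cong (Inverse.to leviEdges) ∘ from)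
    }
    where
    to : ∀ x y → pointOf x ≡ pointOf y × tripleOf x ≡ tripleOf y → Orbit₂ τ₀ τ₂ x y
    to x y (p , q) with endOf x Bool.≟ endOf y
    ... | yes e with same-edge-side x y p q e
    ... | inj₁ refl = ε
    ... | inj₂ refl = inj₂ refl ◅ ε
    to x y (p , q) | no ne with same-edge-side (τ₀ x) y
      (trans (pointOf-τ₀ x) p) (trans (tripleOf-τ₀ x) q) (trans (endOf-τ₀ x) (sym (Bool.¬-not (ne ∘ sym))))
    ... | inj₁ refl = inj₁ refl ◅ ε
    ... | inj₂ refl = inj₁ refl ◅ inj₂ refl ◅ ε
    from : ∀ {x y} → Orbit₂ τ₀ τ₂ x y → edgeOf x ≡ edgeOf y
    from ε = refl
    from {x} (inj₁ refl ◅ ss) = trans (sym (edgeOf-≡ (τ₀ x) x (pointOf-τ₀ x) (tripleOf-τ₀ x))) (from ss)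
    from {x} (inj₂ refl ◅ ss) = trans (sym (edgeOf-≡ (τ₂ x) x (pointOf-τ₂ x) (tripleOf-τ₂ x))) (from ss)

  -- At an element, having a single orbit is the connectedness of its link. At a triple, `τ₁` and
  -- `τ₂` are two transpositions and reach all six orders of its members.
  vertexClasses : Classes (Orbit₂ τ₁ τ₂)
  vertexClasses = record
    { size       = n + #triples
    ; class      = Inverse.to leviVertices ∘ vertexAt
    ; surjective = λ c → proj₁ (rep (Inverse.from leviVertices c)) ,
        trans (cong (Inverse.to leviVertices) (proj₂ (rep (Inverse.from leviVertices c)))) (Inverse.strictlyInverseˡ leviVertices c)
    ; classifies = λ {x} {y} → mk⇔ (λ eq → to x y (↔-injective leviVertices eq)) (cong (Inverse.to leviVertices) ∘ from)
    }
    where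
    rep : ∀ w → ∃[ x ] vertexAt x ≡ w
    rep (inj₁ i) with point i in eq
    ... | j , p with other j
    ... | j′ , j′≢j = flag (j , p) (j , not p) (j′ , p) t₀ false
        (not-≢ p ∘ sym ∘ cong proj₂ , j′≢j ∘ sym ∘ cong proj₁ , j′≢j ∘ sym ∘ cong proj₁) ,
      cong inj₁ (trans (cong element (sym eq)) (element-point i))
    rep (inj₂ (S , t)) = τ₀ (flagOn ((S , t) , zero)) , cong inj₂ (tripleOf-flagOn ((S , t) , zero))
    to : ∀ x y → vertexAt x ≡ vertexAt y → Orbit₂ τ₁ τ₂ x y
    to (flag a b c t false d) (flag a′ b′ c′ t′ false d′) eq with ↔-injective (point↔ k) (inj₁-inj eq)
      where
      inj₁-inj : ∀ {a b} → _≡_ {A = LeviVertex} (inj₁ a) (inj₁ b) → a ≡ b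
      inj₁-inj refl = refl
    ... | refl = flagLink (orbit₂-isEquivalence τ₁-invol τ₂-invol) a
      (λ b c t d → inj₁ refl ◅ ε) (λ b c t d → inj₂ refl ◅ ε) d d′
    to x@(flag a b c t true d) y@(flag a′ b′ c′ t′ true d′) eq =
      at (∈⟨⟩⁻ (subst (element a′ ∈ₛ_) (cong (proj₁ ∘ proj₁) (sym eq′)) (pointOf∈tripleOf y)))
      where
      inj₂-inj : ∀ {a b} → _≡_ {A = LeviVertex} (inj₂ a) (inj₂ b) → a ≡ b
      inj₂-inj refl = refl
      eq′ : tripleOf x ≡ tripleOf y
      eq′ = inj₂-inj eq
      finish : ∀ z → endOf z ≡ true → tripleOf z ≡ tripleOf x → element (pointOf y) ≡ element (pointOf z) → Orbit₂ τ₁ τ₂ z y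
      finish z e q p with same-edge-side z y (sym (↔-injective (point↔ k) p)) (trans q eq′) e
      ... | inj₁ y≡z   = subst (Orbit₂ τ₁ τ₂ z) (sym y≡z) ε
      ... | inj₂ y≡τ₂z = inj₂ y≡τ₂z ◅ ε
      at : element a′ ≡ element a ⊎ element a′ ≡ element b ⊎ element a′ ≡ element c → Orbit₂ τ₁ τ₂ x y
      at (inj₁ p)        = finish x refl refl p
      at (inj₂ (inj₁ p)) = inj₁ refl ◅ finish (τ₁ x) refl (tripleOf-exchange x) p
      at (inj₂ (inj₂ p)) = inj₂ refl ◅ inj₁ refl ◅ finish (τ₁ (τ₂ x)) refl (trans (tripleOf-exchange (τ₂ x)) (tripleOf-τ₂ x)) p
    vertexAt-τ₁ : ∀ x → vertexAt (τ₁ x) ≡ vertexAt x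
    vertexAt-τ₁ (flag _ _ _ _ false _)  = refl
    vertexAt-τ₁ x@(flag _ _ _ _ true _) = cong inj₂ (tripleOf-exchange x)
    vertexAt-τ₂ : ∀ x → vertexAt (τ₂ x) ≡ vertexAt x
    vertexAt-τ₂ (flag _ _ _ _ false _)  = refl
    vertexAt-τ₂ x@(flag _ _ _ _ true _) = cong inj₂ (tripleOf-τ₂ x)
    from : ∀ {x y} → Orbit₂ τ₁ τ₂ x y → vertexAt x ≡ vertexAt y
    from ε = refl
    from {x} (inj₁ refl ◅ ss) = trans (sym (vertexAt-τ₁ x)) (from ss)
    from {x} (inj₂ refl ◅ ss) = trans (sym (vertexAt-τ₂ x)) (from ss)

  -- Faces are quadrilaterals: τ₀, exchange and reflect commute, and their eight products
  -- carry a flag to all flags of its face.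
  private
    iter : {A : Set} → Bool → (A → A) → A → A
    iter true  f = f
    iter false f = id

    iter-not : {A : Set} (f : A → A) → (∀ x → f (f x) ≡ x) → ∀ b x → f (iter b f x) ≡ iter (not b) f x
    iter-not f invol true  x = invol x
    iter-not f invol false x = refl

    iter-commute : {A : Set} (f g : A → A) → (∀ x → f (g x) ≡ g (f x)) → ∀ b x → f (iter b g x) ≡ iter b g (f x)
    iter-commute f g comm true  x = comm x
    iter-commute f g comm false x = refl

    Word : Set
    Word = Bool × Bool × Bool

    act : Word → Flag → Flag
    act (p , q , r) x = iter p τ₀ (iter q exchange (iter r reflect x))

    exchange-reflect : ∀ x → exchange (reflect x) ≡ reflect (exchange x)
    exchange-reflect (flag a b c t e d) = flag-≡ refl (mate-sym a b (c , t))

    exchange-τ₀ : ∀ x → exchange (τ₀ x) ≡ τ₀ (exchange x)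
    exchange-τ₀ (flag a b c t e d) = refl

    reflect-τ₀ : ∀ x → reflect (τ₀ x) ≡ τ₀ (reflect x)
    reflect-τ₀ (flag a b c t e d) = refl

    act-τ₀ : ∀ w x → ∃[ w′ ] τ₀ (act w x) ≡ act w′ x
    act-τ₀ (p , q , r) x = (not p , q , r) , iter-not τ₀ τ₀-invol p _

    act-exchange : ∀ w x → ∃[ w′ ] exchange (act w x) ≡ act w′ x
    act-exchange (p , q , r) x = (p , not q , r) , trans (iter-commute exchange τ₀ exchange-τ₀ p _)
      (cong (iter p τ₀) (iter-not exchange exchange-invol q _))

    act-reflect : ∀ w x → ∃[ w′ ] reflect (act w x) ≡ act w′ x
    act-reflect (p , q , r) x = (p , q , not r) , trans (iter-commute reflect τ₀ reflect-τ₀ p _)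
      (cong (iter p τ₀) (trans (iter-commute reflect exchange (λ x → sym (exchange-reflect x)) q _)
        (cong (iter q exchange) (iter-not reflect reflect-invol r x))))

    τ₁-case : ∀ x → τ₁ x ≡ exchange x ⊎ τ₁ x ≡ reflect x
    τ₁-case (flag _ _ _ _ true _) = inj₁ refl
    τ₁-case (flag _ _ _ _ false _) = inj₂ refl

    orbit⇒act : ∀ {x y z} w → y ≡ act w x → Orbit₂ τ₀ τ₁ y z → ∃[ w′ ] z ≡ act w′ x
    orbit⇒act w eq ε = w , eq
    orbit⇒act {x} w refl (inj₁ refl ◅ ss) = orbit⇒act {x} (proj₁ (act-τ₀ w x)) (proj₂ (act-τ₀ w x)) ss
    orbit⇒act {x} w refl (inj₂ refl ◅ ss) with τ₁-case (act w x)
    ... | inj₁ eq = orbit⇒act {x} (proj₁ (act-exchange w x)) (trans eq (proj₂ (act-exchange w x))) ss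
    ... | inj₂ eq = orbit⇒act {x} (proj₁ (act-reflect w x)) (trans eq (proj₂ (act-reflect w x))) ss

    exchange-orbit : ∀ x → Orbit₂ τ₀ τ₁ x (exchange x)
    exchange-orbit (flag _ _ _ _ true _) = inj₂ refl ◅ ε
    exchange-orbit (flag _ _ _ _ false _) = inj₁ refl ◅ inj₂ refl ◅ inj₁ refl ◅ ε

    reflect-orbit : ∀ x → Orbit₂ τ₀ τ₁ x (reflect x)
    reflect-orbit (flag _ _ _ _ false _) = inj₂ refl ◅ ε
    reflect-orbit (flag _ _ _ _ true _) = inj₁ refl ◅ inj₂ refl ◅ inj₁ refl ◅ ε

    iter-orbit : ∀ {f : Flag → Flag} → (∀ x → Orbit₂ τ₀ τ₁ x (f x)) → ∀ b x → Orbit₂ τ₀ τ₁ x (iter b f x)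
    iter-orbit step true  x = step x
    iter-orbit step false x = ε

    act-orbit : ∀ w x → Orbit₂ τ₀ τ₁ x (act w x)
    act-orbit (p , q , r) x = iter-orbit reflect-orbit r x ◅◅ iter-orbit exchange-orbit q _ ◅◅
      iter-orbit (λ x → inj₁ refl ◅ ε) p _

    word↔ : Word ↔ Fin 8
    word↔ = Compose._↔-∘_ (Symmetry.↔-sym (Fin.*↔× {2} {4})) (Symmetry.↔-sym Fin.2↔Bool ×-↔
      Compose._↔-∘_ (Symmetry.↔-sym (Fin.*↔× {2} {2})) (Symmetry.↔-sym Fin.2↔Bool ×-↔ Symmetry.↔-sym Fin.2↔Bool))

    flag≟ : DecidableEquality Flag
    flag≟ x y = map′ (↔-injective (proj₂ finiteFlag)) (cong (Inverse.to (proj₂ finiteFlag)))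
      (Inverse.to (proj₂ finiteFlag) x Fin.≟ Inverse.to (proj₂ finiteFlag) y)

    face? : Decidable (Orbit₂ τ₀ τ₁)
    face? x y = map′
      (λ (i , eq) → subst (Orbit₂ τ₀ τ₁ x) (sym eq) (act-orbit (Inverse.from word↔ i) x))
      (λ orbit → let (w , eq) = orbit⇒act {x} (false , false , false) refl orbit in
        Inverse.to word↔ w , trans eq (cong (λ w → act w x) (sym (Inverse.strictlyInverseʳ word↔ w))))
      (Fin.any? (λ i → flag≟ y (act (Inverse.from word↔ i) x)))

  abstract
    faceClasses : Classes (Orbit₂ τ₀ τ₁)
    faceClasses = decidable⇒classes (proj₂ finiteFlag) (orbit₂-isEquivalence τ₀-invol τ₁-invol) face?

  -- The eight products cover a face. This bounds its size from above only; the other direction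
  -- follows from the Euler inequality in `2*#faces`.
  #flags≤#faces*8 : (C : Classes (Orbit₂ τ₀ τ₁)) → proj₁ finiteFlag ≤ Classes.size C * 8
  #flags≤#faces*8 C = ↔-card-surjective
    (Compose._↔-∘_ (Symmetry.↔-sym Fin.*↔×) (Identity.↔-id (Fin size) ×-↔ word↔)) (proj₂ finiteFlag)
    (λ (f , w) → act w (proj₁ (surjective f)))
    preimage
    where
    open Classes C
    preimage : ∀ x → ∃[ fw ] act (proj₂ fw) (proj₁ (surjective (proj₁ fw))) ≡ x
    preimage x with orbit⇒act {proj₁ (surjective (class x))} (false , false , false) refl
      (Equivalence.to classifies (proj₂ (surjective (class x))))
    ... | w , eq = (class x , w) , sym eq

  surface : CellDecomposition
  surface = record
    { Flag          = Flag
    ; #flags        = proj₁ finiteFlag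
    ; finite        = proj₂ finiteFlag
    ; nonempty      = ℕ.≤-trans (s≤s z≤n) (Fin.toℕ<n (Inverse.to (proj₂ finiteFlag) someFlag))
    ; τ₀            = τ₀
    ; τ₁            = τ₁
    ; τ₂            = τ₂
    ; τ₀-involutive = τ₀-invol
    ; τ₁-involutive = τ₁-invol
    ; τ₂-involutive = τ₂-invol
    ; τ₀-τ₂-commute = λ { (flag _ _ _ _ _ _) → refl }
    ; τ₀-fixfree    = λ { x@(flag _ _ _ _ _ _) eq → not-≢ (endOf x) (cong endOf eq) }
    ; τ₁-fixfree    = τ₁-fixfree
    ; τ₂-fixfree    = τ₂-fixfree
    ; τ₀τ₂-fixfree  = λ { x@(flag _ _ _ _ _ _) eq → not-≢ (endOf x) (cong endOf eq) }
    ; connected     = flagsConnected (orbit₃-isEquivalence τ₀-invol τ₁-invol τ₂-invol)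
        (λ x → inj₁ refl ◅ ε) (λ x → inj₂ (inj₂ refl) ◅ ε)
        (λ _ _ _ _ _ → inj₂ (inj₁ refl) ◅ ε) (λ _ _ _ _ _ _ → inj₂ (inj₁ refl) ◅ ε)
    ; vertices      = vertexClasses
    ; edges         = edgeClasses
    ; faces         = faceClasses
    }
    where
    sideOf : Flag → Point
    sideOf (flag _ b _ _ _ _) = b
    cornerOf : Flag → Corner
    cornerOf (flag _ _ c t _ _) = c , t
    τ₁-fixfree : ∀ x → τ₁ x ≢ x
    τ₁-fixfree (flag a b c t true d) eq  = proj₁ (relevant d) (sym (cong pointOf eq))
    τ₁-fixfree (flag a b c t false d) eq = mate-fixfree {a} {b} (proj₁ (relevant d)) (c , t)
      (cong cornerOf {τ₁ (flag a b c t false d)} {flag a b c t false d} eq)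
    τ₂-fixfree : ∀ x → τ₂ x ≢ x
    τ₂-fixfree (flag a b c t e d) eq = proj₂ (proj₂ (relevant d)) (sym (cong sideOf eq))
    someFlag : Flag
    someFlag = flag (i₀ , false) (i₀ , true) (proj₁ (other i₀) , true) t₀ false
      ((λ ()) , proj₂ (other i₀) ∘ sym ∘ cong proj₁ , proj₂ (other i₀) ∘ sym ∘ cong proj₁)

  surface-subgraph : Subgraph (leviGraph (completeHypergraph m n)) surface
  surface-subgraph = record
    { place           = Inverse.to leviVertices
    ; place-injective = ↔-injective leviVertices
    ; place-edge      = λ {u} {v} → place-edge u v
    }
    where
    place-edge : ∀ u v → LeviAdjacent (completeHypergraph m n) u v →
      ∃[ x ] (Inverse.to leviVertices (vertexAt x) ≡ Inverse.to leviVertices u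
            × Inverse.to leviVertices (vertexAt (τ₀ x)) ≡ Inverse.to leviVertices v)
    place-edge (inj₁ i) (inj₂ (S , t)) i∈S = flagOn ((S , t) , position S i∈S) ,
      cong (Inverse.to leviVertices ∘ inj₁) (trans (element-point _) (member-position S i∈S)) ,
      cong (Inverse.to leviVertices ∘ inj₂) (tripleOf-flagOn ((S , t) , position S i∈S))
    place-edge (inj₂ (S , t)) (inj₁ i) i∈S = τ₀ (flagOn ((S , t) , position S i∈S)) ,
      cong (Inverse.to leviVertices ∘ inj₂) (tripleOf-flagOn ((S , t) , position S i∈S)) ,
      cong (Inverse.to leviVertices ∘ inj₁) (trans (element-point _) (member-position S i∈S))

  -- For the constructed surface the Levi graph is the whole 1-skeleton, so the general bound
  -- reduces to `upper`. For `lower`, an edge has at least four flags and a face at most eight.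
  2*#faces : 4 ≤ n → 2 * CellDecomposition.#faces surface ≡ #triples * 3
  2*#faces 4≤n = ℕ.≤-antisym upper lower
    where
    open ℕ.≤-Reasoning
    F E V : ℕ
    F = CellDecomposition.#faces surface
    E = #triples * 3
    V = n + #triples
    upper : 2 * F ≤ E
    upper = ℕ.+-cancelʳ-≤ (E + 2 * V) (2 * F) E (begin
      2 * F + (E + 2 * V)  ≡⟨ regroup F E V ⟩
      2 * (V + F) + E      ≤⟨ levi-euler-bound surface-subgraph 4≤n (Classes.class edgeClasses (flagOn′)) ⟩
      2 * E + 2 * V        ≡⟨ regroup′ E V ⟩
      E + (E + 2 * V)      ∎)
      where
      flagOn′ : Flag
      flagOn′ = proj₁ (Classes.surjective vertexClasses (Inverse.to leviVertices (inj₁ (element (i₀ , false)))))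
      regroup : ∀ F E V → 2 * F + (E + 2 * V) ≡ 2 * (V + F) + E
      regroup = solve-∀
      regroup′ : ∀ E V → 2 * E + 2 * V ≡ E + (E + 2 * V)
      regroup′ = solve-∀
    lower : E ≤ 2 * F
    lower = ℕ.*-cancelˡ-≤ 4 (begin
      4 * E              ≤⟨ Cells.#edges≤#flags surface ⟩
      proj₁ finiteFlag   ≤⟨ #flags≤#faces*8 faceClasses ⟩
      F * 8              ≡⟨ regroup F ⟩
      4 * (2 * F)        ∎)
      where
      regroup : ∀ F → F * 8 ≡ 4 * (2 * F)
      regroup = solve-∀

-- Orientability of the constructed surface

module SurfaceOrientation (k m : ℕ) (θ : Fin k → Fin k → Fin m → Bool) (θ-diagonal : ∀ i t → θ i i t ≡ false)
  (other : (j : Fin k) → ∃[ j′ ] j′ ≢ j) (t₀ : Fin m) (i₀ : Fin k) where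
  open Surface k m θ θ-diagonal other t₀ i₀ public

  orientation : Flag → Bool
  orientation (flag a b c t e d) = o a b c xor e

  orientation-τ₀ : ∀ x → orientation (τ₀ x) ≡ not (orientation x)
  orientation-τ₀ (flag a b c t e d) = sym (Bool.not-distribʳ-xor (o a b c) e)

  orientation-τ₂ : ∀ x → orientation (τ₂ x) ≡ not (orientation x)
  orientation-τ₂ (flag a b c t e d) = let (a≢b , a≢c , b≢c) = relevant d in
    trans (cong (_xor e) (o-swap₂ a≢b a≢c b≢c)) (sym (Bool.not-distribˡ-xor (o a b c) e))

  orientation-exchange : ∀ x → orientation (exchange x) ≡ not (orientation x)
  orientation-exchange (flag a b c t e d) = let (a≢b , a≢c , b≢c) = relevant d in
    trans (cong (_xor e) (o-swap₁ a≢b a≢c b≢c)) (sym (Bool.not-distribˡ-xor (o a b c) e))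

  Untwisted : Point → Point → Set
  Untwisted a b = ∀ i → (a ≡ (i , false) × b ≡ (i , true)) ⊎ (a ≡ (i , true) × b ≡ (i , false)) →
    ∀ l t → θ i l t ≡ false

  orientation-reflect : ∀ a b c t e .d → Untwisted a b →
    orientation (reflect (flag a b c t e d)) ≡ not (orientation (flag a b c t e d))
  orientation-reflect a b c t e d untwisted = let (a≢b , a≢c , b≢c) = relevant d in
    trans (cong (_xor e) (o-mate (c , t) untwisted a≢b (a≢c ∘ sym) (b≢c ∘ sym))) (sym (Bool.not-distribˡ-xor (o a b c) e))

  surface-orientable : (∀ i l t → θ i l t ≡ false) → CellDecomposition.Orientable surface
  surface-orientable untwisted = orientation , λ x → orientation-τ₀ x , orientation-τ₁ x , orientation-τ₂ x
    where
    orientation-τ₁ : ∀ x → orientation (τ₁ x) ≡ not (orientation x)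
    orientation-τ₁ x@(flag _ _ _ _ true _) = orientation-exchange x
    orientation-τ₁ (flag a b c t false d)  = orientation-reflect a b c t false d λ i _ → untwisted i

  -- Any orientation differs from the standard one by a constant, since the flags are
  -- connected without using the transitions between the twisted pair.
  surface-nonorientable : (∀ i → i ≢ i₀ → ∀ l t → θ i l t ≡ false) →
    ∀ l₁ t₁ l₂ t₂ → l₂ ≢ i₀ → (l₁ , t₁) ≢ (l₂ , t₂) →
    θ i₀ l₁ t₁ ≡ true → (∀ l t → (l , t) ≢ (l₁ , t₁) → θ i₀ l t ≡ false) →
    ¬ CellDecomposition.Orientable surface
  surface-nonorientable untwisted l₁ t₁ l₂ t₂ l₂≢i₀ 1≢2 twisted₁ untwisted₁ (or , flips) =
    contradiction (begin
      or x xor orientation x            ≡⟨ constant x (τ₁ x) ⟩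
      or (τ₁ x) xor orientation (τ₁ x)  ≡⟨ cong₂ _xor_ (proj₁ (proj₂ (flips x))) same-orientation ⟩
      not (or x) xor orientation x      ≡⟨ Bool.not-distribˡ-xor (or x) (orientation x) ⟨
      not (or x xor orientation x)      ∎) (Bool.not-¬ refl)
    where
    open ≡-Reasoning
    both-flip : ∀ {x y} → or y ≡ not (or x) → orientation y ≡ not (orientation x) →
      or x xor orientation x ≡ or y xor orientation y
    both-flip {x} {y} p q = sym (trans (cong₂ _xor_ p q) (Bool.xor-annihilates-not (or x) (orientation x)))
    constant : ∀ x y → or x xor orientation x ≡ or y xor orientation y
    constant = flagsConnected {R = λ x y → or x xor orientation x ≡ or y xor orientation y}
      (record { refl = refl ; sym = sym ; trans = trans })
      (λ x → both-flip (proj₁ (flips x)) (orientation-τ₀ x))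
      (λ x → both-flip (proj₂ (proj₂ (flips x))) (orientation-τ₂ x))
      (λ a b c t d → both-flip (proj₁ (proj₂ (flips (flag a b c t true d)))) (orientation-exchange (flag a b c t true d)))
      (λ a b c t d ¬exc → both-flip (proj₁ (proj₂ (flips (flag a b c t false d))))
        (orientation-reflect a b c t false d λ i pair → untwisted i λ { refl → ¬exc pair }))
    l₁≢i₀ : l₁ ≢ i₀
    l₁≢i₀ refl with () ← trans (sym twisted₁) (θ-diagonal l₁ t₁)
    -- Lies on the reversed tetrahedron, at the exceptional pair: the one transition here is twisted
    -- at one end only, so it connects two corners of the same kind.
    x : Flag
    x = flag (i₀ , false) (i₀ , true) (l₁ , false) t₁ false ((λ ()) , l₁≢i₀ ∘ sym ∘ cong proj₁ , l₁≢i₀ ∘ sym ∘ cong proj₁)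
    σ₁ : Index
    σ₁ = rotation (triangles i₀) (l₁ , t₁)
    -- A second tetrahedron is essential: if the rotation fixed the reversed one, both ends of the
    -- transition would be twisted and the effect would cancel.
    σ₁≢ : σ₁ ≢ (l₁ , t₁)
    σ₁≢ = rotation-moves (triangles-unique i₀) (∈-triangles⁺ l₁≢i₀) (∈-triangles⁺ l₂≢i₀) 1≢2
    mate-x : mate (i₀ , false) (i₀ , true) ((l₁ , false) , t₁) ≡ ((proj₁ σ₁ , false) , proj₂ σ₁)
    mate-x = begin
      mixed i₀ i₀ ((l₁ , false) , t₁)              ≡⟨ cong (λ q → mixed i₀ i₀ ((l₁ , not q) , t₁)) twisted₁ ⟨
      mixed i₀ i₀ (twist i₀ ((l₁ , true) , t₁))    ≡⟨ loop-twisted i₀ l₁ t₁ ⟩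
      twist i₀ ((proj₁ σ₁ , false) , proj₂ σ₁)     ≡⟨ cong (λ q → (proj₁ σ₁ , q) , proj₂ σ₁) (untwisted₁ _ _ σ₁≢) ⟩
      ((proj₁ σ₁ , false) , proj₂ σ₁)              ∎
    same-orientation : orientation (τ₁ x) ≡ orientation x
    same-orientation = cong (_xor false) (trans (cong (o (i₀ , false) (i₀ , true) ∘ proj₁) mate-x)
      (trans (o-tetrahedron₃ false (σ-≢ l₁≢i₀)) (sym (o-tetrahedron₃ false l₁≢i₀))))

-- Euler characteristics

euler⇒balance : ∀ {v e f c} → (ℤ.+ v ℤ.- ℤ.+ e) ℤ.+ ℤ.+ f ≡ ℤ.+ 2 ℤ.- ℤ.+ c → v + f + c ≡ e + 2
euler⇒balance {v} {e} {f} {c} eq = ℤ.+-injective (begin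
  ℤ.+ (v + f + c)                                            ≡⟨ regroup (ℤ.+ v) (ℤ.+ e) (ℤ.+ f) (ℤ.+ c) ⟩
  (ℤ.+ v ℤ.- ℤ.+ e) ℤ.+ ℤ.+ f ℤ.+ (ℤ.+ e ℤ.+ ℤ.+ c)          ≡⟨ cong (ℤ._+ (ℤ.+ e ℤ.+ ℤ.+ c)) eq ⟩
  (ℤ.+ 2 ℤ.- ℤ.+ c) ℤ.+ (ℤ.+ e ℤ.+ ℤ.+ c)                    ≡⟨ regroup′ (ℤ.+ 2) (ℤ.+ e) (ℤ.+ c) ⟩
  ℤ.+ (e + 2)                                                ∎)
  where
  open ≡-Reasoning
  regroup : ∀ v e f c → v ℤ.+ f ℤ.+ c ≡ (v ℤ.- e) ℤ.+ f ℤ.+ (e ℤ.+ c)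
  regroup = solve-∀-ℤ
  regroup′ : ∀ d e c → (d ℤ.- c) ℤ.+ (e ℤ.+ c) ≡ e ℤ.+ d
  regroup′ = solve-∀-ℤ

balance⇒euler : ∀ {v e f c} → v + f + c ≡ e + 2 → (ℤ.+ v ℤ.- ℤ.+ e) ℤ.+ ℤ.+ f ≡ ℤ.+ 2 ℤ.- ℤ.+ c
balance⇒euler {v} {e} {f} {c} eq = begin
  (ℤ.+ v ℤ.- ℤ.+ e) ℤ.+ ℤ.+ f           ≡⟨ regroup (ℤ.+ v) (ℤ.+ e) (ℤ.+ f) (ℤ.+ c) ⟩
  ℤ.+ (v + f + c) ℤ.- (ℤ.+ e ℤ.+ ℤ.+ c)  ≡⟨ cong (λ x → ℤ.+ x ℤ.- (ℤ.+ e ℤ.+ ℤ.+ c)) eq ⟩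
  ℤ.+ (e + 2) ℤ.- (ℤ.+ e ℤ.+ ℤ.+ c)      ≡⟨ regroup′ (ℤ.+ 2) (ℤ.+ e) (ℤ.+ c) ⟩
  ℤ.+ 2 ℤ.- ℤ.+ c                        ∎
  where
  open ≡-Reasoning
  regroup : ∀ v e f c → (v ℤ.- e) ℤ.+ f ≡ (v ℤ.+ f ℤ.+ c) ℤ.- (e ℤ.+ c)
  regroup = solve-∀-ℤ
  regroup′ : ∀ d e c → (e ℤ.+ d) ℤ.- (e ℤ.+ c) ≡ d ℤ.- c
  regroup′ = solve-∀-ℤ

-- For n = 2 k the number of triples is `4 * ∑² k`, and the genus is `∑² k * m` diminished by k - 1.
-- The sum thus replaces the fractions of the formula.
∑² : ℕ → ℕ
∑² zero    = 0
∑² (suc k) = ∑² k + k * k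

6*∑² : ∀ k → 6 * ∑² (suc k) ≡ k * suc k * suc (2 * k)
6*∑² zero    = refl
6*∑² (suc k) = begin
  6 * (∑² (suc k) + suc k * suc k)               ≡⟨ ℕ.*-distribˡ-+ 6 (∑² (suc k)) (suc k * suc k) ⟩
  6 * ∑² (suc k) + 6 * (suc k * suc k)           ≡⟨ cong (_+ 6 * (suc k * suc k)) (6*∑² k) ⟩
  k * suc k * suc (2 * k) + 6 * (suc k * suc k)  ≡⟨ rearrange k ⟩
  suc k * suc (suc k) * suc (2 * suc k)          ∎
  where
  open ≡-Reasoning
  rearrange : ∀ k → k * suc k * suc (2 * k) + 6 * (suc k * suc k) ≡ suc k * suc (suc k) * suc (2 * suc k)
  rearrange = solve-∀

private
  -- Multiplication distributes over truncated subtraction too, so each term can be rescaled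
  -- separately.
  *-∸-balance : ∀ c d a p {x y g} → a * p ≡ c * x → a * d ≡ c * y → g + y ≡ x → c * g ≡ a * (p ∸ d)
  *-∸-balance c d a p {x} {y} {g} eq eq′ refl = sym (begin
    a * (p ∸ d)                ≡⟨ ℕ.*-distribˡ-∸ a p d ⟩
    a * p ∸ a * d              ≡⟨ cong₂ _∸_ eq eq′ ⟩
    c * (g + y) ∸ c * y        ≡⟨ ℕ.*-distribˡ-∸ c (g + y) y ⟨
    c * (g + y ∸ y)            ≡⟨ cong (c *_) (ℕ.m+n∸n≡m g y) ⟩
    c * g                      ∎)
    where open ≡-Reasoning

genus-formula : ∀ m q g → g + suc q ≡ ∑² (suc (suc q)) * m →
  24 * g ≡ (suc (suc q) * 2 ∸ 2) * (m * (suc (suc q) * 2) * (suc (suc q) * 2 ∸ 1) ∸ 12)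
genus-formula m q g = *-∸-balance 24 12 (suc q * 2) (m * (suc (suc q) * 2) * suc (suc q * 2)) {y = suc q} {g}
    (begin
      (suc q * 2) * (m * (suc (suc q) * 2) * suc (suc q * 2))   ≡⟨ rearrange q m ⟩
      m * (4 * (suc q * suc (suc q) * suc (2 * suc q)))         ≡⟨ cong (λ x → m * (4 * x)) (6*∑² (suc q)) ⟨
      m * (4 * (6 * ∑² (suc (suc q))))                          ≡⟨ rearrange′ m (∑² (suc (suc q))) ⟩
      24 * (∑² (suc (suc q)) * m)                               ∎)
    (rearrange″ q)
  where
  open ≡-Reasoning
  rearrange : ∀ q m → (suc q * 2) * (m * (suc (suc q) * 2) * suc (suc q * 2)) ≡ m * (4 * (suc q * suc (suc q) * suc (2 * suc q)))
  rearrange = solve-∀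
  rearrange′ : ∀ m s → m * (4 * (6 * s)) ≡ 24 * (s * m)
  rearrange′ = solve-∀
  rearrange″ : ∀ q → suc q * 2 * 12 ≡ 24 * suc q
  rearrange″ = solve-∀

-- n = 2 (2 + q) and m = 1 + r.
module _ (q r : ℕ) where

  private
    k m n h : ℕ
    k = suc (suc q)
    m = suc r
    n = k * 2
    h = ∑² k * m ∸ suc q

    4≤n : 4 ≤ n
    4≤n = s≤s (s≤s (s≤s (s≤s z≤n)))

    nC3 : n C 3 ≡ 4 * ∑² k
    nC3 = ℕ.*-cancelˡ-≡ _ _ 6 (begin
      6 * (n C 3)                             ≡⟨ 6*[2+n]C3 (suc q * 2) ⟩
      n * suc (suc q * 2) * (suc q * 2)       ≡⟨ rearrange q ⟩
      4 * (suc q * k * suc (2 * suc q))       ≡⟨ cong (4 *_) (6*∑² (suc q)) ⟨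
      4 * (6 * ∑² k)                          ≡⟨ rearrange′ (∑² k) ⟩
      6 * (4 * ∑² k)                          ∎)
      where
      open ≡-Reasoning
      rearrange : ∀ q → suc (suc q) * 2 * suc (suc q * 2) * (suc q * 2) ≡ 4 * (suc q * suc (suc q) * suc (2 * suc q))
      rearrange = solve-∀
      rearrange′ : ∀ s → 4 * (6 * s) ≡ 6 * (4 * s)
      rearrange′ = solve-∀

    h-spec : h + suc q ≡ ∑² k * m
    h-spec = ℕ.m∸n+n≡m (begin
      suc q              ≤⟨ ℕ.m≤m+n (suc q) (q * suc q) ⟩
      suc q * suc q      ≤⟨ ℕ.m≤n+m (suc q * suc q) (∑² (suc q)) ⟩
      ∑² k               ≤⟨ ℕ.m≤m*n (∑² k) m ⟩
      ∑² k * m           ∎)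
      where open ℕ.≤-Reasoning

    G : SimpleGraph
    G = leviGraph (completeHypergraph m n)

    open Levi m n using (#triples; levi-euler-bound)

    #triples-spec : #triples ≡ 4 * (h + suc q)
    #triples-spec = trans (cong (_* m) nC3) (trans (ℕ.*-assoc 4 (∑² k) m) (cong (4 *_) (sym h-spec)))

    -- Phrased through the Euler characteristic so as to serve every kind of surface: c is the
    -- number of crosscaps, twice the orientable genus, or 0 for the sphere.
    2*h≤ : ∀ S c → CellDecomposition.eulerCharacteristic S ≡ ℤ.+ 2 ℤ.- ℤ.+ c → Subgraph G S → 2 * h ≤ c
    2*h≤ S c χ emb = ℕ.*-cancelˡ-≤ 2 (ℕ.+-cancelʳ-≤ (2 * (E + 2) + 4 * (h + suc q) * 3 + 4 * suc q) _ _ (begin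
      2 * (2 * h) + (2 * (E + 2) + T′ * 3 + 4 * suc q)             ≡⟨ cong (λ x → 2 * (2 * h) + (2 * x + T′ * 3 + 4 * suc q)) (euler⇒balance {V} {E} {F} {c} χ) ⟨
      2 * (2 * h) + (2 * (V + F + c) + T′ * 3 + 4 * suc q)         ≡⟨ rearrange h V F c q ⟩
      (2 * (V + F) + T′ * 3) + (2 * c + 4 * (h + suc q))           ≤⟨ ℕ.+-monoˡ-≤ (2 * c + 4 * (h + suc q)) bound ⟩
      (2 * E + 2 * (n + T′)) + (2 * c + 4 * (h + suc q))           ≡⟨ rearrange′ h E c q ⟩
      2 * c + (2 * (E + 2) + T′ * 3 + 4 * suc q)                   ∎))
      where
      open ℕ.≤-Reasoning
      V E F T′ : ℕ
      V = CellDecomposition.#vertices S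
      E = CellDecomposition.#edges S
      F = CellDecomposition.#faces S
      T′ = 4 * (h + suc q)
      j₀ : Fin (#triples * 3)
      j₀ = subst Fin (sym (cong (_* 3) (trans #triples-spec (cong (4 *_) (ℕ.+-suc h q))))) zero
      bound : 2 * (V + F) + T′ * 3 ≤ 2 * E + 2 * (n + T′)
      bound = subst (λ t → 2 * (V + F) + t * 3 ≤ 2 * E + 2 * (n + t)) #triples-spec (levi-euler-bound emb 4≤n j₀)
      rearrange : ∀ h V F c q → 2 * (2 * h) + (2 * (V + F + c) + 4 * (h + suc q) * 3 + 4 * suc q) ≡
        (2 * (V + F) + 4 * (h + suc q) * 3) + (2 * c + 4 * (h + suc q))
      rearrange = solve-∀
      rearrange′ : ∀ h E c q → (2 * E + 2 * (suc (suc q) * 2 + 4 * (h + suc q))) + (2 * c + 4 * (h + suc q)) ≡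
        2 * c + (2 * (E + 2) + 4 * (h + suc q) * 3 + 4 * suc q)
      rearrange′ = solve-∀

    other : (j : Fin k) → ∃[ j′ ] j′ ≢ j
    other zero    = suc zero , λ ()
    other (suc j) = zero , λ ()

    module _ (θ : Fin k → Fin k → Fin m → Bool) (θ-diagonal : ∀ i t → θ i i t ≡ false) where
      open SurfaceOrientation k m θ θ-diagonal other zero zero using (surface; 2*#faces)

      surface-euler : CellDecomposition.eulerCharacteristic surface ≡ ℤ.+ 2 ℤ.- ℤ.+ (2 * h)
      surface-euler = balance⇒euler {n + #triples} {#triples * 3} {CellDecomposition.#faces surface} {2 * h}
        (ℕ.*-cancelˡ-≡ _ _ 2 (begin
          2 * (n + #triples + F + 2 * h)          ≡⟨ regroup n #triples F h ⟩
          2 * F + (2 * (n + #triples) + 4 * h)    ≡⟨ cong (_+ (2 * (n + #triples) + 4 * h)) (2*#faces 4≤n) ⟩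
          #triples * 3 + (2 * (n + #triples) + 4 * h) ≡⟨ cong (λ t → t * 3 + (2 * (n + t) + 4 * h)) #triples-spec ⟩
          T′ * 3 + (2 * (n + T′) + 4 * h)         ≡⟨ rearrange h q ⟩
          2 * (T′ * 3 + 2)                        ≡⟨ cong (λ t → 2 * (t * 3 + 2)) #triples-spec ⟨
          2 * (#triples * 3 + 2)                  ∎))
        where
        open ≡-Reasoning
        F T′ : ℕ
        F = CellDecomposition.#faces surface
        T′ = 4 * (h + suc q)
        regroup : ∀ n T F h → 2 * (n + T + F + 2 * h) ≡ 2 * F + (2 * (n + T) + 4 * h)
        regroup = solve-∀
        rearrange : ∀ h q → 4 * (h + suc q) * 3 + (2 * (suc (suc q) * 2 + 4 * (h + suc q)) + 4 * h) ≡
          2 * (4 * (h + suc q) * 3 + 2)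
        rearrange = solve-∀

    embedsInOrientable : EmbedsInOrientable G h
    embedsInOrientable = surface , (surface-orientable (λ _ _ _ → refl) , surface-euler (λ _ _ _ → false) (λ _ _ → refl)) ,
        surface-subgraph
      where open SurfaceOrientation k m (λ _ _ _ → false) (λ _ _ → refl) other zero zero

    -- Reverses the first copy of the tetrahedron on the first two antipodal pairs, seen from the
    -- first pair only.
    θ₁ : Fin k → Fin k → Fin m → Bool
    θ₁ zero (suc zero) zero = true
    θ₁ _    _          _    = false

    θ₁-diagonal : ∀ i t → θ₁ i i t ≡ false
    θ₁-diagonal zero    t = refl
    θ₁-diagonal (suc i) t = refl

    embedsInNonOrientable : (l₂ : Fin k) (t₂ : Fin m) → l₂ ≢ zero → (suc zero , zero) ≢ (l₂ , t₂) → h ≢ 0 →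
      EmbedsInNonOrientable G (2 * h)
    embedsInNonOrientable l₂ t₂ l₂≢0 1≢2 h≢0 = surface ,
        (surface-nonorientable untwisted (suc zero) zero l₂ t₂ l₂≢0 1≢2 refl untwisted₁ , 1≤2h , surface-euler θ₁ θ₁-diagonal) ,
        surface-subgraph
      where
      open SurfaceOrientation k m θ₁ θ₁-diagonal other zero zero
      1≤2h : 1 ≤ 2 * h
      1≤2h = ℕ.≤-trans (ℕ.n≢0⇒n>0 h≢0) (ℕ.m≤m+n h (h + 0))
      untwisted : ∀ i → i ≢ zero → ∀ l t → θ₁ i l t ≡ false
      untwisted zero    i≢0 l t = contradiction refl i≢0
      untwisted (suc i) i≢0 l t = refl
      untwisted₁ : ∀ l t → (l , t) ≢ (suc zero , zero) → θ₁ zero l t ≡ false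
      untwisted₁ zero          t       ne = refl
      untwisted₁ (suc zero)    zero    ne = contradiction refl ne
      untwisted₁ (suc zero)    (suc t) ne = refl
      untwisted₁ (suc (suc l)) t       ne = refl

  genus-even : ∃[ g ] (Genus (completeHypergraph m n) g × g + suc q ≡ ∑² k * m)
  genus-even = h , (embedsInOrientable ,
      λ { j (S , (_ , χ) , emb) → ℕ.*-cancelˡ-≤ 2 (2*h≤ S (2 * j) χ emb) }) , h-spec

  nonOrientableGenus-even : ∃[ g ] (NonOrientableGenus (completeHypergraph m n) (2 * g) × g + suc q ≡ ∑² k * m)
  nonOrientableGenus-even = h , cases (h ℕ.≟ 0) , h-spec
    where
    -- Only for n = 4 and m = 1 is there a single tetrahedron at the first pair, and then h is 0.
    -- Otherwise a third antipodal pair or a second copy provides another one.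
    second : h ≢ 0 → ∃[ l₂ ] ∃[ t₂ ] (l₂ ≢ zero × _≢_ {A = Fin k × Fin m} (suc zero , zero) (l₂ , t₂))
    second h≢0 = at q r h≢0
      where
      at : ∀ q r → ∑² (suc (suc q)) * suc r ∸ suc q ≢ 0 →
        ∃[ l₂ ] ∃[ t₂ ] (l₂ ≢ zero × _≢_ {A = Fin (suc (suc q)) × Fin (suc r)} (suc zero , zero) (l₂ , t₂))
      at (suc q) r       _  = suc (suc zero) , zero , (λ ()) , λ ()
      at zero    (suc r) _  = suc zero , suc zero , (λ ()) , λ ()
      at zero    zero    ne = contradiction refl ne
    cases : Dec (h ≡ 0) → NonOrientableGenus (completeHypergraph m n) (2 * h)
    -- The orientable embedding is then in the sphere, and the non-orientable genus is 0 by
    -- convention.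
    cases (yes h≡0) = inj₁ (subst (EmbedsInOrientable G) h≡0 embedsInOrientable , cong (2 *_) h≡0)
    cases (no h≢0) with second h≢0
    ... | l₂ , t₂ , l₂≢0 , 1≢2 = inj₂
      ( (λ { (S , (_ , χ) , emb) → h≢0 (ℕ.n≤0⇒n≡0 (ℕ.*-cancelˡ-≤ 2 (2*h≤ S 0 χ emb))) })
      , embedsInNonOrientable l₂ t₂ l₂≢0 1≢2 h≢0
      , λ { j (S , (_ , _ , χ) , emb) → 2*h≤ S j χ emb })

theorem1p4 : (m n : ℕ) → 1 ≤ m → 4 ≤ n → 2 ∣ n →
    (∃[ g ] (Genus (completeHypergraph m n) g
    × 24 * g ≡ (n ∸ 2) * (m * n * (n ∸ 1) ∸ 12)))
    × (∃[ c ] (NonOrientableGenus (completeHypergraph m n) c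
    × 12 * c ≡ (n ∸ 2) * (m * n * (n ∸ 1) ∸ 12)))
theorem1p4 (suc r) .(suc (suc q) * 2) _ _ (divides (suc (suc q)) refl) =
  (g , proj₁ (proj₂ orientable) , genus-formula (suc r) q g (proj₂ (proj₂ orientable))) ,
  (2 * g′ , proj₁ (proj₂ nonOrientable) ,
    trans (sym (ℕ.*-assoc 12 2 g′)) (genus-formula (suc r) q g′ (proj₂ (proj₂ nonOrientable))))
  where
  orientable = genus-even q r
  nonOrientable = nonOrientableGenus-even q r
  g g′ : ℕ
  g = proj₁ orientable
  g′ = proj₁ nonOrientable
theorem1p4 (suc r) .(zero * 2) _ () (divides zero refl)
theorem1p4 (suc r) .(suc zero * 2) _ (s≤s (s≤s ())) (divides (suc zero) refl)
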